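{- Let $(\mathcal N,\mathcal O,\mathfrak l)$ be a plabic network containing the square configuration described in the context, with square edges $h_1,\dots,h_4$ of weights $\alpha_1,\dots,\alpha_4$ carrying the edge vectors $F_1,\dots,F_4$, and let $\tilde F_1,\dots,\tilde F_4$ be the edge vectors at the corresponding edges after the square move, with $\tilde\alpha_1,\dots,\tilde\alpha_4$ the new weights. Then $$\tilde F_4=\tilde\alpha_4\alpha_3^{ -1}(-1)^{\mathrm{int}(h_3)+\mathrm{int}(h_4)+\gamma_2(h_4)+\mathrm{wind}(h_3,h_4)+1}F_3+\tilde\alpha_4(-1)^{\mathrm{int}(h_4)+\gamma_2(h_4)}F_4,$$ $$\tilde F_2=\alpha_1(-1)^{\mathrm{int}(h_1)+\gamma_2(h_4)+\mathrm{wind}(h_2,-h_4)+\mathrm{wind}(h_3,h_4)+1}F_3+\alpha_2\alpha_4^{ -1}(-1)^{1+\mathrm{int}(h_2)+\mathrm{int}(h_4)+\gamma_2(h_4)+\mathrm{wind}(h_2,-h_4)}F_4,$$ $$\tilde F_1=\tilde\alpha_1(-1)^{\mathrm{int}(h_1)+\mathrm{wind}(-h_1,h_2)}\tilde F_2,$$ $$\tilde F_3=(-1)^{\mathrm{int}(h_3)+\mathrm{int}(h_4)+\gamma_2(h_4)+\mathrm{wind}(h_3,h_4)+1}\,\alpha_2\alpha_1^{ -1}\,\tilde F_4 .$$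
   Context: **Plabic networks.** Let $D$ be a closed convex disk whose boundary contains a straight segment. A plabic graph is a finite directed planar graph embedded in $D$ with straight edges. It has boundary vertices $b_1,\dots,b_n$ on the segment, labelled clockwise, each of degree 1 (a source if its edge is outgoing, a sink otherwise). The remaining (internal) vertices lie inside $D$ and have degree 2 or 3. No component is isolated from the boundary. The graph is perfect: each internal vertex has exactly one incoming edge (then it is white) or exactly one outgoing edge (then it is black); bivalent vertices have one incoming and one outgoing edge and either color. The orientation $\mathcal O$ is called a perfect orientation. A network $\mathcal N$ has a positive weight $w_e$ on each directed edge. **Gauge rays.** A gauge ray direction $\mathfrak l$ is an oriented direction, not parallel to any edge, such that the rays with direction $\mathfrak l$ starting at boundary vertices point inside $D$ and contain no internal vertices. The gauge rays are those starting at the boundary sources, and $\mathrm{int}(e)$ is the number of their intersections with $e$ (base points not counted). **Winding.** $s(a,b)=+1,0,-1$ if the ordered pair $(a,b)$ is positively oriented, parallel, negatively oriented. For consecutive directed edges: $\mathrm{wind}(e,f)=\pm1$ if $s(e,f)=s(e,\mathfrak l)=s(\mathfrak l,f)=\pm1$; otherwise $0$. $\gamma_2(e)=\frac{1-s(e,\mathfrak l)}2$. $-h$ denotes the edge $h$ with reversed direction. **Edge vectors.** The edge vectors are the unique solution of $E_e=(-1)^{\mathrm{int}(e)}w_e\sum_f(-1)^{\mathrm{wind}(e,f)}E_f$ (for every edge $e$ ending at an internal vertex $V$, $f$ running over the edges outgoing at $V$), with $E_{e_j}=(-1)^{\mathrm{int}(e_j)}w_{e_j}E_j$ at the edge $e_j$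 ending at the sink $b_j$, $E_j$ being the $j$-th canonical basis vector of $\mathbb R^n$. **Square configuration.** Four trivalent vertices $S,P,Q,R$ bound a quadrilateral face and appear in this order clockwise around it; $S,Q$ are white and $P,R$ black. Directed square edges: $h_1=(S,P)$, $h_2=(S,R)$, $h_3=(P,Q)$, $h_4=(Q,R)$, with weights $\alpha_1,\alpha_2,\alpha_3,\alpha_4$. The remaining edges at $S,P,R,Q$ (outside the square) are $e_1$ incoming at $S$, $e_2$ incoming at $P$, $e_3$ outgoing at $R$, $e_4$ outgoing at $Q$. In particular the directions $h_4,e_4,-h_3$ at $Q$ and $-h_2,e_3,-h_4$ at $R$ are each in counterclockwise cyclic order. **Square move.** The colors of the four vertices are switched, vertices keep their positions, the edges $h_1$ and $h_4$ are reversed (becoming $-h_1=(P,S)$ and $-h_4=(R,Q)$), all other orientations and all weights outside the square are unchanged, and the new weights of $-h_1,h_2,h_3,-h_4$ are $$\tilde\alpha_1=\frac{\alpha_3\alpha_4}{\tilde\alpha_2},\quad\tilde\alpha_2=\alpha_2+\alpha_1\alpha_3\alpha_4,\quad\tilde\alpha_3=\frac{\alpha_2\alpha_3}{\tilde\alpha_2},\quad\tilde\alpha_4=\frac{\alpha_1\alpha_3}{\tilde\alpha_2}.$$ $F_i$ is the edge vector at $h_i$ before the move; $\tilde F_1,\tilde F_2,\tilde F_3,\tilde F_4$ are the edge vectors at $-h_1,h_2,h_3,-h_4$ after the move. -}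

module Defs where

open import Algebra.Bundles using (CommutativeRing)
import Algebra.Properties.Ring as RingProperties
import Algebra.Properties.Semiring.Exp as Exp
open import Data.Bool.Base using (Bool; true; false; if_then_else_; _∧_; _∨_)
open import Data.Fin.Base as Fin using (Fin)
import Data.Fin.Properties as Fin
open import Data.Integer.Base as ℤ using (ℤ; 0ℤ; 1ℤ; -1ℤ; +_; ∣_∣)
import Data.Integer.DivMod as ℤ
import Data.Integer.Properties as ℤ
open import Data.List.Base using (List; allFin; filter; foldr; length)
open import Data.Nat.Base as ℕ using (ℕ)
open import Data.Product.Base using (∃; ∃-syntax; _×_; _,_; proj₁; proj₂)
open import Data.Sum.Base using (_⊎_; inj₁; inj₂; [_,_]′)
import Data.Sum.Properties as Sum
open import Data.Vec.Functional using (Vector)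
open import Level using (0ℓ)
open import Relation.Binary.Construct.Closure.Equivalence using (EqClosure)
open import Relation.Binary.Construct.StrictToNonStrict using () renaming (_≤_ to NonStrict)
open import Relation.Binary.Core using (Rel)
open import Relation.Binary.Definitions using (DecidableEquality; tri<; tri≈; tri>)
open import Relation.Binary.PropositionalEquality.Core using (_≡_; _≢_)
open import Relation.Binary.Structures using (IsStrictTotalOrder)
import Relation.Binary.Reasoning.Setoid as SetoidReasoning
open import Relation.Nullary.Decidable using (Dec; does; yes; no; _×-dec_; _⊎-dec_; map′; ⌊_⌋)
open import Relation.Nullary.Negation using (¬_)

-- The real numbers, axiomatised as a Dedekind-complete ordered field (these
-- axioms determine ℝ up to isomorphism).  The value of 0# ⁻¹ is unspecified.
record RealNumbers : Set₁ where
  infix  4 _<_ _≤_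
  infix  8 _⁻¹
  infixl 7 _÷_
  field
    commutativeRing : CommutativeRing 0ℓ 0ℓ
  open CommutativeRing commutativeRing public
  field
    _<_                : Rel Carrier 0ℓ
    isStrictTotalOrder : IsStrictTotalOrder _≈_ _<_
    0<1                : 0# < 1#
    +-monoˡ-<          : ∀ {x y} z → x < y → x + z < y + z
    *-pos              : ∀ {x y} → 0# < x → 0# < y → 0# < x * y
    _⁻¹                : Carrier → Carrier
    ⁻¹-cong            : ∀ {x y} → x ≈ y → x ⁻¹ ≈ y ⁻¹
    *-inverseʳ         : ∀ {x} → ¬ (x ≈ 0#) → x * x ⁻¹ ≈ 1#

  _≤_ : Rel Carrier 0ℓ
  _≤_ = NonStrict _≈_ _<_

  _÷_ : Carrier → Carrier → Carrier
  x ÷ y = x * y ⁻¹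

  IsUpperBound : (Carrier → Set) → Carrier → Set
  IsUpperBound X b = ∀ x → X x → x ≤ b

  field
    complete : (X : Carrier → Set) → ∃ X → ∃ (IsUpperBound X) →
               ∃[ s ] IsUpperBound X s × (∀ b → IsUpperBound X b → s ≤ b)

  module < = IsStrictTotalOrder isStrictTotalOrder

module Plabic (ℝ : RealNumbers) where

  open RealNumbers ℝ public hiding (zero)
  open RingProperties ring using (-‿distribˡ-*; -‿distribʳ-*; -‿involutive; -‿+-comm)

  infixl 6 _+ᵥ_ _-ᵥ_
  infixr 7 _•_
  infix  8 -ᵥ_
  infix  4 _≈ᵥ_

  Point : Set
  Point = Carrier × Carrier

  _≈ᵥ_ : Rel Point 0ℓ
  (x , y) ≈ᵥ (x′ , y′) = x ≈ x′ × y ≈ y′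

  _+ᵥ_ _-ᵥ_ : Point → Point → Point
  (x , y) +ᵥ (x′ , y′) = x + x′ , y + y′
  (x , y) -ᵥ (x′ , y′) = x - x′ , y - y′

  -ᵥ_ : Point → Point
  -ᵥ (x , y) = - x , - y

  _•_ : Carrier → Point → Point
  t • (x , y) = t * x , t * y

  cross : Point → Point → Carrier
  cross (x , y) (x′ , y′) = x * y′ - y * x′

  OnSegment : Point → Point → Point → Set
  OnSegment p q x = ∃[ s ] 0# ≤ s × s ≤ 1# × x ≈ᵥ p +ᵥ s • (q -ᵥ p)

  OnOpenSegment : Point → Point → Point → Set
  OnOpenSegment p q x = ∃[ s ] 0# < s × s < 1# × x ≈ᵥ p +ᵥ s • (q -ᵥ p)

  -- The base point b does not belong to the ray.
  OnRay : Point → Point → Point → Set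
  OnRay b 𝔩 x = ∃[ t ] 0# < t × x ≈ᵥ b +ᵥ t • 𝔩

  RayMeetsSegment : (b 𝔩 p q : Point) → Set
  RayMeetsSegment b 𝔩 p q = ∃[ x ] OnRay b 𝔩 x × OnSegment p q x

  Near : Carrier → Point → Point → Set
  Near ε (x , y) (x′ , y′) =
    (x - ε < x′ × x′ < x + ε) × (y - ε < y′ × y′ < y + ε)

  Interior : (Point → Set) → Point → Set
  Interior X x = ∃[ ε ] 0# < ε × (∀ y → Near ε x y → X y)

  -- A compact convex set with nonempty interior, together with a
  -- nondegenerate segment [A,B] in its boundary.  The endpoints are named so
  -- that A → B is the clockwise direction of the boundary: D lies in the
  -- closed half-plane to the right of the line AB.  This makes [A,B] a part
  -- of the boundary.
  record Disk : Set₁ where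
    field
      D         : Point → Set
      convex    : ∀ {p q x} → D p → D q → OnSegment p q x → D x
      closed    : ∀ {x} → (∀ ε → 0# < ε → ∃[ y ] D y × Near ε x y) → D x
      bounded   : ∃[ M ] (∀ {x} → D x → Near M (0# , 0#) x)
      solid     : ∃ (Interior D)
      A B       : Point
      A∈D       : D A
      B∈D       : D B
      A≉B       : ¬ (A ≈ᵥ B)
      clockwise : ∀ {x} → D x → cross (B -ᵥ A) (x -ᵥ A) ≤ 0#

  -- (a,b,c) is a nondegenerate triangle traversed clockwise.
  CW : Point → Point → Point → Set
  CW a b c = cross (b -ᵥ a) (c -ᵥ a) < 0#

  InTriangle : (a b c x : Point) → Set
  InTriangle a b c x = CW a b x × CW b c x × CW c a x

  -- A simple quadrilateral (convex or not) has a diagonal inside it; cutting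
  -- along it gives two triangles traversed in the same sense as the
  -- quadrilateral.  `Cut a b c d` : abcd is clockwise and ac is such a diagonal.
  Cut : (a b c d : Point) → Set
  Cut a b c d = CW a b c × CW a c d

  ClockwiseQuadrilateral : (a b c d : Point) → Set
  ClockwiseQuadrilateral a b c d = Cut a b c d ⊎ Cut b c d a

  InCut : (a b c d x : Point) → Set
  InCut a b c d x =
    Cut a b c d × (InTriangle a b c x ⊎ InTriangle a c d x ⊎ OnOpenSegment a c x)

  -- The open region bounded by a clockwise simple quadrilateral.
  InQuadrilateral : (a b c d x : Point) → Set
  InQuadrilateral a b c d x = InCut a b c d x ⊎ InCut b c d a x

  -- Turning counterclockwise from u, one meets v and then w: equivalently, at
  -- most one of the three counterclockwise angles u→v, v→w, w→u is ≥ π.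
  CyclicCCW : (u v w : Point) → Set
  CyclicCCW u v w = (0# < cross u v × 0# < cross v w)
                  ⊎ (0# < cross v w × 0# < cross w u)
                  ⊎ (0# < cross w u × 0# < cross u v)

  open Exp semiring using (_^_)

  -- For negative z this is right because (-1)^z = (-1)^(-z).
  [-1]^_ : ℤ → Carrier
  [-1]^ z = (- 1#) ^ ∣ z ∣

  s : Point → Point → ℤ
  s a b with <.compare 0# (cross a b)
  ... | tri< _ _ _ = 1ℤ
  ... | tri≈ _ _ _ = 0ℤ
  ... | tri> _ _ _ = -1ℤ

  -- The gauge direction is the first argument.
  wind : Point → Point → Point → ℤ
  wind 𝔩 e f = if ⌊ s e f ℤ.≟ s e 𝔩 ⌋ ∧ ⌊ s e 𝔩 ℤ.≟ s 𝔩 f ⌋ then s e f else 0ℤ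

  γ₂ : Point → Point → ℤ
  γ₂ 𝔩 e = (1ℤ ℤ.- s e 𝔩) ℤ./ + 2

  open SetoidReasoning setoid

  module PlaneLemmas where

    -‿congˡ : ∀ {x y z} → x ≈ y → z - x ≈ z - y
    -‿congˡ p = +-congˡ (-‿cong p)

    cancel : ∀ x y z → (x - y) + (y - z) ≈ x - z
    cancel x y z = begin
      (x - y) + (y - z)    ≈⟨ +-assoc x (- y) (y - z) ⟩
      x + (- y + (y - z))  ≈⟨ +-congˡ (+-assoc (- y) y (- z)) ⟨
      x + ((- y + y) - z)  ≈⟨ +-congˡ (+-congʳ (-‿inverseˡ y)) ⟩
      x + (0# - z)         ≈⟨ +-congˡ (+-identityˡ (- z)) ⟩
      x - z                ∎

    *-distribˡ-- : ∀ x y z → x * (y - z) ≈ x * y - x * z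
    *-distribˡ-- x y z = trans (distribˡ x y (- z)) (+-congˡ (sym (-‿distribʳ-* x z)))

    *-distribʳ-- : ∀ x y z → (y - z) * x ≈ y * x - z * x
    *-distribʳ-- x y z = trans (distribʳ x y (- z)) (+-congˡ (sym (-‿distribˡ-* z x)))

    neg-- : ∀ x y → - (x - y) ≈ y - x
    neg-- x y = begin
      - (x - y)      ≈⟨ -‿+-comm x (- y) ⟨
      - x + - - y    ≈⟨ +-congˡ (-‿involutive y) ⟩
      - x + y        ≈⟨ +-comm (- x) y ⟩
      y - x          ∎

    +-interchange : ∀ a b c d → (a + b) + (c + d) ≈ (a + c) + (b + d)
    +-interchange a b c d = begin
      (a + b) + (c + d)  ≈⟨ +-assoc a b (c + d) ⟩
      a + (b + (c + d))  ≈⟨ +-congˡ (+-assoc b c d) ⟨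
      a + ((b + c) + d)  ≈⟨ +-congˡ (+-congʳ (+-comm b c)) ⟩
      a + ((c + b) + d)  ≈⟨ +-congˡ (+-assoc c b d) ⟩
      a + (c + (b + d))  ≈⟨ +-assoc a c (b + d) ⟨
      (a + c) + (b + d)  ∎

    *-swap : ∀ x y z → (x * y) * z ≈ (x * z) * y
    *-swap x y z = trans (*-assoc x y z) (trans (*-congˡ (*-comm y z)) (sym (*-assoc x z y)))

    cancelʳ : ∀ {x y c} → ¬ (c ≈ 0#) → x * c ≈ y → y * c ⁻¹ ≈ x
    cancelʳ {x} {y} {c} c≉0 eq = begin
      y * c ⁻¹        ≈⟨ *-congʳ eq ⟨
      x * c * c ⁻¹    ≈⟨ *-assoc x c (c ⁻¹) ⟩
      x * (c * c ⁻¹)  ≈⟨ *-congˡ (*-inverseʳ c≉0) ⟩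
      x * 1#          ≈⟨ *-identityʳ x ⟩
      x               ∎

    cross-cong : ∀ {u u′ v v′} → u ≈ᵥ u′ → v ≈ᵥ v′ → cross u v ≈ cross u′ v′
    cross-cong (p , q) (p′ , q′) = +-cong (*-cong p q′) (-‿cong (*-cong q p′))

    cross-+ : ∀ u v w → cross (u +ᵥ v) w ≈ cross u w + cross v w
    cross-+ (a , b) (c , d) (x , y) = begin
      (a + c) * y - (b + d) * x                ≈⟨ +-cong (distribʳ y a c) (-‿cong (distribʳ x b d)) ⟩
      (a * y + c * y) - (b * x + d * x)        ≈⟨ +-congˡ (-‿+-comm (b * x) (d * x)) ⟨
      (a * y + c * y) + (- (b * x) - d * x)    ≈⟨ +-interchange (a * y) (c * y) (- (b * x)) (- (d * x)) ⟩
      (a * y - b * x) + (c * y - d * x)        ∎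

    cross-• : ∀ t u v → cross (t • u) v ≈ t * cross u v
    cross-• t (a , b) (x , y) = begin
      t * a * y - t * b * x      ≈⟨ +-cong (*-assoc t a y) (-‿cong (*-assoc t b x)) ⟩
      t * (a * y) - t * (b * x)  ≈⟨ *-distribˡ-- t (a * y) (b * x) ⟨
      t * (a * y - b * x)        ∎

    cross-self : ∀ u → cross u u ≈ 0#
    cross-self (a , b) = trans (-‿congˡ (*-comm b a)) (-‿inverseʳ (a * b))

    cross-anti : ∀ u v → - cross u v ≈ cross v u
    cross-anti (a , b) (x , y) =
      trans (neg-- (a * y) (b * x)) (+-cong (*-comm b x) (-‿cong (*-comm a y)))

    cross-reverse : ∀ 𝔩 p q → cross 𝔩 (p -ᵥ q) ≈ - cross 𝔩 (q -ᵥ p)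
    cross-reverse (a , b) (p₁ , p₂) (q₁ , q₂) = begin
      a * (p₂ - q₂) - b * (p₁ - q₁)          ≈⟨ +-cong (flip a p₂ q₂) (-‿cong (flip b p₁ q₁)) ⟩
      - (a * (q₂ - p₂)) + - - (b * (q₁ - p₁)) ≈⟨ -‿+-comm (a * (q₂ - p₂)) (- (b * (q₁ - p₁))) ⟩
      - (a * (q₂ - p₂) - b * (q₁ - p₁))      ∎
      where
      flip : ∀ x y z → x * (y - z) ≈ - (x * (z - y))
      flip x y z = trans (*-congˡ (sym (neg-- z y))) (sym (-‿distribʳ-* x (z - y)))

    solve-for-difference : ∀ {a b c d} → a + b ≈ c + d → b ≈ (c - a) + d
    solve-for-difference {a} {b} {c} {d} eq = begin
      b                ≈⟨ +-identityˡ b ⟨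
      0# + b           ≈⟨ +-congʳ (-‿inverseˡ a) ⟨
      (- a + a) + b    ≈⟨ +-assoc (- a) a b ⟩
      - a + (a + b)    ≈⟨ +-congˡ eq ⟩
      - a + (c + d)    ≈⟨ +-assoc (- a) c d ⟨
      (- a + c) + d    ≈⟨ +-congʳ (+-comm (- a) c) ⟩
      (c - a) + d      ∎

    difference-solved : ∀ {a b c d} → b ≈ (c - a) + d → a + b ≈ c + d
    difference-solved {a} {b} {c} {d} eq = begin
      a + b              ≈⟨ +-congˡ eq ⟩
      a + ((c - a) + d)  ≈⟨ +-assoc a (c - a) d ⟨
      (a + (c - a)) + d  ≈⟨ +-congʳ (+-comm a (c - a)) ⟩
      ((c - a) + a) + d  ≈⟨ +-congʳ (+-assoc c (- a) a) ⟩
      (c + (- a + a)) + d ≈⟨ +-congʳ (trans (+-congˡ (-‿inverseˡ a)) (+-identityʳ c)) ⟩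
      c + d              ∎

    cramer₁ : ∀ w d l → cross w d * proj₁ l ≈ proj₁ w * cross l d + cross w l * proj₁ d
    cramer₁ (w₁ , w₂) (d₁ , d₂) (l₁ , l₂) = begin
      (w₁ * d₂ - w₂ * d₁) * l₁                              ≈⟨ *-distribʳ-- l₁ (w₁ * d₂) (w₂ * d₁) ⟩
      w₁ * d₂ * l₁ - w₂ * d₁ * l₁                           ≈⟨ +-cong (*-swap w₁ d₂ l₁) (-‿cong (*-swap w₂ d₁ l₁)) ⟩
      w₁ * l₁ * d₂ - w₂ * l₁ * d₁                           ≈⟨ cancel _ (w₁ * l₂ * d₁) _ ⟨
      (w₁ * l₁ * d₂ - w₁ * l₂ * d₁) + (w₁ * l₂ * d₁ - w₂ * l₁ * d₁)
        ≈⟨ +-cong (trans (*-distribˡ-- w₁ (l₁ * d₂) (l₂ * d₁))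
                         (+-cong (sym (*-assoc w₁ l₁ d₂)) (-‿cong (sym (*-assoc w₁ l₂ d₁)))))
                  (*-distribʳ-- d₁ (w₁ * l₂) (w₂ * l₁)) ⟨
      w₁ * (l₁ * d₂ - l₂ * d₁) + (w₁ * l₂ - w₂ * l₁) * d₁   ∎

    cramer₂ : ∀ w d l → cross w d * proj₂ l ≈ proj₂ w * cross l d + cross w l * proj₂ d
    cramer₂ (w₁ , w₂) (d₁ , d₂) (l₁ , l₂) = begin
      (w₁ * d₂ - w₂ * d₁) * l₂                              ≈⟨ *-distribʳ-- l₂ (w₁ * d₂) (w₂ * d₁) ⟩
      w₁ * d₂ * l₂ - w₂ * d₁ * l₂                           ≈⟨ +-cong (*-swap w₁ d₂ l₂) (-‿cong (*-swap w₂ d₁ l₂)) ⟩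
      w₁ * l₂ * d₂ - w₂ * l₂ * d₁                           ≈⟨ cancel _ (w₂ * l₁ * d₂) _ ⟨
      (w₁ * l₂ * d₂ - w₂ * l₁ * d₂) + (w₂ * l₁ * d₂ - w₂ * l₂ * d₁)
        ≈⟨ +-comm _ _ ⟩
      (w₂ * l₁ * d₂ - w₂ * l₂ * d₁) + (w₁ * l₂ * d₂ - w₂ * l₁ * d₂)
        ≈⟨ +-cong (trans (*-distribˡ-- w₂ (l₁ * d₂) (l₂ * d₁))
                         (+-cong (sym (*-assoc w₂ l₁ d₂)) (-‿cong (sym (*-assoc w₂ l₂ d₁)))))
                  (*-distribʳ-- d₂ (w₁ * l₂) (w₂ * l₁)) ⟨
      w₂ * (l₁ * d₂ - l₂ * d₁) + (w₁ * l₂ - w₂ * l₁) * d₂   ∎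

    divide : ∀ {x y z u v c} → ¬ (c ≈ 0#) → x * y ≈ z * c + u * v →
             x * c ⁻¹ * y ≈ z + u * c ⁻¹ * v
    divide {x} {y} {z} {u} {v} {c} c≉0 eq = begin
      x * c ⁻¹ * y                     ≈⟨ *-swap x (c ⁻¹) y ⟩
      x * y * c ⁻¹                     ≈⟨ *-congʳ eq ⟩
      (z * c + u * v) * c ⁻¹           ≈⟨ distribʳ (c ⁻¹) (z * c) (u * v) ⟩
      z * c * c ⁻¹ + u * v * c ⁻¹      ≈⟨ +-cong (cancelʳ c≉0 refl) (*-swap u v (c ⁻¹)) ⟩
      z + u * c ⁻¹ * v                 ∎

  open PlaneLemmas

  _<?_ : (x y : Carrier) → Dec (x < y)
  _<?_ = <._<?_

  _≤?_ : (x y : Carrier) → Dec (x ≤ y)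
  x ≤? y = (x <? y) ⊎-dec (x <.≟ y)

  module OrderLemmas where

    ≤-respˡ : ∀ {x y z} → x ≈ y → x ≤ z → y ≤ z
    ≤-respˡ eq (inj₁ lt) = inj₁ (<.<-respˡ-≈ eq lt)
    ≤-respˡ eq (inj₂ e)  = inj₂ (trans (sym eq) e)

    ≤-respʳ : ∀ {x y z} → x ≈ y → z ≤ x → z ≤ y
    ≤-respʳ eq (inj₁ lt) = inj₁ (<.<-respʳ-≈ eq lt)
    ≤-respʳ eq (inj₂ e)  = inj₂ (trans e eq)

  open OrderLemmas

  -- If 𝔩 is not parallel to the segment, the only candidates for the
  -- parameters of the intersection point are given by Cramer's rule.
  rayMeetsSegment? : ∀ b 𝔩 p q → ¬ (cross 𝔩 (q -ᵥ p) ≈ 0#) → Dec (RayMeetsSegment b 𝔩 p q)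
  rayMeetsSegment? b 𝔩 p q c≉0 =
    map′ to from ((0# <? t₀) ×-dec ((0# ≤? s₀) ×-dec (s₀ ≤? 1#)))
    where
    d w : Point
    d = q -ᵥ p
    w = p -ᵥ b
    c t₀ s₀ : Carrier
    c  = cross 𝔩 d
    t₀ = cross w d * c ⁻¹
    s₀ = cross w 𝔩 * c ⁻¹

    to : 0# < t₀ × 0# ≤ s₀ × s₀ ≤ 1# → RayMeetsSegment b 𝔩 p q
    to (0<t , 0≤s , s≤1) =
      b +ᵥ t₀ • 𝔩 , (t₀ , 0<t , refl , refl) ,
      (s₀ , 0≤s , s≤1 ,
       difference-solved (divide c≉0 (cramer₁ w d 𝔩)) ,
       difference-solved (divide c≉0 (cramer₂ w d 𝔩)))

    from : RayMeetsSegment b 𝔩 p q → 0# < t₀ × 0# ≤ s₀ × s₀ ≤ 1#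
    from (x , (t , 0<t , x₁ , x₂) , (r , 0≤r , r≤1 , y₁ , y₂)) =
      <.<-respʳ-≈ (sym t₀≈t) 0<t , ≤-respʳ (sym s₀≈r) 0≤r , ≤-respˡ (sym s₀≈r) r≤1
      where
      tl≈w+rd : t • 𝔩 ≈ᵥ w +ᵥ r • d
      tl≈w+rd = solve-for-difference (trans (sym x₁) y₁) , solve-for-difference (trans (sym x₂) y₂)

      t₀≈t : t₀ ≈ t
      t₀≈t = cancelʳ c≉0 (begin
        t * c                         ≈⟨ cross-• t 𝔩 d ⟨
        cross (t • 𝔩) d               ≈⟨ cross-cong tl≈w+rd (refl , refl) ⟩
        cross (w +ᵥ r • d) d          ≈⟨ cross-+ w (r • d) d ⟩
        cross w d + cross (r • d) d   ≈⟨ +-congˡ (cross-• r d d) ⟩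
        cross w d + r * cross d d     ≈⟨ +-congˡ (trans (*-congˡ (cross-self d)) (zeroʳ r)) ⟩
        cross w d + 0#                ≈⟨ +-identityʳ _ ⟩
        cross w d                     ∎)

      zero-sum : cross w 𝔩 + r * cross d 𝔩 ≈ 0#
      zero-sum = begin
        cross w 𝔩 + r * cross d 𝔩     ≈⟨ +-congˡ (cross-• r d 𝔩) ⟨
        cross w 𝔩 + cross (r • d) 𝔩   ≈⟨ cross-+ w (r • d) 𝔩 ⟨
        cross (w +ᵥ r • d) 𝔩          ≈⟨ cross-cong tl≈w+rd (refl , refl) ⟨
        cross (t • 𝔩) 𝔩               ≈⟨ cross-• t 𝔩 𝔩 ⟩
        t * cross 𝔩 𝔩                 ≈⟨ trans (*-congˡ (cross-self 𝔩)) (zeroʳ t) ⟩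
        0#                            ∎

      s₀≈r : s₀ ≈ r
      s₀≈r = cancelʳ c≉0 (begin
        r * c                                     ≈⟨ *-congˡ (cross-anti d 𝔩) ⟨
        r * - cross d 𝔩                           ≈⟨ -‿distribʳ-* r (cross d 𝔩) ⟨
        - (r * cross d 𝔩)                         ≈⟨ +-identityˡ _ ⟨
        0# - r * cross d 𝔩                        ≈⟨ +-congʳ zero-sum ⟨
        (cross w 𝔩 + r * cross d 𝔩) - r * cross d 𝔩 ≈⟨ +-assoc _ _ _ ⟩
        cross w 𝔩 + (r * cross d 𝔩 - r * cross d 𝔩) ≈⟨ +-congˡ (-‿inverseʳ _) ⟩
        cross w 𝔩 + 0#                            ≈⟨ +-identityʳ _ ⟩
        cross w 𝔩                                 ∎)

  data Colour : Set where
    black white : Colour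

  switch : Colour → Colour
  switch black = white
  switch white = black

  -- Straight-line drawing of a finite directed graph with coloured internal
  -- vertices and weighted edges; the conditions on it are in IsPlabicNetwork.
  record Network (n m k : ℕ) : Set₁ where
    field
      disk     : Disk
      boundary : Fin n → Point
      internal : Fin m → Point
      colour   : Fin m → Colour
      src tgt  : Fin k → Fin n ⊎ Fin m
      weight   : Fin k → Carrier

    open Disk disk public

    Vertex : Set
    Vertex = Fin n ⊎ Fin m

    _≟ᵛ_ : DecidableEquality Vertex
    _≟ᵛ_ = Sum.≡-dec Fin._≟_ Fin._≟_

    pos : Vertex → Point
    pos = [ boundary , internal ]′

    dir : Fin k → Point
    dir e = pos (tgt e) -ᵥ pos (src e)

    OnEdge : Fin k → Point → Set
    OnEdge e = OnSegment (pos (src e)) (pos (tgt e))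

    inEdges outEdges : Vertex → List (Fin k)
    inEdges  v = filter (λ e → tgt e ≟ᵛ v) (allFin k)
    outEdges v = filter (λ e → src e ≟ᵛ v) (allFin k)

    indegree outdegree degree : Vertex → ℕ
    indegree  v = length (inEdges v)
    outdegree v = length (outEdges v)
    degree    v = indegree v ℕ.+ outdegree v

    IsSource : Fin n → Set
    IsSource j = ∃[ e ] src e ≡ inj₁ j

    isSource? : ∀ j → Dec (IsSource j)
    isSource? j = Fin.any? λ e → src e ≟ᵛ inj₁ j

    EndpointOf : Fin k → Vertex → Set
    EndpointOf e v = src e ≡ v ⊎ tgt e ≡ v

    Adjacent : Vertex → Vertex → Set
    Adjacent u v = ∃[ e ] src e ≡ u × tgt e ≡ v

  module _ {n m k : ℕ} where

    record IsPlabicNetwork (N : Network n m k) : Set where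
      open Network N
      field
        -- b₁, …, bₙ lie on [A,B], in clockwise order
        param             : Fin n → Carrier
        param-range       : ∀ j → 0# ≤ param j × param j ≤ 1#
        param-increasing  : ∀ {i j} → i Fin.< j → param i < param j
        on-segment        : ∀ j → boundary j ≈ᵥ A +ᵥ param j • (B -ᵥ A)
        inside            : ∀ v → Interior D (internal v)
        pos-injective     : ∀ {u v} → pos u ≈ᵥ pos v → u ≡ v
        no-loops          : ∀ e → src e ≢ tgt e
        vertex-on-edge    : ∀ {e v} → OnEdge e (pos v) → EndpointOf e v
        no-crossings      : ∀ {e f x} → e ≢ f → OnEdge e x → OnEdge f x →
                            ∃[ v ] EndpointOf e v × EndpointOf f v × x ≈ᵥ pos v
        boundary-degree   : ∀ j → degree (inj₁ j) ≡ 1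
        internal-degree   : ∀ v → degree (inj₂ v) ≡ 2 ⊎ degree (inj₂ v) ≡ 3
        none-isolated     : ∀ v → ∃[ j ] EqClosure Adjacent v (inj₁ j)
        -- perfect orientation; a bivalent vertex has one incoming and one
        -- outgoing edge whichever its colour is
        white-perfect     : ∀ v → colour v ≡ white → indegree (inj₂ v) ≡ 1
        black-perfect     : ∀ v → colour v ≡ black → outdegree (inj₂ v) ≡ 1
        weight-positive   : ∀ e → 0# < weight e

    record IsGaugeDirection (N : Network n m k) (𝔩 : Point) : Set where
      open Network N
      field
        not-parallel : ∀ e → ¬ (cross 𝔩 (dir e) ≈ 0#)
        points-in    : ∀ j → ∃[ x ] OnRay (boundary j) 𝔩 x × Interior D x
        generic      : ∀ j v → ¬ OnRay (boundary j) 𝔩 (internal v)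

    EdgeFamily : Set
    EdgeFamily = Fin k → Vector Carrier n

    module _ (N : Network n m k) {𝔩 : Point} (g : IsGaugeDirection N 𝔩) where
      open Network N
      open IsGaugeDirection g

      gaugeRayMeets? : ∀ e j → Dec (IsSource j × RayMeetsSegment (boundary j) 𝔩 (pos (src e)) (pos (tgt e)))
      gaugeRayMeets? e j =
        isSource? j ×-dec rayMeetsSegment? (boundary j) 𝔩 (pos (src e)) (pos (tgt e)) (not-parallel e)

      -- Not being parallel to e, a ray meets e at most once, so counting
      -- intersections amounts to counting gauge rays that meet e.
      int : Fin k → ℤ
      int e = + length (filter (gaugeRayMeets? e) (allFin n))

      canonical : Fin n → Vector Carrier n
      canonical j i = if does (j Fin.≟ i) then 1# else 0#

      record SolvesEdgeSystem (E : EdgeFamily) : Set where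
        field
          at-internal : ∀ e v → tgt e ≡ inj₂ v → ∀ i →
            E e i ≈ [-1]^ (int e) * weight e *
                    foldr (λ f Σ → [-1]^ (wind 𝔩 (dir e) (dir f)) * E f i + Σ) 0# (outEdges (inj₂ v))
          at-sink     : ∀ e j → tgt e ≡ inj₁ j → ∀ i →
            E e i ≈ [-1]^ (int e) * weight e * canonical j i

      record AreEdgeVectors (E : EdgeFamily) : Set where
        field
          solves : SolvesEdgeSystem E
          unique : ∀ E′ → SolvesEdgeSystem E′ → ∀ e i → E′ e i ≈ E e i

    record Square (N : Network n m k) : Set where
      open Network N
      field
        S P Q R     : Fin m
        h₁ h₂ h₃ h₄ : Fin k
        e₁ e₂ e₃ e₄ : Fin k

        S-trivalent : degree (inj₂ S) ≡ 3
        P-trivalent : degree (inj₂ P) ≡ 3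
        Q-trivalent : degree (inj₂ Q) ≡ 3
        R-trivalent : degree (inj₂ R) ≡ 3
        S-white     : colour S ≡ white
        Q-white     : colour Q ≡ white
        P-black     : colour P ≡ black
        R-black     : colour R ≡ black

        h₁-src : src h₁ ≡ inj₂ S
        h₁-tgt : tgt h₁ ≡ inj₂ P
        h₂-src : src h₂ ≡ inj₂ S
        h₂-tgt : tgt h₂ ≡ inj₂ R
        h₃-src : src h₃ ≡ inj₂ P
        h₃-tgt : tgt h₃ ≡ inj₂ Q
        h₄-src : src h₄ ≡ inj₂ Q
        h₄-tgt : tgt h₄ ≡ inj₂ R

        -- e₁ and e₃ are outside the square because no square edge ends at S
        -- or starts at R.
        e₁-tgt : tgt e₁ ≡ inj₂ S
        e₂-tgt : tgt e₂ ≡ inj₂ P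
        e₃-src : src e₃ ≡ inj₂ R
        e₄-src : src e₄ ≡ inj₂ Q
        e₂≢h₁  : e₂ ≢ h₁
        e₄≢h₄  : e₄ ≢ h₄

        quadrilateral : ClockwiseQuadrilateral (internal S) (internal P) (internal Q) (internal R)
        face          : ∀ e {x} → OnEdge e x →
                        ¬ InQuadrilateral (internal S) (internal P) (internal Q) (internal R) x
        cyclic-at-Q   : CyclicCCW (dir h₄) (dir e₄) (-ᵥ dir h₃)
        cyclic-at-R   : CyclicCCW (-ᵥ dir h₂) (dir e₃) (-ᵥ dir h₄)

      α₁ α₂ α₃ α₄ : Carrier
      α₁ = weight h₁
      α₂ = weight h₂
      α₃ = weight h₃
      α₄ = weight h₄

      α̃₁ α̃₂ α̃₃ α̃₄ : Carrier
      α̃₂ = α₂ + α₁ * α₃ * α₄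
      α̃₁ = (α₃ * α₄) ÷ α̃₂
      α̃₃ = (α₂ * α₃) ÷ α̃₂
      α̃₄ = (α₁ * α₃) ÷ α̃₂

      reversed : Fin k → Bool
      reversed e = ⌊ e Fin.≟ h₁ ⌋ ∨ ⌊ e Fin.≟ h₄ ⌋

      isCorner : Fin m → Bool
      isCorner v = ⌊ v Fin.≟ S ⌋ ∨ ⌊ v Fin.≟ P ⌋ ∨ ⌊ v Fin.≟ Q ⌋ ∨ ⌊ v Fin.≟ R ⌋

    -- The edges keep their indices, so h₁ and h₄ in the moved network are the
    -- reversed edges -h₁ and -h₄.
    squareMove : (N : Network n m k) → Square N → Network n m k
    squareMove N sq = record
      { disk     = disk
      ; boundary = boundary
      ; internal = internal
      ; colour   = λ v → if isCorner v then switch (colour v) else colour v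
      ; src      = λ e → if reversed e then tgt e else src e
      ; tgt      = λ e → if reversed e then src e else tgt e
      ; weight   = λ e → if ⌊ e Fin.≟ h₁ ⌋ then α̃₁ else
                         if ⌊ e Fin.≟ h₂ ⌋ then α̃₂ else
                         if ⌊ e Fin.≟ h₃ ⌋ then α̃₃ else
                         if ⌊ e Fin.≟ h₄ ⌋ then α̃₄ else weight e
      }
      where
      open Network N
      open Square sq

    squareMove-gauge : (N : Network n m k) (sq : Square N) {𝔩 : Point} →
                       IsGaugeDirection N 𝔩 → IsGaugeDirection (squareMove N sq) 𝔩
    squareMove-gauge N sq {𝔩} g = record
      { not-parallel = not-parallel′
      ; points-in    = points-in
      ; generic      = generic
      }
      where
      open Network N
      open Square sq
      open IsGaugeDirection g

      not-parallel′ : ∀ e → ¬ (cross 𝔩 (Network.dir (squareMove N sq) e) ≈ 0#)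
      not-parallel′ e eq with reversed e
      ... | false = not-parallel e eq
      ... | true  = not-parallel e (begin
        cross 𝔩 (dir e)                          ≈⟨ cross-reverse 𝔩 (pos (tgt e)) (pos (src e)) ⟩
        - cross 𝔩 (pos (src e) -ᵥ pos (tgt e))   ≈⟨ -‿cong eq ⟩
        - 0#                                     ≈⟨ +-identityˡ (- 0#) ⟨
        0# - 0#                                  ≈⟨ -‿inverseʳ 0# ⟩
        0#                                       ∎)

-- Let E agree with F off the square and be given by the claimed formulas on it.
-- Then E solves the edge system of the moved network, so it is F̃ by uniqueness.
--
-- The linear algebra involves the exponents only modulo 2, and (-1)^wind and (-1)^γ₂
-- are functions of the signs of cross products.  The equations at the square edges
-- and at e₁, e₂ thus become identities between signs, which hold for all
-- values compatible with the Plücker relations: at each corner the third edge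
-- points out of the face, and the clockwise square has turning number -1, so
-- that its four winds have odd sum.  Moreover int(h₁) + int(h₂) + int(h₃) + int(h₄) is
-- even, because a gauge ray meets a segment inside the disk exactly if it separates the
-- endpoints, the opposite ray lying outside the disk.

module Submission where

open import Defs
open import Algebra.Bundles using (CommutativeRing)
import Algebra.Properties.Ring as RingProperties
import Algebra.Properties.Semiring.Mult.TCOptimised as Mult
import Algebra.Solver.Ring
open import Algebra.Solver.Ring.AlmostCommutativeRing
  using (fromCommutativeRing; _-Raw-AlmostCommutative⟶_)
open import Data.Bool.Base using (Bool; true; false; if_then_else_; _∧_)
open import Data.Bool.ListAction using (any)
import Data.Bool.Properties as Bool
open import Data.Fin.Base as Fin using (Fin)
import Data.Fin.Properties as Fin
open import Data.Integer.Base as ℤ using (ℤ; 0ℤ; 1ℤ; -1ℤ; +_; -[1+_]; ∣_∣; +-*-rawRing)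
  renaming (_+_ to _+ℤ_)
import Data.Integer.DivMod as ℤ
import Data.Integer.Properties as ℤ
open import Data.List.Base using (List; []; _∷_; allFin; filter; foldr; length; map)
open import Data.List.Membership.Propositional using (_∈_)
open import Data.List.Membership.Propositional.Properties using (∈-filter⁺; ∈-filter⁻; ∈-allFin)
open import Data.List.Properties using (filter-≐)
import Data.List.Relation.Unary.All as All
open All using (_∷_)
open import Data.List.Relation.Unary.AllPairs using (_∷_)
open import Data.List.Relation.Unary.Any using (here; there)
open import Data.List.Relation.Unary.Unique.Propositional using (Unique)
open import Data.List.Relation.Unary.Unique.Propositional.Properties using (filter⁺; allFin⁺)
open import Data.Maybe.Base using (Maybe; just; nothing)
open import Data.Nat.Base as ℕ using (ℕ; zero; suc)
import Data.Nat.Properties as ℕ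
open import Data.Product.Base as Product using (∃-syntax; _×_; _,_; proj₁; proj₂)
open import Data.Sign.Base as Sign using (Sign; opposite) renaming (_*_ to _·_)
import Data.Sign.Properties as Sign
open import Data.Sum.Base using (_⊎_; inj₁; inj₂; fromInj₁; fromInj₂)
open import Data.Sum.Properties using (inj₂-injective)
open import Relation.Binary.Definitions using (DecidableEquality; tri<; tri≈; tri>)
import Relation.Binary.PropositionalEquality as ≡
open ≡ using (_≡_; _≢_)
import Relation.Binary.Reasoning.Setoid as SetoidReasoning
open import Relation.Nullary.Decidable
  using (Dec; yes; no; does; ⌊_⌋; toWitness; map′; ¬?; _×-dec_; _⊎-dec_; _→-dec_;
         isYes≗does; dec-true; dec-false)
open import Relation.Nullary.Negation using (¬_; contradiction)

-- Each sign identity ranges over finitely many signs and is settled by evaluation; the work lies in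
-- extracting enough sign relations from the geometry. Brackets of two edges take three values,
-- since straight and reflex corners are allowed, while brackets with the gauge direction take only
-- two. The tour around the square and the claimed formulas pass the corners R and S in opposite
-- senses: `h₄`, `-h₂` against `h₂`, `-h₄`, and `-h₂`, `h₁` against `-h₁`, `h₂`. The parities of the
-- two passages differ by γ₂ terms, except for antiparallel directions, which lie on different sides
-- of the gauge direction although neither passage winds. The turning lemma therefore also has to
-- exclude antiparallel sides at these corners. At Q and R the cyclic order is given. At S and P it
-- is extracted from the face: an edge that does not point outward has a point in the face or
-- overlaps a side. Once `F₃` and `F₄` are rescaled by signs, only rational identities in the
-- weights remain.

-- Ring solver with integer coefficients

module IntegerCoefficientSolver {c ℓ} (R : CommutativeRing c ℓ) where
  open CommutativeRing R
  open RingProperties ring using (-‿distribˡ-*; -‿distribʳ-*; -‿involutive; -‿+-comm)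
  open Mult semiring using (×-homo-+; ×1-homo-*; 1+×) renaming (_×_ to _×#_)
  open SetoidReasoning setoid

  fromℕ : ℕ → Carrier
  fromℕ n = n ×# 1#

  fromℤ : ℤ → Carrier
  fromℤ (+ n)    = fromℕ n
  fromℤ -[1+ n ] = - fromℕ (suc n)

  -0≈0 : - 0# ≈ 0#
  -0≈0 = trans (sym (+-identityˡ (- 0#))) (-‿inverseʳ 0#)

  fromℤ-⊖ : ∀ m n → fromℤ (m ℤ.⊖ n) ≈ fromℕ m - fromℕ n
  fromℤ-⊖ m zero = sym (trans (+-congˡ -0≈0) (+-identityʳ _))
  fromℤ-⊖ zero (suc n) = sym (+-identityˡ _)
  fromℤ-⊖ (suc m) (suc n) = begin
    fromℤ (suc m ℤ.⊖ suc n)             ≡⟨ ≡.cong fromℤ (ℤ.[1+m]⊖[1+n]≡m⊖n m n) ⟩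
    fromℤ (m ℤ.⊖ n)                     ≈⟨ fromℤ-⊖ m n ⟩
    fromℕ m - fromℕ n                   ≈⟨ +-congˡ (+-identityˡ _) ⟨
    fromℕ m + (0# - fromℕ n)            ≈⟨ +-congˡ (+-congʳ (-‿inverseʳ 1#)) ⟨
    fromℕ m + ((1# - 1#) - fromℕ n)     ≈⟨ +-congˡ (+-assoc 1# (- 1#) (- fromℕ n)) ⟩
    fromℕ m + (1# + (- 1# - fromℕ n))   ≈⟨ +-assoc (fromℕ m) 1# _ ⟨
    fromℕ m + 1# + (- 1# - fromℕ n)     ≈⟨ +-cong (+-comm (fromℕ m) 1#) (-‿+-comm 1# (fromℕ n)) ⟩
    1# + fromℕ m - (1# + fromℕ n)       ≈⟨ +-cong (1+× m 1#) (-‿cong (1+× n 1#)) ⟨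
    fromℕ (suc m) - fromℕ (suc n)       ∎

  fromℤ-+ : ∀ i j → fromℤ (i ℤ.+ j) ≈ fromℤ i + fromℤ j
  fromℤ-+ (+ m)    (+ n)    = ×-homo-+ 1# m n
  fromℤ-+ (+ m)    -[1+ n ] = fromℤ-⊖ m (suc n)
  fromℤ-+ -[1+ m ] (+ n)    = trans (fromℤ-⊖ n (suc m)) (+-comm _ _)
  fromℤ-+ -[1+ m ] -[1+ n ] = begin
    - fromℕ (suc (suc (m ℕ.+ n)))          ≡⟨ ≡.cong (λ k → - fromℕ (suc k)) (ℕ.+-suc m n) ⟨
    - fromℕ (suc m ℕ.+ suc n)              ≈⟨ -‿cong (×-homo-+ 1# (suc m) (suc n)) ⟩
    - (fromℕ (suc m) + fromℕ (suc n))      ≈⟨ -‿+-comm _ _ ⟨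
    - fromℕ (suc m) - fromℕ (suc n)        ∎


  fromℤ-neg : ∀ i → fromℤ (ℤ.- i) ≈ - fromℤ i
  fromℤ-neg (+ zero)  = sym -0≈0
  fromℤ-neg (+ suc n) = refl
  fromℤ-neg -[1+ n ]  = sym (-‿involutive _)

  fromℤ-*-+ : ∀ m n → fromℤ (+ m ℤ.* + n) ≈ fromℕ m * fromℕ n
  fromℤ-*-+ m n = trans (reflexive (≡.cong fromℤ (≡.sym (ℤ.pos-* m n)))) (×1-homo-* m n)

  fromℤ-* : ∀ i j → fromℤ (i ℤ.* j) ≈ fromℤ i * fromℤ j
  fromℤ-* (+ m)    (+ n)    = fromℤ-*-+ m n
  fromℤ-* (+ m)    -[1+ n ] = begin
    fromℤ (+ m ℤ.* -[1+ n ])       ≡⟨ ≡.cong fromℤ (ℤ.neg-distribʳ-* (+ m) (+ suc n)) ⟨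
    fromℤ (ℤ.- (+ m ℤ.* + suc n))  ≈⟨ fromℤ-neg (+ m ℤ.* + suc n) ⟩
    - fromℤ (+ m ℤ.* + suc n)      ≈⟨ -‿cong (fromℤ-*-+ m (suc n)) ⟩
    - (fromℕ m * fromℕ (suc n))    ≈⟨ -‿distribʳ-* _ _ ⟩
    fromℕ m * - fromℕ (suc n)      ∎
  fromℤ-* -[1+ m ] (+ n)    = begin
    fromℤ (-[1+ m ] ℤ.* + n)       ≡⟨ ≡.cong fromℤ (ℤ.neg-distribˡ-* (+ suc m) (+ n)) ⟨
    fromℤ (ℤ.- (+ suc m ℤ.* + n))  ≈⟨ fromℤ-neg (+ suc m ℤ.* + n) ⟩
    - fromℤ (+ suc m ℤ.* + n)      ≈⟨ -‿cong (fromℤ-*-+ (suc m) n) ⟩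
    - (fromℕ (suc m) * fromℕ n)    ≈⟨ -‿distribˡ-* _ _ ⟩
    - fromℕ (suc m) * fromℕ n      ∎
  fromℤ-* -[1+ m ] -[1+ n ] = begin
    fromℕ (suc m ℕ.* suc n)            ≈⟨ ×1-homo-* (suc m) (suc n) ⟩
    fromℕ (suc m) * fromℕ (suc n)      ≈⟨ -‿involutive _ ⟨
    - - (fromℕ (suc m) * fromℕ (suc n)) ≈⟨ -‿cong (-‿distribʳ-* _ _) ⟩
    - (fromℕ (suc m) * - fromℕ (suc n)) ≈⟨ -‿distribˡ-* _ _ ⟩
    - fromℕ (suc m) * - fromℕ (suc n)  ∎

  morphism : +-*-rawRing -Raw-AlmostCommutative⟶ fromCommutativeRing R
  morphism = record
    { ⟦_⟧    = fromℤ
    ; +-homo = fromℤ-+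
    ; *-homo = fromℤ-*
    ; -‿homo = fromℤ-neg
    ; 0-homo = refl
    ; 1-homo = refl
    }

  -- Normal forms drop terms whose coefficient passes this test against zero; with integer
  -- coefficients the test computes.
  coefficients≟ : ∀ i j → Maybe (fromℤ i ≈ fromℤ j)
  coefficients≟ i j with i ℤ.≟ j
  ... | yes i≡j = just (reflexive (≡.cong fromℤ i≡j))
  ... | no  _   = nothing

  open Algebra.Solver.Ring +-*-rawRing (fromCommutativeRing R) morphism coefficients≟ public
    using (Polynomial; solve; _:=_; _:+_; _:*_; _:-_; :-_; con)

-- Finite calculus of signs

data Trit : Set where
  ⊖ ⊙ ⊕ : Trit

module SignCalculus where

  infixl 7 _⊗_
  infix  4 _≟_

  ⌜_⌝ : Sign → Trit
  ⌜ Sign.- ⌝ = ⊖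
  ⌜ Sign.+ ⌝ = ⊕

  -- The value at `⊙` is a default: the sides and flanks below come from brackets that
  -- transversality or genericity keeps nonzero.
  ⌞_⌟ : Trit → Sign
  ⌞ ⊖ ⌟ = Sign.-
  ⌞ ⊙ ⌟ = Sign.+
  ⌞ ⊕ ⌟ = Sign.+

  neg : Trit → Trit
  neg ⊖ = ⊕
  neg ⊙ = ⊙
  neg ⊕ = ⊖

  _⊗_ : Trit → Trit → Trit
  ⊖ ⊗ t = neg t
  ⊙ ⊗ t = ⊙
  ⊕ ⊗ t = t

  ⌜⌞_⌟⌝ : ∀ t → t ≢ ⊙ → t ≡ ⌜ ⌞ t ⌟ ⌝
  ⌜⌞ ⊖ ⌟⌝ _   = ≡.refl
  ⌜⌞ ⊙ ⌟⌝ t≢⊙ = contradiction ≡.refl t≢⊙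
  ⌜⌞ ⊕ ⌟⌝ _   = ≡.refl

  ⌞neg⌟ : ∀ t → t ≢ ⊙ → ⌞ neg t ⌟ ≡ opposite ⌞ t ⌟
  ⌞neg⌟ ⊖ _   = ≡.refl
  ⌞neg⌟ ⊙ t≢⊙ = contradiction ≡.refl t≢⊙
  ⌞neg⌟ ⊕ _   = ≡.refl

  _≟_ : DecidableEquality Trit
  ⊖ ≟ ⊖ = yes ≡.refl
  ⊖ ≟ ⊙ = no λ ()
  ⊖ ≟ ⊕ = no λ ()
  ⊙ ≟ ⊖ = no λ ()
  ⊙ ≟ ⊙ = yes ≡.refl
  ⊙ ≟ ⊕ = no λ ()
  ⊕ ≟ ⊖ = no λ ()
  ⊕ ≟ ⊙ = no λ ()
  ⊕ ≟ ⊕ = yes ≡.refl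

  hasPos hasNeg : List Trit → Bool
  hasPos = any (λ t → does (t ≟ ⊕))
  hasNeg = any (λ t → does (t ≟ ⊖))

  -- The condition on the signs of finitely many numbers to allow the sum 0.
  Balanced : List Trit → Set
  Balanced ts = hasPos ts ≡ hasNeg ts

  -- The signs in [ab][cd] − [ac][bd] + [ad][bc] = 0.
  Plücker : (ab ac ad bc bd cd : Trit) → Set
  Plücker ab ac ad bc bd cd = Balanced (ab ⊗ cd ∷ neg (ac ⊗ bd) ∷ ad ⊗ bc ∷ [])

  plücker? : ∀ ab ac ad bc bd cd → Dec (Plücker ab ac ad bc bd cd)
  plücker? ab ac ad bc bd cd = _ Bool.≟ _

  -- A fourth vector 𝔩 parallel to none of a, b, c; the signs of [a𝔩], [b𝔩], [c𝔩] are a, b, c.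
  Plücker𝔩 : (ab ac bc : Trit) (a b c : Sign) → Set
  Plücker𝔩 ab ac bc a b c = Plücker ab ac ⌜ a ⌝ bc ⌜ b ⌝ ⌜ c ⌝

  plücker𝔩? : ∀ ab ac bc a b c → Dec (Plücker𝔩 ab ac bc a b c)
  plücker𝔩? ab ac bc a b c = _ Bool.≟ _

  Cyclic : (uv vw wu : Trit) → Set
  Cyclic uv vw wu = (uv ≡ ⊕ × vw ≡ ⊕) ⊎ (vw ≡ ⊕ × wu ≡ ⊕) ⊎ (wu ≡ ⊕ × uv ≡ ⊕)

  cyclic? : ∀ uv vw wu → Dec (Cyclic uv vw wu)
  cyclic? uv vw wu = (uv ≟ ⊕ ×-dec vw ≟ ⊕) ⊎-dec (vw ≟ ⊕ ×-dec wu ≟ ⊕) ⊎-dec (wu ≟ ⊕ ×-dec uv ≟ ⊕)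

  -- (-1)^wind(e,f) in terms of the signs of [ef], [e𝔩] and [f𝔩].
  turn : Trit → Sign → Sign → Sign
  turn ⊖ Sign.- Sign.+ = Sign.-
  turn ⊕ Sign.+ Sign.- = Sign.-
  turn _ _      _      = Sign.+

  -- Nested with `∀Sign?`, this turns a claim about all sign patterns into a single decision, which
  -- `toWitness` evaluates.
  ∀Trit? : {P : Trit → Set} → (∀ t → Dec (P t)) → Dec (∀ t → P t)
  ∀Trit? P? = map′ (λ { (p , q , r) ⊖ → p ; (p , q , r) ⊙ → q ; (p , q , r) ⊕ → r })
                   (λ f → f ⊖ , f ⊙ , f ⊕)
                   (P? ⊖ ×-dec P? ⊙ ×-dec P? ⊕)

  ∀Sign? : {P : Sign → Set} → (∀ t → Dec (P t)) → Dec (∀ t → P t)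
  ∀Sign? P? = map′ (λ { (p , q) Sign.- → p ; (p , q) Sign.+ → q })
                   (λ f → f Sign.- , f Sign.+)
                   (P? Sign.- ×-dec P? Sign.+)

  ·-rotate : ∀ w x y z → w · x · y · z ≡ x · y · z · w
  ·-rotate = toWitness {a? =
    ∀Sign? λ w → ∀Sign? λ x → ∀Sign? λ y → ∀Sign? λ z → w · x · y · z Sign.≟ x · y · z · w} _

  -- Meant for an edge `a` ending where `b` and `c` start, with `b`, `c`, `-a` counterclockwise. It
  -- compares the passages before and after a reversal of `b`. The parity depends only on the sector
  -- between the lines of `a`, `b`, `c` that contains the gauge direction, so finitely many patterns
  -- remain.
  turn-vertex : ∀ ab ac bc a b c → Plücker𝔩 ab ac bc a b c → Cyclic bc ac (neg ab) →
                turn ac a c · turn (neg bc) (opposite b) c · turn ab a b · b ≡ Sign.-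
  turn-vertex = toWitness {a? =
    ∀Trit? λ ab → ∀Trit? λ ac → ∀Trit? λ bc → ∀Sign? λ a → ∀Sign? λ b → ∀Sign? λ c →
    plücker𝔩? ab ac bc a b c →-dec cyclic? bc ac (neg ab) →-dec _ Sign.≟ _} _

  -- The counterpart where `a` and `b` end and `c` starts, with `-a`, `c`, `-b` counterclockwise:
  -- once `b` is reversed, `a` may continue along `-b`.
  turn-merge : ∀ ab ac bc a b c → Plücker𝔩 ab ac bc a b c → Cyclic (neg ac) bc (neg ab) →
               turn (neg ab) a (opposite b) · turn ac a c · turn bc b c · b ≡ Sign.-
  turn-merge = toWitness {a? =
    ∀Trit? λ ab → ∀Trit? λ ac → ∀Trit? λ bc → ∀Sign? λ a → ∀Sign? λ b → ∀Sign? λ c →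
    plücker𝔩? ab ac bc a b c →-dec cyclic? (neg ac) bc (neg ab) →-dec _ Sign.≟ _} _

  -- If the two directions lie on different sides of the gauge direction, exactly one of the
  -- passages from `a` to `b` and from `-b` to `-a` sweeps across it; otherwise none does.
  -- Antiparallel directions lie on different sides but wind in neither order, hence the hypothesis.
  turn-reverse : ∀ ab a b → (ab ≡ ⊙ → a ≡ b) →
                 turn ab a b · turn (neg ab) (opposite b) (opposite a) ≡ a · b
  turn-reverse = toWitness {a? =
    ∀Trit? λ ab → ∀Sign? λ a → ∀Sign? λ b →
    (ab ≟ ⊙ →-dec a Sign.≟ b) →-dec _ Sign.≟ _} _

  -- Vectors a, b, c, d with sum 0, the first two and the last two turning clockwise.
  turn-quadrilateral : ∀ bc ad ac bd →
    Balanced (⊕ ∷ neg ac ∷ neg ad ∷ []) → Balanced (⊖ ∷ neg bc ∷ neg bd ∷ []) →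
    Balanced (ac ∷ bc ∷ ⊕ ∷ []) → Balanced (ad ∷ bd ∷ ⊖ ∷ []) →
    Plücker ⊖ ac ad bc bd ⊖ →
    ∀ a b c d → Balanced (⌜ a ⌝ ∷ ⌜ b ⌝ ∷ ⌜ c ⌝ ∷ ⌜ d ⌝ ∷ []) →
    Plücker𝔩 ⊖ ac bc a b c → Plücker𝔩 ⊖ ad bd a b d →
    Plücker𝔩 ac ad ⊖ a c d → Plücker𝔩 bc bd ⊖ b c d →
    turn ⊖ a b · turn bc b c · turn ⊖ c d · turn (neg ad) d a ≡ Sign.-
    × (bc ≡ ⊙ → b ≡ c) × (neg ad ≡ ⊙ → d ≡ a)
  turn-quadrilateral = toWitness {a? =
    ∀Trit? λ bc → ∀Trit? λ ad → ∀Trit? λ ac → ∀Trit? λ bd →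
    _ Bool.≟ _ →-dec _ Bool.≟ _ →-dec _ Bool.≟ _ →-dec _ Bool.≟ _ →-dec
    plücker? ⊖ ac ad bc bd ⊖ →-dec
    ∀Sign? λ a → ∀Sign? λ b → ∀Sign? λ c → ∀Sign? λ d → _ Bool.≟ _ →-dec
    plücker𝔩? ⊖ ac bc a b c →-dec plücker𝔩? ⊖ ad bd a b d →-dec
    plücker𝔩? ac ad ⊖ a c d →-dec plücker𝔩? bc bd ⊖ b c d →-dec
    _ Sign.≟ _ ×-dec (bc ≟ ⊙ →-dec b Sign.≟ c) ×-dec (neg ad ≟ ⊙ →-dec d Sign.≟ a)} _

  -- Position of a vector u ≠ 0 relative to the wedge from x clockwise through o to y.
  wedge : ∀ xo oy xy xu uo uy → xo ≡ ⊖ → oy ≡ ⊖ → ¬ (xu ≡ ⊙ × uo ≡ ⊙) →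
          Plücker xo xy xu oy (neg uo) (neg uy) →
          Cyclic (neg xy) xu uy
          ⊎ (xu ≡ ⊖ × uo ≡ ⊖)
          ⊎ (uo ≡ ⊙ × xu ≡ ⊖)
          ⊎ (neg uo ≡ ⊖ × uy ≡ ⊖)
          ⊎ (xu ≡ ⊙ × uo ≡ ⊖)
          ⊎ (uy ≡ ⊙ × uo ≡ ⊕)
  wedge = toWitness {a? =
    ∀Trit? λ xo → ∀Trit? λ oy → ∀Trit? λ xy → ∀Trit? λ xu → ∀Trit? λ uo → ∀Trit? λ uy →
    xo ≟ ⊖ →-dec oy ≟ ⊖ →-dec ¬? (xu ≟ ⊙ ×-dec uo ≟ ⊙) →-dec
    plücker? xo xy xu oy (neg uo) (neg uy) →-dec
    (cyclic? (neg xy) xu uy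
    ⊎-dec (xu ≟ ⊖ ×-dec uo ≟ ⊖)
    ⊎-dec (uo ≟ ⊙ ×-dec xu ≟ ⊖)
    ⊎-dec (neg uo ≟ ⊖ ×-dec uy ≟ ⊖)
    ⊎-dec (xu ≟ ⊙ ×-dec uo ≟ ⊖)
    ⊎-dec (uy ≟ ⊙ ×-dec uo ≟ ⊕))} _

  -- The variant for a wedge below π, which can be described without an intermediate vector.
  wedge-convex : ∀ xy xu uy → xy ≡ ⊖ → ¬ (xu ≡ ⊙ × uy ≡ ⊙) →
                 Cyclic (neg xy) xu uy
                 ⊎ (xu ≡ ⊖ × uy ≡ ⊖)
                 ⊎ (xu ≡ ⊙ × uy ≡ ⊖)
                 ⊎ (uy ≡ ⊙ × xu ≡ ⊖)
  wedge-convex = toWitness {a? =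
    ∀Trit? λ xy → ∀Trit? λ xu → ∀Trit? λ uy →
    xy ≟ ⊖ →-dec ¬? (xu ≟ ⊙ ×-dec uy ≟ ⊙) →-dec
    (cyclic? (neg xy) xu uy
    ⊎-dec (xu ≟ ⊖ ×-dec uy ≟ ⊖)
    ⊎-dec (xu ≟ ⊙ ×-dec uy ≟ ⊖)
    ⊎-dec (uy ≟ ⊙ ×-dec xu ≟ ⊖))} _

  -- In the two lemmas below, j collects the four turns around the square, r and r′
  -- reversals at its corners, and v the turns at the corner in question.
  signs-at-S : ∀ eh₁ eh₂ t₁₃ t₃₄ t₄₂ t₂₁ t₂₄ g₂ g₄ →
    (j : t₁₃ · t₃₄ · t₄₂ · t₂₁ ≡ Sign.-) (r : t₄₂ · t₂₄ ≡ g₄ · opposite g₂)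
    (v : eh₁ · t₂₁ · eh₂ · g₂ ≡ Sign.-) →
    eh₁ · t₁₃ ≡ opposite (eh₂ · (g₄ · t₂₄ · t₃₄))
  signs-at-S = toWitness {a? =
    ∀Sign? λ eh₁ → ∀Sign? λ eh₂ → ∀Sign? λ t₁₃ → ∀Sign? λ t₃₄ → ∀Sign? λ t₄₂ →
    ∀Sign? λ t₂₁ → ∀Sign? λ t₂₄ → ∀Sign? λ g₂ → ∀Sign? λ g₄ →
    _ Sign.≟ _ →-dec _ Sign.≟ _ →-dec _ Sign.≟ _ →-dec _ Sign.≟ _} _

  signs-at-P : ∀ eh₁ eh₃ t₁₃ t₃₄ t₄₂ t₂₁ t₂₄ t₁₂ g₁ g₂ g₄ →
    (j : t₁₃ · t₃₄ · t₄₂ · t₂₁ ≡ Sign.-) (r : t₄₂ · t₂₄ ≡ g₄ · opposite g₂)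
    (r′ : t₂₁ · t₁₂ ≡ opposite g₂ · g₁)
    (v : eh₃ · t₁₃ · eh₁ · opposite g₁ ≡ Sign.-) →
    eh₁ · t₁₂ ≡ opposite (eh₃ · (g₄ · t₂₄ · t₃₄))
  signs-at-P = toWitness {a? =
    ∀Sign? λ eh₁ → ∀Sign? λ eh₃ → ∀Sign? λ t₁₃ → ∀Sign? λ t₃₄ → ∀Sign? λ t₄₂ →
    ∀Sign? λ t₂₁ → ∀Sign? λ t₂₄ → ∀Sign? λ t₁₂ → ∀Sign? λ g₁ → ∀Sign? λ g₂ → ∀Sign? λ g₄ →
    _ Sign.≟ _ →-dec _ Sign.≟ _ →-dec _ Sign.≟ _ →-dec _ Sign.≟ _ →-dec _ Sign.≟ _} _

-- Ordered field and signs of its elements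

module OrderedField (ℝ : RealNumbers) where

  open Plabic ℝ
  open SignCalculus
  open IntegerCoefficientSolver commutativeRing using (solve; _:=_; _:+_; _:*_; _:-_; :-_; con; -0≈0; Polynomial)
  open RingProperties ring using (-‿distribˡ-*; -‿distribʳ-*; -‿involutive)

  0<⇒≉0 : ∀ {x} → 0# < x → ¬ (x ≈ 0#)
  0<⇒≉0 0<x x≈0 = <.irrefl (sym x≈0) 0<x

  0<⇒-<0 : ∀ {x} → 0# < x → - x < 0#
  0<⇒-<0 {x} 0<x =
    <.<-respˡ-≈ (+-identityˡ (- x)) (<.<-respʳ-≈ (-‿inverseʳ x) (+-monoˡ-< (- x) 0<x))

  <0⇒0<- : ∀ {x} → x < 0# → 0# < - x
  <0⇒0<- {x} x<0 =
    <.<-respˡ-≈ (-‿inverseʳ x) (<.<-respʳ-≈ (+-identityˡ (- x)) (+-monoˡ-< (- x) x<0))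

  -<0⇒0< : ∀ {x} → - x < 0# → 0# < x
  -<0⇒0< -x<0 = <.<-respʳ-≈ (-‿involutive _) (<0⇒0<- -x<0)

  0<-⇒<0 : ∀ {x} → 0# < - x → x < 0#
  0<-⇒<0 0<-x = <.<-respˡ-≈ (-‿involutive _) (0<⇒-<0 0<-x)

  +-pos : ∀ {x y} → 0# < x → 0# < y → 0# < x + y
  +-pos {x} {y} 0<x 0<y = <.trans 0<y (<.<-respˡ-≈ (+-identityˡ y) (+-monoˡ-< y 0<x))

  +-neg : ∀ {x y} → x < 0# → y < 0# → x + y < 0#
  +-neg {x} {y} x<0 y<0 = <.trans (<.<-respʳ-≈ (+-identityˡ y) (+-monoˡ-< y x<0)) y<0

  *-pos-neg : ∀ {x y} → 0# < x → y < 0# → x * y < 0#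
  *-pos-neg {x} {y} 0<x y<0 =
    0<-⇒<0 (<.<-respʳ-≈ (sym (-‿distribʳ-* x y)) (*-pos 0<x (<0⇒0<- y<0)))

  *-neg-pos : ∀ {x y} → x < 0# → 0# < y → x * y < 0#
  *-neg-pos {x} {y} x<0 0<y = <.<-respˡ-≈ (*-comm y x) (*-pos-neg 0<y x<0)

  *-neg-neg : ∀ {x y} → x < 0# → y < 0# → 0# < x * y
  *-neg-neg {x} {y} x<0 y<0 =
    -<0⇒0< (<.<-respˡ-≈ (sym (-‿distribˡ-* x y)) (*-pos-neg (<0⇒0<- x<0) y<0))

  <⇒0<- : ∀ {x y} → x < y → 0# < y - x
  <⇒0<- {x} {y} x<y = <.<-respˡ-≈ (-‿inverseʳ x) (+-monoˡ-< (- x) x<y)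

  0<-⇒< : ∀ {x y} → 0# < y - x → x < y
  0<-⇒< {x} {y} 0<y-x =
    <.<-respˡ-≈ (+-identityˡ x)
      (<.<-respʳ-≈ (solve 2 (λ x y → y :- x :+ x := y) refl x y) (+-monoˡ-< x 0<y-x))

  *-inverse : ∀ {x} → ¬ (x ≈ 0#) → x ⁻¹ * x ≈ 1#
  *-inverse {x} x≉0 = trans (*-comm (x ⁻¹) x) (*-inverseʳ x≉0)

  ⁻¹-pos : ∀ {x} → 0# < x → 0# < x ⁻¹
  ⁻¹-pos {x} 0<x with <.compare 0# (x ⁻¹)
  ... | tri< 0<x⁻¹ _ _ = 0<x⁻¹
  ... | tri≈ _ 0≈x⁻¹ _ =
    contradiction 0<1 (<.irrefl (trans (sym (zeroʳ x)) (trans (*-congˡ 0≈x⁻¹) (*-inverseʳ (0<⇒≉0 0<x)))))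
  ... | tri> _ _ x⁻¹<0 =
    contradiction (<.<-respˡ-≈ (*-inverseʳ (0<⇒≉0 0<x)) (*-pos-neg 0<x x⁻¹<0)) (<.asym 0<1)

  square-pos : ∀ {x} → ¬ (x ≈ 0#) → 0# < x * x
  square-pos {x} x≉0 with <.compare 0# x
  ... | tri< 0<x _ _ = *-pos 0<x 0<x
  ... | tri≈ _ 0≈x _ = contradiction (sym 0≈x) x≉0
  ... | tri> _ _ x<0 = *-neg-neg x<0 x<0

  sum : List Carrier → Carrier
  sum = foldr _+_ 0#

  opaque
    sg : Carrier → Trit
    sg x with <.compare 0# x
    ... | tri< _ _ _ = ⊕
    ... | tri≈ _ _ _ = ⊙
    ... | tri> _ _ _ = ⊖

    sg-⊕ : ∀ {x} → 0# < x → sg x ≡ ⊕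
    sg-⊕ {x} 0<x with <.compare 0# x
    ... | tri< _ _ _   = ≡.refl
    ... | tri≈ 0≮x _ _ = contradiction 0<x 0≮x
    ... | tri> 0≮x _ _ = contradiction 0<x 0≮x

    sg-⊖ : ∀ {x} → x < 0# → sg x ≡ ⊖
    sg-⊖ {x} x<0 with <.compare 0# x
    ... | tri< _ _ x≮0 = contradiction x<0 x≮0
    ... | tri≈ _ _ x≮0 = contradiction x<0 x≮0
    ... | tri> _ _ _   = ≡.refl

    sg-⊙ : ∀ {x} → x ≈ 0# → sg x ≡ ⊙
    sg-⊙ {x} x≈0 with <.compare 0# x
    ... | tri< _ 0≉x _ = contradiction (sym x≈0) 0≉x
    ... | tri≈ _ _ _   = ≡.refl
    ... | tri> _ 0≉x _ = contradiction (sym x≈0) 0≉x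

    ⊕-sg : ∀ {x} → sg x ≡ ⊕ → 0# < x
    ⊕-sg {x} eq with <.compare 0# x
    ... | tri< 0<x _ _ = 0<x
    ⊕-sg () | tri≈ _ _ _
    ⊕-sg () | tri> _ _ _

    ⊖-sg : ∀ {x} → sg x ≡ ⊖ → x < 0#
    ⊖-sg {x} eq with <.compare 0# x
    ... | tri> _ _ x<0 = x<0
    ⊖-sg () | tri≈ _ _ _
    ⊖-sg () | tri< _ _ _

    ⊙-sg : ∀ {x} → sg x ≡ ⊙ → x ≈ 0#
    ⊙-sg {x} eq with <.compare 0# x
    ... | tri≈ _ 0≈x _ = sym 0≈x
    ⊙-sg () | tri< _ _ _
    ⊙-sg () | tri> _ _ _

    sg-cong : ∀ {x y} → x ≈ y → sg x ≡ sg y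
    sg-cong {x} {y} x≈y with <.compare 0# x
    ... | tri< 0<x _ _ = ≡.sym (sg-⊕ (<.<-respʳ-≈ x≈y 0<x))
    ... | tri≈ _ 0≈x _ = ≡.sym (sg-⊙ (trans (sym x≈y) (sym 0≈x)))
    ... | tri> _ _ x<0 = ≡.sym (sg-⊖ (<.<-respˡ-≈ x≈y x<0))

    sg-neg : ∀ x → sg (- x) ≡ neg (sg x)
    sg-neg x with <.compare 0# x
    ... | tri< 0<x _ _ = sg-⊖ (0<⇒-<0 0<x)
    ... | tri≈ _ 0≈x _ = sg-⊙ (trans (-‿cong (sym 0≈x)) -0≈0)
    ... | tri> _ _ x<0 = sg-⊕ (<0⇒0<- x<0)

    sg-* : ∀ x y → sg (x * y) ≡ sg x ⊗ sg y
    sg-* x y with <.compare 0# x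
    ... | tri≈ _ 0≈x _ = sg-⊙ (trans (*-congʳ (sym 0≈x)) (zeroˡ y))
    ... | tri< 0<x _ _ with <.compare 0# y
    ...   | tri< 0<y _ _ = sg-⊕ (*-pos 0<x 0<y)
    ...   | tri≈ _ 0≈y _ = sg-⊙ (trans (*-congˡ (sym 0≈y)) (zeroʳ x))
    ...   | tri> _ _ y<0 = sg-⊖ (*-pos-neg 0<x y<0)
    sg-* x y | tri> _ _ x<0 with <.compare 0# y
    ...   | tri< 0<y _ _ = sg-⊖ (*-neg-pos x<0 0<y)
    ...   | tri≈ _ 0≈y _ = sg-⊙ (trans (*-congˡ (sym 0≈y)) (zeroʳ x))
    ...   | tri> _ _ y<0 = sg-⊕ (*-neg-neg x<0 y<0)

    sum-nonneg : ∀ xs → hasNeg (map sg xs) ≡ false →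
                 (0# < sum xs) ⊎ (sum xs ≈ 0# × hasPos (map sg xs) ≡ false)
    sum-nonneg [] _ = inj₂ (refl , ≡.refl)
    sum-nonneg (x ∷ xs) eq with <.compare 0# x
    ... | tri> _ _ _ = contradiction eq λ ()
    ... | tri≈ _ 0≈x _ with sum-nonneg xs eq
    ...   | inj₁ 0<s       = inj₁ (<.<-respʳ-≈ (trans (sym (+-identityˡ _)) (+-congʳ 0≈x)) 0<s)
    ...   | inj₂ (s≈0 , p) = inj₂ (trans (+-cong (sym 0≈x) s≈0) (+-identityˡ 0#) , p)
    sum-nonneg (x ∷ xs) eq | tri< 0<x _ _ with sum-nonneg xs eq
    ...   | inj₁ 0<s       = inj₁ (+-pos 0<x 0<s)
    ...   | inj₂ (s≈0 , _) = inj₁ (<.<-respʳ-≈ (trans (sym (+-identityʳ x)) (+-congˡ (sym s≈0))) 0<x)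

    sum-nonpos : ∀ xs → hasPos (map sg xs) ≡ false →
                 (sum xs < 0#) ⊎ (sum xs ≈ 0# × hasNeg (map sg xs) ≡ false)
    sum-nonpos [] _ = inj₂ (refl , ≡.refl)
    sum-nonpos (x ∷ xs) eq with <.compare 0# x
    ... | tri< _ _ _ = contradiction eq λ ()
    ... | tri≈ _ 0≈x _ with sum-nonpos xs eq
    ...   | inj₁ s<0       = inj₁ (<.<-respˡ-≈ (trans (sym (+-identityˡ _)) (+-congʳ 0≈x)) s<0)
    ...   | inj₂ (s≈0 , p) = inj₂ (trans (+-cong (sym 0≈x) s≈0) (+-identityˡ 0#) , p)
    sum-nonpos (x ∷ xs) eq | tri> _ _ x<0 with sum-nonpos xs eq
    ...   | inj₁ s<0       = inj₁ (+-neg x<0 s<0)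
    ...   | inj₂ (s≈0 , _) = inj₁ (<.<-respˡ-≈ (trans (sym (+-identityʳ x)) (+-congˡ (sym s≈0))) x<0)

  -- A sum with a positive and no negative term is positive, and with a negative and no positive
  -- term it is negative.
  balanced : ∀ xs → sum xs ≈ 0# → Balanced (map sg xs)
  balanced xs s≈0 with hasPos (map sg xs) in p | hasNeg (map sg xs) in q
  ... | true  | true  = ≡.refl
  ... | false | false = ≡.refl
  ... | true  | false with sum-nonneg xs q
  ...   | inj₁ 0<s     = contradiction 0<s (<.irrefl (sym s≈0))
  ...   | inj₂ (_ , r) = ≡.trans (≡.sym p) r
  balanced xs s≈0 | false | true with sum-nonpos xs p
  ...   | inj₁ s<0     = contradiction s<0 (<.irrefl s≈0)
  ...   | inj₂ (_ , r) = ≡.trans (≡.sym r) q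

  [_,_] : Point → Point → Trit
  [ u , v ] = sg (cross u v)

  sg-cross-cong : ∀ {u u′ v v′} → u ≈ᵥ u′ → v ≈ᵥ v′ → [ u , v ] ≡ [ u′ , v′ ]
  sg-cross-cong p q = sg-cong (PlaneLemmas.cross-cong p q)

  sg-cross-anti : ∀ u v → [ v , u ] ≡ neg [ u , v ]
  sg-cross-anti u v = ≡.trans (sg-cong (sym (PlaneLemmas.cross-anti u v))) (sg-neg _)

  infixl 10 _⊠_
  -- The cross product of formal vectors: it lets the ring solver prove identities written in
  -- brackets.
  _⊠_ : ∀ {n} → Polynomial n × Polynomial n → Polynomial n × Polynomial n → Polynomial n
  (a , b) ⊠ (c , d) = a :* d :- b :* c

  sg-cross-negˡ : ∀ u v → [ -ᵥ u , v ] ≡ neg [ u , v ]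
  sg-cross-negˡ (a , b) (c , d) = ≡.trans
    (sg-cong (solve 4 (λ a b c d → (:- a) :* d :- (:- b) :* c := :- (a :* d :- b :* c)) refl a b c d))
    (sg-neg _)

  sg-cross-negʳ : ∀ u v → [ u , -ᵥ v ] ≡ neg [ u , v ]
  sg-cross-negʳ (a , b) (c , d) = ≡.trans
    (sg-cong (solve 4 (λ a b c d → a :* (:- d) :- b :* (:- c) := :- (a :* d :- b :* c)) refl a b c d))
    (sg-neg _)

  plücker : ∀ a b c d → Plücker [ a , b ] [ a , c ] [ a , d ] [ b , c ] [ b , d ] [ c , d ]
  plücker a@(a₁ , a₂) b@(b₁ , b₂) c@(c₁ , c₂) d@(d₁ , d₂) =
    ≡.subst Balanced
      (≡.cong₂ _∷_ (sg-* _ _) (≡.cong₂ _∷_ (≡.trans (sg-neg _) (≡.cong neg (sg-* _ _)))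
        (≡.cong (_∷ []) (sg-* _ _))))
      (balanced (cross a b * cross c d ∷ - (cross a c * cross b d) ∷ cross a d * cross b c ∷ [])
        (solve 8 (λ a₁ a₂ b₁ b₂ c₁ c₂ d₁ d₂ →
           let a = a₁ , a₂ ; b = b₁ , b₂ ; c = c₁ , c₂ ; d = d₁ , d₂
           in a ⊠ b :* c ⊠ d :+ (:- (a ⊠ c :* b ⊠ d) :+ (a ⊠ d :* b ⊠ c :+ con 0ℤ)) := con 0ℤ)
          refl a₁ a₂ b₁ b₂ c₁ c₂ d₁ d₂))

  cyclic : ∀ {u v w} → CyclicCCW u v w → Cyclic [ u , v ] [ v , w ] [ w , u ]
  cyclic (inj₁ (p , q))        = inj₁ (sg-⊕ p , sg-⊕ q)
  cyclic (inj₂ (inj₁ (p , q))) = inj₂ (inj₁ (sg-⊕ p , sg-⊕ q))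
  cyclic (inj₂ (inj₂ (p , q))) = inj₂ (inj₂ (sg-⊕ p , sg-⊕ q))

  ccw : ∀ {u v w} → Cyclic [ u , v ] [ v , w ] [ w , u ] → CyclicCCW u v w
  ccw (inj₁ (p , q))        = inj₁ (⊕-sg p , ⊕-sg q)
  ccw (inj₂ (inj₁ (p , q))) = inj₂ (inj₁ (⊕-sg p , ⊕-sg q))
  ccw (inj₂ (inj₂ (p , q))) = inj₂ (inj₂ (⊕-sg p , ⊕-sg q))

  sg-cross-flip : ∀ u v → [ u , -ᵥ v ] ≡ [ v , u ]
  sg-cross-flip u v = ≡.trans (sg-cross-negʳ u v) (≡.sym (sg-cross-anti u v))

-- Parities of windings at vertices and around a quadrilateral

module Turning (ℝ : RealNumbers) (𝔩 : Plabic.Point ℝ) where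

  open Plabic ℝ
  open SignCalculus
  open OrderedField ℝ
  open IntegerCoefficientSolver commutativeRing using (solve; _:=_; _:+_; _:-_; con)

  Transverse : Point → Set
  Transverse u = [ u , 𝔩 ] ≢ ⊙

  side : Point → Sign
  side u = ⌞ [ u , 𝔩 ] ⌟

  -- (-1)^wind(u,v) for u, v not parallel to 𝔩.
  τ : Point → Point → Sign
  τ u v = turn [ u , v ] (side u) (side v)

  -- For vectors transverse to 𝔩 this says that they are not antiparallel, which is the hypothesis
  -- of `turn-reverse`.
  Reversible : Point → Point → Set
  Reversible u v = [ u , v ] ≡ ⊙ → side u ≡ side v

  side-cong : ∀ {u v} → u ≈ᵥ v → side u ≡ side v
  side-cong p = ≡.cong ⌞_⌟ (sg-cross-cong p (refl , refl))

  τ-cong : ∀ {u u′ v v′} → u ≈ᵥ u′ → v ≈ᵥ v′ → τ u v ≡ τ u′ v′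
  τ-cong p q rewrite sg-cross-cong p q | side-cong p | side-cong q = ≡.refl

  side-neg : ∀ u → Transverse u → side (-ᵥ u) ≡ opposite (side u)
  side-neg u tu = ≡.trans (≡.cong ⌞_⌟ (sg-cross-negˡ u 𝔩)) (⌞neg⌟ _ tu)

  plücker𝔩 : ∀ a b c → Transverse a → Transverse b → Transverse c →
             Plücker𝔩 [ a , b ] [ a , c ] [ b , c ] (side a) (side b) (side c)
  plücker𝔩 a b c ta tb tc =
    ≡.subst (λ t → Plücker [ a , b ] [ a , c ] t [ b , c ] ⌜ side b ⌝ ⌜ side c ⌝) (⌜⌞ _ ⌟⌝ ta)
      (≡.subst (λ t → Plücker [ a , b ] [ a , c ] [ a , 𝔩 ] [ b , c ] t ⌜ side c ⌝) (⌜⌞ _ ⌟⌝ tb)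
        (≡.subst (Plücker [ a , b ] [ a , c ] [ a , 𝔩 ] [ b , c ] [ b , 𝔩 ]) (⌜⌞ _ ⌟⌝ tc)
          (plücker a b c 𝔩)))

  τ-≡ : ∀ {u v t a b} → [ u , v ] ≡ t → side u ≡ a → side v ≡ b → τ u v ≡ turn t a b
  τ-≡ ≡.refl ≡.refl ≡.refl = ≡.refl

  τ-vertex : ∀ a b c → Transverse a → Transverse b → Transverse c → CyclicCCW b c (-ᵥ a) →
             τ a c · τ (-ᵥ b) c · τ a b · side b ≡ Sign.-
  τ-vertex a b c ta tb tc cyc = ≡.trans
    (≡.cong (λ t → τ a c · t · τ a b · side b) (τ-≡ (sg-cross-negˡ b c) (side-neg b tb) ≡.refl))
    (turn-vertex [ a , b ] [ a , c ] [ b , c ] (side a) (side b) (side c) (plücker𝔩 a b c ta tb tc)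
      (≡.subst₂ (Cyclic [ b , c ]) (sg-cross-flip c a) (sg-cross-negˡ a b) (cyclic cyc)))

  τ-merge : ∀ a b c → Transverse a → Transverse b → Transverse c → CyclicCCW (-ᵥ a) c (-ᵥ b) →
            τ a (-ᵥ b) · τ a c · τ b c · side b ≡ Sign.-
  τ-merge a b c ta tb tc cyc = ≡.trans
    (≡.cong (λ t → t · τ a c · τ b c · side b) (τ-≡ (sg-cross-negʳ a b) ≡.refl (side-neg b tb)))
    (turn-merge [ a , b ] [ a , c ] [ b , c ] (side a) (side b) (side c) (plücker𝔩 a b c ta tb tc)
      (≡.subst₂ (λ t → Cyclic t [ b , c ]) (sg-cross-negˡ a c)
        (≡.trans (sg-cross-flip (-ᵥ b) a) (sg-cross-negʳ a b))
        (≡.subst (λ t → Cyclic [ -ᵥ a , c ] t [ -ᵥ b , -ᵥ a ]) (sg-cross-flip c b) (cyclic cyc))))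

  τ-reverse : ∀ a b → Transverse a → Transverse b → Reversible a b →
              τ a b · τ (-ᵥ b) (-ᵥ a) ≡ side a · side b
  τ-reverse a b ta tb r = ≡.trans
    (≡.cong (τ a b ·_)
      (τ-≡ (≡.trans (sg-cross-flip (-ᵥ b) a) (sg-cross-negʳ a b)) (side-neg b tb) (side-neg a ta)))
    (turn-reverse [ a , b ] (side a) (side b) r)

  -- The cut makes the corners at `q` and `t` strictly convex, which fixes the signs of `[ a , b ]`
  -- and `[ c , d ]`. The ends `p` and `r` of the diagonal may be convex, straight or reflex, so
  -- reversibility has to be proved exactly there.
  cut-quadrilateral : ∀ p q r t → let a = q -ᵥ p; b = r -ᵥ q; c = t -ᵥ r; d = p -ᵥ t in
    Transverse a → Transverse b → Transverse c → Transverse d → Cut p q r t →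
    τ a b · τ b c · τ c d · τ d a ≡ Sign.- × Reversible b c × Reversible d a
  cut-quadrilateral p@(p₁ , p₂) q@(q₁ , q₂) r@(r₁ , r₂) t@(t₁ , t₂) ta tb tc td (pqr , prt) =
    proof
    where
    a b c d : Point
    a = q -ᵥ p
    b = r -ᵥ q
    c = t -ᵥ r
    d = p -ᵥ t

    ab : [ a , b ] ≡ ⊖
    ab = ≡.trans (sg-cong (solve 6 (λ p₁ p₂ q₁ q₂ r₁ r₂ →
           (q₁ :- p₁ , q₂ :- p₂) ⊠ (r₁ :- q₁ , r₂ :- q₂) := (q₁ :- p₁ , q₂ :- p₂) ⊠ (r₁ :- p₁ , r₂ :- p₂))
           refl p₁ p₂ q₁ q₂ r₁ r₂)) (sg-⊖ pqr)

    cd : [ c , d ] ≡ ⊖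
    cd = ≡.trans (sg-cong (solve 6 (λ p₁ p₂ r₁ r₂ t₁ t₂ →
           (t₁ :- r₁ , t₂ :- r₂) ⊠ (p₁ :- t₁ , p₂ :- t₂) := (r₁ :- p₁ , r₂ :- p₂) ⊠ (t₁ :- p₁ , t₂ :- p₂))
           refl p₁ p₂ r₁ r₂ t₁ t₂)) (sg-⊖ prt)

    -- The sides of a closed polygon add up to zero; bracketing this with `a`, `b`, `c`, `d` and `𝔩`
    -- gives the five balance conditions of `turn-quadrilateral`.
    sum-cross : ∀ u → cross a u + (cross b u + (cross c u + (cross d u + 0#))) ≈ 0#
    sum-cross (u₁ , u₂) = solve 10 (λ u₁ u₂ p₁ p₂ q₁ q₂ r₁ r₂ t₁ t₂ →
      let u = u₁ , u₂ in
      (q₁ :- p₁ , q₂ :- p₂) ⊠ u :+ ((r₁ :- q₁ , r₂ :- q₂) ⊠ u :+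
      ((t₁ :- r₁ , t₂ :- r₂) ⊠ u :+ ((p₁ :- t₁ , p₂ :- t₂) ⊠ u :+ con 0ℤ)))
      := con 0ℤ) refl u₁ u₂ p₁ p₂ q₁ q₂ r₁ r₂ t₁ t₂

    column : ∀ u {w x y z} → [ a , u ] ≡ w → [ b , u ] ≡ x → [ c , u ] ≡ y → [ d , u ] ≡ z →
             Balanced (w ∷ x ∷ y ∷ z ∷ [])
    column u ≡.refl ≡.refl ≡.refl ≡.refl =
      balanced (cross a u ∷ cross b u ∷ cross c u ∷ cross d u ∷ []) (sum-cross u)

    self : ∀ u → [ u , u ] ≡ ⊙
    self u = sg-⊙ (PlaneLemmas.cross-self u)

    da : [ d , a ] ≡ neg [ a , d ]
    da = sg-cross-anti a d

    turns : τ a b · τ b c · τ c d · τ d a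
            ≡ turn ⊖ (side a) (side b) · τ b c · turn ⊖ (side c) (side d) · turn (neg [ a , d ]) (side d) (side a)
    turns = ≡.cong₂ _·_
      (≡.cong₂ (λ t u → t · τ b c · u) (τ-≡ ab ≡.refl ≡.refl) (τ-≡ cd ≡.refl ≡.refl))
      (τ-≡ da ≡.refl ≡.refl)

    signs : turn ⊖ (side a) (side b) · τ b c · turn ⊖ (side c) (side d) · turn (neg [ a , d ]) (side d) (side a) ≡ Sign.-
            × Reversible b c × (neg [ a , d ] ≡ ⊙ → side d ≡ side a)
    signs = turn-quadrilateral [ b , c ] [ a , d ] [ a , c ] [ b , d ]
      (column a (self a) (≡.trans (sg-cross-anti a b) (≡.cong neg ab)) (sg-cross-anti a c) (sg-cross-anti a d))
      (column b ab (self b) (sg-cross-anti b c) (sg-cross-anti b d))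
      (column c ≡.refl ≡.refl (self c) (≡.trans (sg-cross-anti c d) (≡.cong neg cd)))
      (column d ≡.refl ≡.refl cd (self d))
      (≡.subst₂ (λ t u → Plücker t [ a , c ] [ a , d ] [ b , c ] [ b , d ] u) ab cd (plücker a b c d))
      (side a) (side b) (side c) (side d)
      (column 𝔩 (⌜⌞ _ ⌟⌝ ta) (⌜⌞ _ ⌟⌝ tb) (⌜⌞ _ ⌟⌝ tc) (⌜⌞ _ ⌟⌝ td))
      (≡.subst (λ t → Plücker𝔩 t [ a , c ] [ b , c ] (side a) (side b) (side c)) ab (plücker𝔩 a b c ta tb tc))
      (≡.subst (λ t → Plücker𝔩 t [ a , d ] [ b , d ] (side a) (side b) (side d)) ab (plücker𝔩 a b d ta tb td))
      (≡.subst (λ t → Plücker𝔩 [ a , c ] [ a , d ] t (side a) (side c) (side d)) cd (plücker𝔩 a c d ta tc td))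
      (≡.subst (λ t → Plücker𝔩 [ b , c ] [ b , d ] t (side b) (side c) (side d)) cd (plücker𝔩 b c d tb tc td))

    proof : τ a b · τ b c · τ c d · τ d a ≡ Sign.- × Reversible b c × Reversible d a
    proof = ≡.trans turns (proj₁ signs) , proj₁ (proj₂ signs) , λ eq → proj₂ (proj₂ signs) (≡.trans (≡.sym da) eq)

  -- With S, P, Q, R for `p`, `q`, `r`, `t`, reversals are wanted at R and S. For either diagonal,
  -- one of these corners is an end of it, where `cut-quadrilateral` applies, and the other is
  -- strictly convex, so that the bracket there is not zero.
  quadrilateral-turns : ∀ p q r t → let a = q -ᵥ p; b = r -ᵥ q; c = t -ᵥ r; d = p -ᵥ t in
    Transverse a → Transverse b → Transverse c → Transverse d → ClockwiseQuadrilateral p q r t →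
    τ a b · τ b c · τ c d · τ d a ≡ Sign.- × Reversible c d × Reversible d a
  quadrilateral-turns p@(p₁ , p₂) q@(q₁ , q₂) r@(r₁ , r₂) t@(t₁ , t₂) ta tb tc td (inj₁ cut@(_ , prt)) =
    proj₁ turns , (λ cd → contradiction (≡.trans (≡.sym cd) cd≡⊖) λ ()) , proj₂ (proj₂ turns)
    where
    turns = cut-quadrilateral p q r t ta tb tc td cut

    cd≡⊖ : [ t -ᵥ r , p -ᵥ t ] ≡ ⊖
    cd≡⊖ = ≡.trans (sg-cong (solve 6 (λ p₁ p₂ r₁ r₂ t₁ t₂ →
           (t₁ :- r₁ , t₂ :- r₂) ⊠ (p₁ :- t₁ , p₂ :- t₂) := (r₁ :- p₁ , r₂ :- p₂) ⊠ (t₁ :- p₁ , t₂ :- p₂))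
           refl p₁ p₂ r₁ r₂ t₁ t₂)) (sg-⊖ prt)
  quadrilateral-turns p@(p₁ , p₂) q@(q₁ , q₂) r@(r₁ , r₂) t@(t₁ , t₂) ta tb tc td (inj₂ cut@(_ , qtp)) =
    ≡.trans (·-rotate (τ (q -ᵥ p) (r -ᵥ q)) _ _ _) (proj₁ turns) ,
    proj₁ (proj₂ turns) , (λ da → contradiction (≡.trans (≡.sym da) da≡⊖) λ ())
    where
    turns = cut-quadrilateral q r t p tb tc td ta cut

    da≡⊖ : [ p -ᵥ t , q -ᵥ p ] ≡ ⊖
    da≡⊖ = ≡.trans (sg-cong (solve 6 (λ p₁ p₂ q₁ q₂ t₁ t₂ →
           (p₁ :- t₁ , p₂ :- t₂) ⊠ (q₁ :- p₁ , q₂ :- p₂) := (t₁ :- q₁ , t₂ :- q₂) ⊠ (p₁ :- q₁ , p₂ :- q₂))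
           refl p₁ p₂ q₁ q₂ t₁ t₂)) (sg-⊖ qtp)

-- Direction of an edge leaving a corner of a face

module Corners (ℝ : RealNumbers) where

  open Plabic ℝ
  open SignCalculus
  open OrderedField ℝ
  open IntegerCoefficientSolver commutativeRing using (solve; _:=_; _:+_; _:*_; _:-_; :-_; con)
  open SetoidReasoning setoid

  complement-<1 : ∀ {s t} → 0# < t → s + t ≈ 1# → s < 1#
  complement-<1 {s} {t} 0<t s+t≈1 = 0<-⇒< (<.<-respʳ-≈
    (trans (solve 2 (λ s t → t := s :+ t :- s) refl s t) (+-congʳ s+t≈1)) 0<t)

  -- Divides the unit in the ratio of `a` to `b`; the source of the parameters strictly between 0
  -- and 1 used below.
  split-unit : ∀ {a b} → 0# < a → 0# < b →
               ∃[ s ] ∃[ t ] 0# < s × 0# < t × s + t ≈ 1# × s * b ≈ t * a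
  split-unit {a} {b} 0<a 0<b =
    a * c , b * c , *-pos 0<a 0<c , *-pos 0<b 0<c ,
    trans (sym (distribʳ c a b)) (*-inverseʳ (0<⇒≉0 0<a+b)) ,
    solve 3 (λ a b c → a :* c :* b := b :* c :* a) refl a b c
    where
    0<a+b = +-pos 0<a 0<b
    c = (a + b) ⁻¹
    0<c = ⁻¹-pos 0<a+b

  Overlap : (v x u : Point) → Set
  Overlap v x u = ∃[ s ] ∃[ t ] (0# < s × s < 1#) × (0# < t × t < 1#) × v +ᵥ t • u ≈ᵥ v +ᵥ s • x

  -- Cramer's rule with an auxiliary vector `z`: the factor is the quotient of the brackets of `u`
  -- and `x` with `z`, which have the same sign.
  positive-multiple : ∀ x u z → cross x u ≈ 0# → 0# < cross u z * cross x z →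
                      ∃[ r ] 0# < r × u ≈ᵥ r • x
  positive-multiple x@(x₁ , x₂) u@(u₁ , u₂) z@(z₁ , z₂) xu≈0 0<uz*xz = r , 0<r , u≈rx
    where
    c r : Carrier
    c = cross x z ⁻¹
    r = cross u z * c

    xz≉0 : ¬ (cross x z ≈ 0#)
    xz≉0 xz≈0 = 0<⇒≉0 0<uz*xz (trans (*-congˡ xz≈0) (zeroʳ _))

    c≉0 : ¬ (c ≈ 0#)
    c≉0 c≈0 = 0<⇒≉0 0<1 (trans (sym (*-inverseʳ xz≉0)) (trans (*-congˡ c≈0) (zeroʳ _)))

    0<r : 0# < r
    -- `r` is the given positive product times the square of `c`, the inverse of the bracket of `x`
    -- and `z`.
    0<r = <.<-respʳ-≈ (begin
      cross u z * cross x z * (c * c)    ≈⟨ solve 3 (λ a b c → a :* b :* (c :* c) := a :* c :* (b :* c)) refl _ _ c ⟩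
      r * (cross x z * c)               ≈⟨ *-congˡ (*-inverseʳ xz≉0) ⟩
      r * 1#                            ≈⟨ *-identityʳ r ⟩
      r                                 ∎) (*-pos 0<uz*xz (square-pos c≉0))

    coordinate : ∀ {xᵢ uᵢ zᵢ} → uᵢ * cross x z ≈ xᵢ * cross u z + zᵢ * cross x u → uᵢ ≈ r * xᵢ
    coordinate {xᵢ} {uᵢ} {zᵢ} eq = begin
      uᵢ                                            ≈⟨ PlaneLemmas.cancelʳ xz≉0 refl ⟨
      uᵢ * cross x z * c                            ≈⟨ *-congʳ eq ⟩
      (xᵢ * cross u z + zᵢ * cross x u) * c         ≈⟨ *-congʳ (+-congˡ (trans (*-congˡ xu≈0) (zeroʳ zᵢ))) ⟩
      (xᵢ * cross u z + 0#) * c                     ≈⟨ solve 3 (λ x a c → (x :* a :+ con 0ℤ) :* c := a :* c :* x) refl xᵢ _ c ⟩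
      r * xᵢ                                       ∎

    u≈rx : u ≈ᵥ r • x
    u≈rx = coordinate (solve 6 (λ x₁ x₂ u₁ u₂ z₁ z₂ → let x = x₁ , x₂ ; u = u₁ , u₂ ; z = z₁ , z₂ in
             u₁ :* x ⊠ z := x₁ :* u ⊠ z :+ z₁ :* x ⊠ u) refl x₁ x₂ u₁ u₂ z₁ z₂)
         , coordinate (solve 6 (λ x₁ x₂ u₁ u₂ z₁ z₂ → let x = x₁ , x₂ ; u = u₁ , u₂ ; z = z₁ , z₂ in
             u₂ :* x ⊠ z := x₂ :* u ⊠ z :+ z₂ :* x ⊠ u) refl x₁ x₂ u₁ u₂ z₁ z₂)

  parallel-overlap : ∀ v x u z → cross x u ≈ 0# → 0# < cross u z * cross x z → Overlap v x u
  parallel-overlap v x u z xu≈0 0<uz*xz =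
    let r , 0<r , u≈rx = positive-multiple x u z xu≈0 0<uz*xz
        -- `t` = 1/(1+r) and `s` = r/(1+r) stay below 1 however large or small `r` is.
        t , s , 0<t , 0<s , t+s≈1 , tr≈s = split-unit 0<1 0<r
        scale : ∀ {xᵢ uᵢ} → uᵢ ≈ r * xᵢ → t * uᵢ ≈ s * xᵢ
        scale {xᵢ} eq =
          trans (*-congˡ eq) (trans (sym (*-assoc t r xᵢ)) (*-congʳ (trans tr≈s (*-identityʳ s))))
    in s , t , (0<s , complement-<1 0<t (trans (+-comm s t) t+s≈1)) , (0<t , complement-<1 0<s t+s≈1) ,
       +-congˡ (scale (proj₁ u≈rx)) , +-congˡ (scale (proj₂ u≈rx))

  inside-triangle : ∀ v x y u → CW v x y → cross (x -ᵥ v) u < 0# → cross u (y -ᵥ v) < 0# →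
                    ∃[ t ] (0# < t × t < 1#) × InTriangle v x y (v +ᵥ t • u)
  inside-triangle v@(v₁ , v₂) x@(x₁ , x₂) y@(y₁ , y₂) u@(u₁ , u₂) cw xu<0 uy<0 =
    -- At parameter s the bracket against the side `xy` is s`m` - `k`, so the ray crosses the line
    -- `xy` at `k`/`m`. The choice s = `k`/(`k`+`m`) is smaller than both this value and 1.
    inner (split-unit (<0⇒0<- cw) (+-pos (<0⇒0<- uy<0) (<0⇒0<- xu<0)))
    where
    k = - cross (x -ᵥ v) (y -ᵥ v)
    m = - cross u (y -ᵥ v) + - cross (x -ᵥ v) u

    inner : ∃[ s ] ∃[ t ] 0# < s × 0# < t × s + t ≈ 1# × s * m ≈ t * k →
            ∃[ t ] (0# < t × t < 1#) × InTriangle v x y (v +ᵥ t • u)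
    inner (s , t , 0<s , 0<t , s+t≈1 , sm≈tk) =
      s , (0<s , complement-<1 0<t s+t≈1) ,
      <.<-respˡ-≈ (solve 7 (λ s v₁ v₂ x₁ x₂ u₁ u₂ →
          s :* (x₁ :- v₁ , x₂ :- v₂) ⊠ (u₁ , u₂)
          := (x₁ :- v₁ , x₂ :- v₂) ⊠ (v₁ :+ s :* u₁ :- v₁ , v₂ :+ s :* u₂ :- v₂))
          refl s v₁ v₂ x₁ x₂ u₁ u₂) (*-pos-neg 0<s xu<0) ,
      <.<-respˡ-≈ (begin
          - (s * k)                    ≈⟨ solve 3 (λ s t k → :- (s :* k) := t :* k :- (s :+ t) :* k) refl s t k ⟩
          t * k - (s + t) * k          ≈⟨ +-cong (sym sm≈tk) (-‿cong (*-congʳ s+t≈1)) ⟩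
          s * m - 1# * k               ≈⟨ solve 9 (λ s v₁ v₂ x₁ x₂ y₁ y₂ u₁ u₂ →
             let x = x₁ :- v₁ , x₂ :- v₂ ; y = y₁ :- v₁ , y₂ :- v₂ ; u = u₁ , u₂ in
             s :* (:- (u ⊠ y) :+ :- (x ⊠ u)) :- con 1ℤ :* (:- (x ⊠ y))
             := (y₁ :- x₁ , y₂ :- x₂) ⊠ (v₁ :+ s :* u₁ :- x₁ , v₂ :+ s :* u₂ :- x₂))
             refl s v₁ v₂ x₁ x₂ y₁ y₂ u₁ u₂ ⟩
          cross (y -ᵥ x) ((v +ᵥ s • u) -ᵥ x)  ∎)
        (0<⇒-<0 (*-pos 0<s (<0⇒0<- cw))) ,
      <.<-respˡ-≈ (solve 7 (λ s v₁ v₂ y₁ y₂ u₁ u₂ →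
          s :* (u₁ , u₂) ⊠ (y₁ :- v₁ , y₂ :- v₂)
          := (v₁ :- y₁ , v₂ :- y₂) ⊠ (v₁ :+ s :* u₁ :- y₁ , v₂ :+ s :* u₂ :- y₂))
          refl s v₁ v₂ y₁ y₂ u₁ u₂) (*-pos-neg 0<s uy<0)

  independent : ∀ x u z → ¬ (cross x z ≈ 0#) → cross x u ≈ 0# → cross u z ≈ 0# → u ≈ᵥ (0# , 0#)
  independent x@(x₁ , x₂) u@(u₁ , u₂) z@(z₁ , z₂) xz≉0 xu≈0 uz≈0 =
      coordinate (solve 6 (λ x₁ x₂ u₁ u₂ z₁ z₂ → let x = x₁ , x₂ ; u = u₁ , u₂ ; z = z₁ , z₂ in
        u₁ :* x ⊠ z := x₁ :* u ⊠ z :+ z₁ :* x ⊠ u) refl x₁ x₂ u₁ u₂ z₁ z₂)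
    , coordinate (solve 6 (λ x₁ x₂ u₁ u₂ z₁ z₂ → let x = x₁ , x₂ ; u = u₁ , u₂ ; z = z₁ , z₂ in
        u₂ :* x ⊠ z := x₂ :* u ⊠ z :+ z₂ :* x ⊠ u) refl x₁ x₂ u₁ u₂ z₁ z₂)
    where
    coordinate : ∀ {xᵢ uᵢ zᵢ} → uᵢ * cross x z ≈ xᵢ * cross u z + zᵢ * cross x u → uᵢ ≈ 0#
    coordinate {xᵢ} {uᵢ} {zᵢ} eq = begin
      uᵢ                         ≈⟨ PlaneLemmas.cancelʳ xz≉0 (trans eq (+-cong (*-congˡ uz≈0) (*-congˡ xu≈0))) ⟨
      (xᵢ * 0# + zᵢ * 0#) * _    ≈⟨ solve 3 (λ x z c → (x :* con 0ℤ :+ z :* con 0ℤ) :* c := con 0ℤ) refl xᵢ zᵢ _ ⟩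
      0#                         ∎

  CW-rotate : ∀ a b c → CW a b c → CW b c a
  CW-rotate (a₁ , a₂) (b₁ , b₂) (c₁ , c₂) = <.<-respˡ-≈ (solve 6 (λ a₁ a₂ b₁ b₂ c₁ c₂ →
    (b₁ :- a₁ , b₂ :- a₂) ⊠ (c₁ :- a₁ , c₂ :- a₂) := (c₁ :- b₁ , c₂ :- b₂) ⊠ (a₁ :- b₁ , a₂ :- b₂))
    refl a₁ a₂ b₁ b₂ c₁ c₂)

  -- Relative to the wedge of the quadrilateral at `v`, a nonzero direction points outward, or gives
  -- a point of the open segment `vw` in a triangle of the cut or on its diagonal, or runs along one
  -- of the sides at `v`. The hypotheses exclude everything but the first.
  corner : ∀ v x o y w → ClockwiseQuadrilateral v x o y →
           (∀ t → 0# < t → t < 1# → ¬ InQuadrilateral v x o y (v +ᵥ t • (w -ᵥ v))) →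
           ¬ Overlap v (x -ᵥ v) (w -ᵥ v) → ¬ Overlap v (y -ᵥ v) (w -ᵥ v) → ¬ (w ≈ᵥ v) →
           CyclicCCW (y -ᵥ v) (x -ᵥ v) (w -ᵥ v)
  corner v@(v₁ , v₂) x o y w@(w₁ , w₂) quad outside not-x not-y w≉v = direction quad outside
    where
    X O Y U : Point
    X = x -ᵥ v
    O = o -ᵥ v
    Y = y -ᵥ v
    U = w -ᵥ v

    nonzero : ∀ z → cross X z < 0# → ¬ ([ X , U ] ≡ ⊙ × [ U , z ] ≡ ⊙)
    nonzero z xz<0 (xu , uz) =
      w≉v (Product.map -≈0 -≈0 (independent X U z (λ xz≈0 → <.irrefl xz≈0 xz<0) (⊙-sg xu) (⊙-sg uz)))
      where
      -≈0 : ∀ {a b} → a - b ≈ 0# → a ≈ b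
      -≈0 {a} {b} eq = trans (solve 2 (λ a b → a := a :- b :+ b) refl a b) (trans (+-congʳ eq) (+-identityˡ b))

    inside : ∀ a b → CW v a b → [ a -ᵥ v , U ] ≡ ⊖ → [ U , b -ᵥ v ] ≡ ⊖ →
             ∃[ t ] (0# < t × t < 1#) × InTriangle v a b (v +ᵥ t • U)
    inside a b cw au ub = inside-triangle v a b U cw (⊖-sg au) (⊖-sg ub)

    along : ∀ z z′ → [ z , U ] ≡ ⊙ → 0# < cross U z′ * cross z z′ → Overlap v z U
    along z z′ zu = parallel-overlap v z U z′ (⊙-sg zu)

    flip⊙ : ∀ {z} → [ U , z ] ≡ ⊙ → [ z , U ] ≡ ⊙
    flip⊙ {z} uz = ≡.trans (sg-cross-anti U z) (≡.cong neg uz)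

    flip⊖ : ∀ {a b} → cross a b < 0# → 0# < cross b a
    flip⊖ {a} {b} ab<0 = <.<-respʳ-≈ (PlaneLemmas.cross-anti a b) (<0⇒0<- ab<0)

    outward : Cyclic (neg [ X , Y ]) [ X , U ] [ U , Y ] → CyclicCCW Y X U
    outward cyc = ccw (≡.subst (λ t → Cyclic t [ X , U ] [ U , Y ]) (≡.sym (sg-cross-anti X Y)) cyc)

    direction : ClockwiseQuadrilateral v x o y →
                (∀ t → 0# < t → t < 1# → ¬ InQuadrilateral v x o y (v +ᵥ t • U)) → CyclicCCW Y X U
    -- The diagonal starts at `v` and splits the wedge into two wedges below π, so a reflex corner
    -- needs no separate treatment.
    direction (inj₁ cut@(vxo , voy)) outside =
      cases (wedge [ X , O ] [ O , Y ] [ X , Y ] [ X , U ] [ U , O ] [ U , Y ] (sg-⊖ vxo) (sg-⊖ voy)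
        (nonzero O vxo)
        (≡.subst₂ (Plücker [ X , O ] [ X , Y ] [ X , U ] [ O , Y ]) (sg-cross-anti U O) (sg-cross-anti U Y)
          (plücker X O Y U)))
      where
      cases : _ → CyclicCCW Y X U
      cases (inj₁ cyc) = outward cyc
      cases (inj₂ (inj₁ (xu , uo))) =
        let t , (0<t , t<1) , tri = inside x o vxo xu uo
        in contradiction (inj₁ (cut , inj₁ tri)) (outside t 0<t t<1)
      cases (inj₂ (inj₂ (inj₁ (uo , xu)))) =
        let s , t , (0<s , s<1) , (0<t , t<1) , eq = along O X (flip⊙ uo) (*-pos (flip⊖ (⊖-sg xu)) (flip⊖ vxo))
        in contradiction (inj₁ (cut , inj₂ (inj₂ (s , 0<s , s<1 , eq)))) (outside t 0<t t<1)
      cases (inj₂ (inj₂ (inj₂ (inj₁ (ou , uy))))) =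
        let t , (0<t , t<1) , tri = inside o y voy (≡.trans (sg-cross-anti U O) ou) uy
        in contradiction (inj₁ (cut , inj₂ (inj₁ tri))) (outside t 0<t t<1)
      cases (inj₂ (inj₂ (inj₂ (inj₂ (inj₁ (xu , uo)))))) =
        contradiction (along X O xu (*-neg-neg (⊖-sg uo) vxo)) not-x
      cases (inj₂ (inj₂ (inj₂ (inj₂ (inj₂ (uy , uo)))))) =
        contradiction (along Y O (flip⊙ uy) (*-pos (⊕-sg uo) (flip⊖ voy))) not-y
    -- The diagonal joins the neighbours of `v`; the corner is strictly convex, and the triangle
    -- `xyv` of the cut suffices.
    direction (inj₂ cut@(xoy , xyv)) outside =
      cases (wedge-convex [ X , Y ] [ X , U ] [ U , Y ] (sg-⊖ vxy) (nonzero Y vxy))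
      where
      vxy : CW v x y
      vxy = CW-rotate y v x (CW-rotate x y v xyv)

      cases : _ → CyclicCCW Y X U
      cases (inj₁ cyc) = outward cyc
      cases (inj₂ (inj₁ (xu , uy))) =
        let t , (0<t , t<1) , (p , q , r) = inside x y vxy xu uy
        in contradiction (inj₂ (cut , inj₂ (inj₁ (q , r , p)))) (outside t 0<t t<1)
      cases (inj₂ (inj₂ (inj₁ (xu , uy)))) =
        contradiction (along X Y xu (*-neg-neg (⊖-sg uy) vxy)) not-x
      cases (inj₂ (inj₂ (inj₂ (uy , xu)))) =
        contradiction (along Y X (flip⊙ uy) (*-pos (flip⊖ (⊖-sg xu)) (flip⊖ vxy))) not-y

-- Parities of integers and of counts

module Parity where

  open SignCalculus

  parity : ℕ → Sign
  parity zero    = Sign.+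
  parity (suc n) = opposite (parity n)

  parityℤ : ℤ → Sign
  parityℤ z = parity ∣ z ∣

  opposite-·ˡ : ∀ a b → opposite a · b ≡ opposite (a · b)
  opposite-·ˡ Sign.+ Sign.+ = ≡.refl
  opposite-·ˡ Sign.+ Sign.- = ≡.refl
  opposite-·ˡ Sign.- Sign.+ = ≡.refl
  opposite-·ˡ Sign.- Sign.- = ≡.refl

  opposite-opposite : ∀ a b → opposite a · opposite b ≡ a · b
  opposite-opposite Sign.+ Sign.+ = ≡.refl
  opposite-opposite Sign.+ Sign.- = ≡.refl
  opposite-opposite Sign.- Sign.+ = ≡.refl
  opposite-opposite Sign.- Sign.- = ≡.refl

  parity-+ : ∀ m n → parity (m ℕ.+ n) ≡ parity m · parity n
  parity-+ zero    n = ≡.refl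
  parity-+ (suc m) n = ≡.trans (≡.cong opposite (parity-+ m n)) (≡.sym (opposite-·ˡ (parity m) (parity n)))

  parity-⊖ : ∀ m n → parityℤ (m ℤ.⊖ n) ≡ parity m · parity n
  parity-⊖ m       zero    = ≡.sym (Sign.*-identityʳ (parity m))
  parity-⊖ zero    (suc n) = ≡.refl
  parity-⊖ (suc m) (suc n) = ≡.trans (≡.cong parityℤ (ℤ.[1+m]⊖[1+n]≡m⊖n m n))
    (≡.trans (parity-⊖ m n) (≡.sym (opposite-opposite (parity m) (parity n))))

  parityℤ-+ : ∀ i j → parityℤ (i ℤ.+ j) ≡ parityℤ i · parityℤ j
  parityℤ-+ (+ m)    (+ n)    = parity-+ m n
  parityℤ-+ (+ m)    -[1+ n ] = parity-⊖ m (suc n)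
  parityℤ-+ -[1+ m ] (+ n)    = ≡.trans (parity-⊖ n (suc m)) (Sign.*-comm (parity n) (parity (suc m)))
  parityℤ-+ -[1+ m ] -[1+ n ] =
    ≡.trans (≡.cong parity (≡.cong suc (≡.sym (ℕ.+-suc m n)))) (parity-+ (suc m) (suc n))

  indicator : Bool → Sign
  indicator true  = Sign.-
  indicator false = Sign.+

  module _ {a} {A : Set a} where

    count : {P : A → Set} → (∀ x → Dec (P x)) → List A → Sign
    count P? xs = parity (length (filter P? xs))

    count-∷ : {P : A → Set} (P? : ∀ x → Dec (P x)) → ∀ x xs →
              count P? (x ∷ xs) ≡ indicator (does (P? x)) · count P? xs
    count-∷ P? x xs with does (P? x)
    ... | true  = ≡.refl
    ... | false = ≡.refl

    ·-interchange₄ : ∀ a b c d a′ b′ c′ d′ → a · b · c · d ≡ Sign.+ → a′ · b′ · c′ · d′ ≡ Sign.+ →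
                     (a · a′) · (b · b′) · (c · c′) · (d · d′) ≡ Sign.+
    ·-interchange₄ = toWitness {a? =
      ∀Sign? λ a → ∀Sign? λ b → ∀Sign? λ c → ∀Sign? λ d →
      ∀Sign? λ a′ → ∀Sign? λ b′ → ∀Sign? λ c′ → ∀Sign? λ d′ →
      _ Sign.≟ _ →-dec _ Sign.≟ _ →-dec _ Sign.≟ _} _

    -- Each list element multiplies the product by its own four indicators, so evenness can be
    -- checked element by element.
    count₄ : {P Q R S : A → Set} (P? : ∀ x → Dec (P x)) (Q? : ∀ x → Dec (Q x))
             (R? : ∀ x → Dec (R x)) (S? : ∀ x → Dec (S x)) →
             (∀ x → indicator (does (P? x)) · indicator (does (Q? x))
                  · indicator (does (R? x)) · indicator (does (S? x)) ≡ Sign.+) →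
             ∀ xs → count P? xs · count Q? xs · count R? xs · count S? xs ≡ Sign.+
    count₄ P? Q? R? S? even [] = ≡.refl
    count₄ P? Q? R? S? even (x ∷ xs)
      rewrite count-∷ P? x xs | count-∷ Q? x xs | count-∷ R? x xs | count-∷ S? x xs =
      ·-interchange₄ (indicator (does (P? x))) (indicator (does (Q? x)))
        (indicator (does (R? x))) (indicator (does (S? x))) _ _ _ _ (even x) (count₄ P? Q? R? S? even xs)

-- Signs as units of the field

module SignedUnits (ℝ : RealNumbers) where

  open RealNumbers ℝ hiding (zero)
  open IntegerCoefficientSolver commutativeRing using (solve; _:=_; _:*_; :-_; con)

  ⟦_⟧ : Sign → Carrier
  ⟦ Sign.+ ⟧ = 1#
  ⟦ Sign.- ⟧ = - 1#

  ⟦opposite⟧ : ∀ a → ⟦ opposite a ⟧ ≈ - 1# * ⟦ a ⟧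
  ⟦opposite⟧ Sign.+ = sym (*-identityʳ (- 1#))
  ⟦opposite⟧ Sign.- = solve 0 (con 1ℤ := :- con 1ℤ :* :- con 1ℤ) refl

  ⟦·⟧ : ∀ a b → ⟦ a · b ⟧ ≈ ⟦ a ⟧ * ⟦ b ⟧
  ⟦·⟧ Sign.+ b = sym (*-identityˡ ⟦ b ⟧)
  ⟦·⟧ Sign.- b = ⟦opposite⟧ b

  ⟦⟧-square : ∀ a → ⟦ a ⟧ * ⟦ a ⟧ ≈ 1#
  ⟦⟧-square Sign.+ = *-identityˡ 1#
  ⟦⟧-square Sign.- = sym (⟦opposite⟧ Sign.-)

  ⟦·⟧₃ : ∀ a b c → ⟦ a · b · c ⟧ ≈ ⟦ a ⟧ * ⟦ b ⟧ * ⟦ c ⟧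
  ⟦·⟧₃ a b c = trans (⟦·⟧ (a · b) c) (*-congʳ (⟦·⟧ a b))

  -- With `units₃`, carries sign identities proved by enumeration over to the field; products with
  -- fewer factors are padded by `Sign.+`.
  units₂ : ∀ a b c d → a · b ≡ c · d → ⟦ a ⟧ * ⟦ b ⟧ ≈ ⟦ c ⟧ * ⟦ d ⟧
  units₂ a b c d eq = trans (sym (⟦·⟧ a b)) (trans (reflexive (≡.cong ⟦_⟧ eq)) (⟦·⟧ c d))

  units₃ : ∀ a b c d e f → a · b · c ≡ d · e · f → ⟦ a ⟧ * ⟦ b ⟧ * ⟦ c ⟧ ≈ ⟦ d ⟧ * ⟦ e ⟧ * ⟦ f ⟧
  units₃ a b c d e f eq =
    trans (sym (⟦·⟧₃ a b c)) (trans (reflexive (≡.cong ⟦_⟧ eq)) (⟦·⟧₃ d e f))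

-- Parities of the exponents in the edge system

module Exponents (ℝ : RealNumbers) (𝔩 : Plabic.Point ℝ) where

  open Plabic ℝ
  open SignCalculus
  open OrderedField ℝ
  open Turning ℝ 𝔩
  open Parity
  open SignedUnits ℝ

  toℤ : Trit → ℤ
  toℤ ⊖ = -1ℤ
  toℤ ⊙ = 0ℤ
  toℤ ⊕ = 1ℤ

  opaque
    unfolding sg

    s-sg : ∀ u v → s u v ≡ toℤ [ u , v ]
    s-sg u v with <.compare 0# (cross u v)
    ... | tri< _ _ _ = ≡.refl
    ... | tri≈ _ _ _ = ≡.refl
    ... | tri> _ _ _ = ≡.refl

  -- `wind` compares with s(𝔩,f), whereas `turn` takes the sign of [f𝔩]; hence the `neg`.
  wind-turn : ∀ ef e𝔩 f𝔩 → e𝔩 ≢ ⊙ → f𝔩 ≢ ⊙ →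
    parityℤ (if ⌊ toℤ ef ℤ.≟ toℤ e𝔩 ⌋ ∧ ⌊ toℤ e𝔩 ℤ.≟ toℤ (neg f𝔩) ⌋ then toℤ ef else 0ℤ)
    ≡ turn ef ⌞ e𝔩 ⌟ ⌞ f𝔩 ⌟
  wind-turn = toWitness {a? =
    ∀Trit? λ ef → ∀Trit? λ e𝔩 → ∀Trit? λ f𝔩 →
    ¬? (e𝔩 ≟ ⊙) →-dec ¬? (f𝔩 ≟ ⊙) →-dec _ Sign.≟ _} _

  parity-wind : ∀ u v → Transverse u → Transverse v → parityℤ (wind 𝔩 u v) ≡ τ u v
  parity-wind u v tu tv = ≡.trans
    (≡.cong parityℤ (wind-≡ (s-sg u v) (s-sg u 𝔩) (≡.trans (s-sg 𝔩 v) (≡.cong toℤ (sg-cross-anti v 𝔩)))))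
    (wind-turn [ u , v ] [ u , 𝔩 ] [ v , 𝔩 ] tu tv)
    where
    wind-≡ : ∀ {x y z} → s u v ≡ x → s u 𝔩 ≡ y → s 𝔩 v ≡ z →
             wind 𝔩 u v ≡ (if ⌊ x ℤ.≟ y ⌋ ∧ ⌊ y ℤ.≟ z ⌋ then x else 0ℤ)
    wind-≡ ≡.refl ≡.refl ≡.refl = ≡.refl

  -- If `u` is parallel to 𝔩, both sides still agree: (1 - 0)/2 rounds down to 0, and `⊙` defaults
  -- to `Sign.+`.
  parity-γ₂ : ∀ u → parityℤ (γ₂ 𝔩 u) ≡ side u
  parity-γ₂ u = ≡.trans (≡.cong (λ z → parityℤ ((1ℤ ℤ.- z) ℤ./ + 2)) (s-sg u 𝔩)) (half [ u , 𝔩 ])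
    where
    half : ∀ t → parityℤ ((1ℤ ℤ.- toℤ t) ℤ./ + 2) ≡ ⌞ t ⌟
    half ⊖ = ≡.refl
    half ⊙ = ≡.refl
    half ⊕ = ≡.refl

  [-1]^-parity : ∀ z → [-1]^ z ≈ ⟦ parityℤ z ⟧
  [-1]^-parity z = power ∣ z ∣
    where
    power : ∀ n → [-1]^ (+ n) ≈ ⟦ parity n ⟧
    power zero    = refl
    power (suc n) = trans (*-congˡ (power n)) (sym (⟦opposite⟧ (parity n)))

  sign-power₂ : ∀ a b {x y} → parityℤ a ≡ x → parityℤ b ≡ y → ⟦ x · y ⟧ ≈ [-1]^ (a ℤ.+ b)
  sign-power₂ a b ≡.refl ≡.refl =
    sym (trans ([-1]^-parity (a ℤ.+ b)) (reflexive (≡.cong ⟦_⟧ (parityℤ-+ a b))))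

  sign-power₅ : ∀ a b c d e {v w x y z} → parityℤ a ≡ v → parityℤ b ≡ w → parityℤ c ≡ x →
                parityℤ d ≡ y → parityℤ e ≡ z →
                ⟦ v · w · x · y · z ⟧ ≈ [-1]^ (a ℤ.+ b ℤ.+ c ℤ.+ d ℤ.+ e)
  sign-power₅ a b c d e p q r s t = sign-power₂ (a ℤ.+ b ℤ.+ c ℤ.+ d) e
    (≡.trans (parityℤ-+ (a ℤ.+ b ℤ.+ c) d) (≡.cong₂ _·_
      (≡.trans (parityℤ-+ (a ℤ.+ b) c) (≡.cong₂ _·_
        (≡.trans (parityℤ-+ a b) (≡.cong₂ _·_ p q)) r)) s)) t

-- Rays from the boundary and segments inside the disk

module Rays (ℝ : RealNumbers) where

  open Plabic ℝ
  open SignCalculus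
  open OrderedField ℝ
  open Corners ℝ
  open Parity
  open IntegerCoefficientSolver commutativeRing using (solve; _:=_; _:+_; _:*_; _:-_; :-_; con)
  open SetoidReasoning setoid

  ≤0⇒≯0 : ∀ {x} → x ≤ 0# → ¬ (0# < x)
  ≤0⇒≯0 (inj₁ x<0) 0<x = <.asym x<0 0<x
  ≤0⇒≯0 (inj₂ x≈0) 0<x = <.irrefl (sym x≈0) 0<x

  -- A linear function that is nonpositive on both sides of 0 has slope 0; testing it at two
  -- opposite values is enough.
  slope-zero : ∀ {ε} d → 0# < ε → (∀ δ → - ε < δ → δ < ε → d * δ ≤ 0#) → d ≈ 0#
  slope-zero {ε} d 0<ε bound =
    -- Both `s` and `t` are 1/2, so the test values are ±ε/2.
    let s , t , 0<s , 0<t , s+t≈1 , _ = split-unit 0<1 0<1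
        h    = ε * s
        0<h  = *-pos 0<ε 0<s
        h<ε  = 0<-⇒< (<.<-respʳ-≈ (begin
                 ε * t              ≈⟨ solve 3 (λ ε s t → ε :* t := ε :* (s :+ t) :- ε :* s) refl ε s t ⟩
                 ε * (s + t) - h    ≈⟨ +-congʳ (trans (*-congˡ s+t≈1) (*-identityʳ ε)) ⟩
                 ε - h              ∎) (*-pos 0<ε 0<t))
        -h<0 = 0<⇒-<0 0<h
        -ε<0 = 0<⇒-<0 0<ε
        -ε<-h = 0<-⇒< (<.<-respʳ-≈ (solve 2 (λ ε h → ε :- h := :- h :- :- ε) refl ε h) (<⇒0<- h<ε))
    in trichotomy h 0<h (bound h (<.trans -ε<0 0<h) h<ε) (bound (- h) -ε<-h (<.trans -h<0 0<ε))
    where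
    trichotomy : ∀ h → 0# < h → d * h ≤ 0# → d * - h ≤ 0# → d ≈ 0#
    trichotomy h 0<h dh≤0 d-h≤0 with <.compare 0# d
    ... | tri< 0<d _ _ = contradiction (*-pos 0<d 0<h) (≤0⇒≯0 dh≤0)
    ... | tri≈ _ 0≈d _ = sym 0≈d
    ... | tri> _ _ d<0 = contradiction (*-neg-neg d<0 (0<⇒-<0 0<h)) (≤0⇒≯0 d-h≤0)

  near : ∀ {ε x δ} → - ε < δ → δ < ε → x - ε < x + δ × x + δ < x + ε
  near {ε} {x} {δ} -ε<δ δ<ε =
    <.<-respˡ-≈ (+-comm (- ε) x) (<.<-respʳ-≈ (+-comm δ x) (+-monoˡ-< x -ε<δ)) ,
    <.<-respˡ-≈ (+-comm δ x) (<.<-respʳ-≈ (+-comm ε x) (+-monoˡ-< x δ<ε))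

  -- If an interior point were on the line AB, small horizontal and vertical shifts would stay in
  -- the disk, so the bracket could not become positive in either direction. Both coordinates of B -
  -- A would then vanish by `slope-zero`.
  interior-clockwise : (K : Disk) → let open Disk K in
                       ∀ {x} → Interior D x → cross (B -ᵥ A) (x -ᵥ A) < 0#
  interior-clockwise K {x@(x₁ , x₂)} (ε , 0<ε , ball) = strict (clockwise (ball x (stay , stay)))
    where
    open Disk K
    a₁ a₂ b₁ b₂ : Carrier
    a₁ = proj₁ A
    a₂ = proj₂ A
    b₁ = proj₁ B
    b₂ = proj₂ B

    -ε<0 : - ε < 0#
    -ε<0 = 0<⇒-<0 0<ε

    stay : ∀ {z} → z - ε < z × z < z + ε
    stay {z} = let p , q = near {x = z} -ε<0 0<ε in
      <.<-respʳ-≈ (+-identityʳ z) p , <.<-respˡ-≈ (+-identityʳ z) q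

    -≈0 : ∀ {a b} → b - a ≈ 0# → a ≈ b
    -≈0 {a} {b} eq = sym (trans (solve 2 (λ a b → b := b :- a :+ a) refl a b)
                                (trans (+-congʳ eq) (+-identityˡ a)))

    strict : cross (B -ᵥ A) (x -ᵥ A) ≤ 0# → cross (B -ᵥ A) (x -ᵥ A) < 0#
    strict (inj₁ neg) = neg
    strict (inj₂ eq) = contradiction (-≈0 d₁≈0 , -≈0 d₂≈0) A≉B
      where
      d₁≈0 : b₁ - a₁ ≈ 0#
      d₁≈0 = slope-zero (b₁ - a₁) 0<ε λ δ p q → OrderLemmas.≤-respˡ
        (trans (solve 7 (λ a₁ a₂ b₁ b₂ x₁ x₂ δ →
                  (b₁ :- a₁ , b₂ :- a₂) ⊠ (x₁ :- a₁ , x₂ :+ δ :- a₂)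
                  := (b₁ :- a₁ , b₂ :- a₂) ⊠ (x₁ :- a₁ , x₂ :- a₂) :+ (b₁ :- a₁) :* δ) refl a₁ a₂ b₁ b₂ x₁ x₂ δ)
               (trans (+-congʳ eq) (+-identityˡ _)))
        (clockwise (ball (x₁ , x₂ + δ) (stay , near p q)))

      -d₂≈0 : a₂ - b₂ ≈ 0#
      -d₂≈0 = slope-zero (a₂ - b₂) 0<ε λ δ p q → OrderLemmas.≤-respˡ
        (trans (solve 7 (λ a₁ a₂ b₁ b₂ x₁ x₂ δ →
                  (b₁ :- a₁ , b₂ :- a₂) ⊠ (x₁ :+ δ :- a₁ , x₂ :- a₂)
                  := (b₁ :- a₁ , b₂ :- a₂) ⊠ (x₁ :- a₁ , x₂ :- a₂) :+ (a₂ :- b₂) :* δ) refl a₁ a₂ b₁ b₂ x₁ x₂ δ)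
               (trans (+-congʳ eq) (+-identityˡ _)))
        (clockwise (ball (x₁ + δ , x₂) (near p q , stay)))

      d₂≈0 : b₂ - a₂ ≈ 0#
      d₂≈0 = trans (solve 2 (λ a b → b :- a := :- (a :- b)) refl a₂ b₂)
                   (trans (-‿cong -d₂≈0) (trans (sym (+-identityˡ (- 0#))) (-‿inverseʳ 0#)))

  -- A ray from b in the direction 𝔩 entering the half-plane to the right of
  -- the line through b in the direction n.
  module _ (b 𝔩 n : Point) (n𝔩<0 : cross n 𝔩 < 0#) where

    Right : Point → Set
    Right p = cross n (p -ᵥ b) < 0#

    flank : Point → Sign
    flank p = ⌞ [ 𝔩 , p -ᵥ b ] ⌟

    -- Here `n` is the auxiliary vector of `positive-multiple`: `p -ᵥ b` and `𝔩` both point to its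
    -- right, which rules out the opposite ray.
    on-ray : ∀ {p} → Right p → cross 𝔩 (p -ᵥ b) ≈ 0# → OnRay b 𝔩 p
    on-ray {p@(p₁ , p₂)} right eq =
      let r , 0<r , e₁ , e₂ = positive-multiple 𝔩 (p -ᵥ b) n eq
            (*-pos (<.<-respʳ-≈ (PlaneLemmas.cross-anti n (p -ᵥ b)) (<0⇒0<- right))
                   (<.<-respʳ-≈ (PlaneLemmas.cross-anti n 𝔩) (<0⇒0<- n𝔩<0)))
      in r , 0<r , move e₁ , move e₂
      where
      move : ∀ {x y z} → x - y ≈ z → x ≈ y + z
      move {x} {y} eq = trans (solve 2 (λ x y → x := y :+ (x :- y)) refl x y) (+-congˡ eq)

    separate : ∀ s t p q → s ≢ ⊖ → t ≢ ⊖ → ¬ (s ≡ ⊙ × t ≡ ⊙) → p ≢ ⊙ → q ≢ ⊙ →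
               Balanced (s ⊗ p ∷ t ⊗ q ∷ []) → ⌞ p ⌟ ≡ opposite ⌞ q ⌟
    separate = toWitness {a? =
      ∀Trit? λ s → ∀Trit? λ t → ∀Trit? λ p → ∀Trit? λ q →
      ¬? (s ≟ ⊖) →-dec ¬? (t ≟ ⊖) →-dec ¬? (s ≟ ⊙ ×-dec t ≟ ⊙) →-dec ¬? (p ≟ ⊙) →-dec ¬? (q ≟ ⊙) →-dec
      _ Bool.≟ _ →-dec _ Sign.≟ _} _

    module _ (p q : Point) (p-off : ¬ (cross 𝔩 (p -ᵥ b) ≈ 0#)) (q-off : ¬ (cross 𝔩 (q -ᵥ b) ≈ 0#)) where
      private
        b₁ b₂ l₁ l₂ p₁ p₂ q₁ q₂ : Carrier
        b₁ = proj₁ b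
        b₂ = proj₂ b
        l₁ = proj₁ 𝔩
        l₂ = proj₂ 𝔩
        p₁ = proj₁ p
        p₂ = proj₂ p
        q₁ = proj₁ q
        q₂ = proj₂ q

      -- The bracket of `𝔩` with the vector from `b` is affine along the segment and vanishes at the
      -- intersection point.
      meets⇒separates : RayMeetsSegment b 𝔩 p q → flank p ≡ opposite (flank q)
      meets⇒separates (x , (t , _ , x₁ , x₂) , (s , 0≤s , s≤1 , y₁ , y₂)) =
        separate (sg (1# - s)) (sg s) [ 𝔩 , p -ᵥ b ] [ 𝔩 , q -ᵥ b ]
          (λ eq → ≤⇒≮ s≤1 (0<-⇒< (-<0⇒0< (<.<-respˡ-≈ (solve 1 (λ s → con 1ℤ :- s := :- (s :- con 1ℤ)) refl s) (⊖-sg eq)))))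
          (λ eq → ≤⇒≮ 0≤s (⊖-sg eq))
          (λ (u , v) → <.irrefl (begin
             0#               ≈⟨ +-identityˡ 0# ⟨
             0# + 0#          ≈⟨ +-cong (⊙-sg u) (⊙-sg v) ⟨
             1# - s + s       ≈⟨ solve 1 (λ s → con 1ℤ :- s :+ s := con 1ℤ) refl s ⟩
             1#               ∎) 0<1)
          (λ eq → p-off (⊙-sg eq)) (λ eq → q-off (⊙-sg eq))
          (≡.subst₂ (λ u v → Balanced (u ∷ v ∷ [])) (sg-* (1# - s) (cross 𝔩 (p -ᵥ b))) (sg-* s (cross 𝔩 (q -ᵥ b)))
            (balanced ((1# - s) * cross 𝔩 (p -ᵥ b) ∷ s * cross 𝔩 (q -ᵥ b) ∷ []) (begin
              (1# - s) * cross 𝔩 (p -ᵥ b) + (s * cross 𝔩 (q -ᵥ b) + 0#)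
                ≈⟨ solve 9 (λ s b₁ b₂ l₁ l₂ p₁ p₂ q₁ q₂ →
                     (con 1ℤ :- s) :* (l₁ , l₂) ⊠ (p₁ :- b₁ , p₂ :- b₂) :+ (s :* (l₁ , l₂) ⊠ (q₁ :- b₁ , q₂ :- b₂) :+ con 0ℤ)
                     := (l₁ , l₂) ⊠ (p₁ :+ s :* (q₁ :- p₁) :- b₁ , p₂ :+ s :* (q₂ :- p₂) :- b₂))
                     refl s b₁ b₂ l₁ l₂ p₁ p₂ q₁ q₂ ⟩
              cross 𝔩 (p +ᵥ s • (q -ᵥ p) -ᵥ b)
                ≈⟨ PlaneLemmas.cross-cong (refl , refl) (+-congʳ (trans (sym y₁) x₁) , +-congʳ (trans (sym y₂) x₂)) ⟩
              cross 𝔩 (b +ᵥ t • 𝔩 -ᵥ b)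
                ≈⟨ solve 5 (λ t b₁ b₂ l₁ l₂ →
                     (l₁ , l₂) ⊠ (b₁ :+ t :* l₁ :- b₁ , b₂ :+ t :* l₂ :- b₂) := con 0ℤ) refl t b₁ b₂ l₁ l₂ ⟩
              0# ∎)))
        where
        ≤⇒≮ : ∀ {x y} → x ≤ y → ¬ (y < x)
        ≤⇒≮ (inj₁ x<y) y<x = <.asym x<y y<x
        ≤⇒≮ (inj₂ x≈y) y<x = <.irrefl (sym x≈y) y<x

      -- The affine bracket has a zero between the endpoints. That point is again in the open
      -- half-plane, being a convex combination of `p` and `q`, so `on-ray` applies.
      separates⇒meets : Right p → Right q → flank p ≡ opposite (flank q) → RayMeetsSegment b 𝔩 p q
      separates⇒meets right-p right-q opp = meets (weights [ 𝔩 , p -ᵥ b ] [ 𝔩 , q -ᵥ b ] ≡.refl ≡.refl opp)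
        where
        n₁ n₂ : Carrier
        n₁ = proj₁ n
        n₂ = proj₂ n

        Weights : Set
        Weights = ∃[ s ] ∃[ t ] 0# < s × 0# < t × s + t ≈ 1# × t * cross 𝔩 (p -ᵥ b) + s * cross 𝔩 (q -ᵥ b) ≈ 0#

        weights : ∀ u v → [ 𝔩 , p -ᵥ b ] ≡ u → [ 𝔩 , q -ᵥ b ] ≡ v → ⌞ u ⌟ ≡ opposite ⌞ v ⌟ → Weights
        -- The zero divides the segment in the ratio of the absolute values of the bracket at its
        -- ends.
        weights ⊕ ⊖ eu ev _ =
          let s , t , 0<s , 0<t , s+t , sq≈tp = split-unit (⊕-sg eu) (<0⇒0<- (⊖-sg ev))
          in s , t , 0<s , 0<t , s+t , trans (+-congʳ (sym sq≈tp)) (solve 2 (λ s q → s :* :- q :+ s :* q := con 0ℤ) refl s _)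
        weights ⊖ ⊕ eu ev _ =
          let s , t , 0<s , 0<t , s+t , sq≈tp = split-unit (<0⇒0<- (⊖-sg eu)) (⊕-sg ev)
          in s , t , 0<s , 0<t , s+t , trans (+-congˡ sq≈tp) (solve 2 (λ t p → t :* p :+ t :* :- p := con 0ℤ) refl t _)
        weights ⊙ _ eu _ _ = contradiction (⊙-sg eu) p-off
        weights _ ⊙ _ ev _ = contradiction (⊙-sg ev) q-off
        weights ⊕ ⊕ _ _ ()
        weights ⊖ ⊖ _ _ ()

        meets : Weights → RayMeetsSegment b 𝔩 p q
        meets (s , t , 0<s , 0<t , s+t≈1 , eq) =
          x , on-ray (<.<-respˡ-≈ (expand (n₁ , n₂)) (+-neg (*-pos-neg 0<t right-p) (*-pos-neg 0<s right-q)))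
                     (trans (sym (expand (l₁ , l₂))) eq) ,
          s , inj₁ 0<s , inj₁ (complement-<1 0<t s+t≈1) , refl , refl
          where
          x : Point
          x = p +ᵥ s • (q -ᵥ p)

          expand : ∀ u → t * cross u (p -ᵥ b) + s * cross u (q -ᵥ b) ≈ cross u (x -ᵥ b)
          expand u@(u₁ , u₂) = begin
            t * cross u (p -ᵥ b) + s * cross u (q -ᵥ b)
              ≈⟨ solve 4 (λ s t p q → t :* p :+ s :* q := (s :+ t) :* p :+ s :* (q :- p)) refl s t _ _ ⟩
            (s + t) * cross u (p -ᵥ b) + s * (cross u (q -ᵥ b) - cross u (p -ᵥ b))
              ≈⟨ +-congʳ (*-congʳ s+t≈1) ⟩
            1# * cross u (p -ᵥ b) + s * (cross u (q -ᵥ b) - cross u (p -ᵥ b))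
              ≈⟨ solve 9 (λ s b₁ b₂ u₁ u₂ p₁ p₂ q₁ q₂ →
                   let u = u₁ , u₂ ; p = p₁ :- b₁ , p₂ :- b₂ ; q = q₁ :- b₁ , q₂ :- b₂ in
                   con 1ℤ :* u ⊠ p :+ s :* (u ⊠ q :- u ⊠ p)
                   := u ⊠ (p₁ :+ s :* (q₁ :- p₁) :- b₁ , p₂ :+ s :* (q₂ :- p₂) :- b₂))
                   refl s b₁ b₂ u₁ u₂ p₁ p₂ q₁ q₂ ⟩
            cross u (x -ᵥ b) ∎

-- Linear algebra of the move in one coordinate

module SquareAlgebra (ℝ : RealNumbers) where

  open RealNumbers ℝ hiding (zero)
  open SignCalculus using (∀Sign?)
  open SignedUnits ℝ
  open OrderedField ℝ using (*-inverse)
  open IntegerCoefficientSolver commutativeRing using (solve; _:=_; _:+_; _:*_; _:-_; :-_; con)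
  open SetoidReasoning setoid

  private
    _≡?_ : ∀ a b → Dec (a ≡ b)
    _≡?_ = Sign._≟_

  module Signs where

    -- Factors `Sign.+` here and below pad the products to the three factors that `units₃` takes.
    split-F₃ : ∀ i₃ i₄ g t₃₄ → i₃ · t₃₄ · (i₄ · g) ≡ Sign.- · (i₃ · i₄ · g · t₃₄ · Sign.-) · Sign.+
    split-F₃ = toWitness {a? = ∀Sign? λ _ → ∀Sign? λ _ → ∀Sign? λ _ → ∀Sign? λ _ → _ ≡? _} _

    split-F₄ : ∀ i₄ g t₄ₑ → (i₄ · g) · (g · t₄ₑ) ≡ i₄ · t₄ₑ
    split-F₄ = toWitness {a? = ∀Sign? λ _ → ∀Sign? λ _ → ∀Sign? λ _ → _ ≡? _} _

    -- The hypothesis is the odd sum of `τ-vertex` at Q; in `at-R` it is that of `τ-merge` at R.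
    -- They trade windings into `e₄` and `e₃` for windings between square edges.
    at-Q : ∀ i₃ i₄ g t₃₄ t₃ₑ t₋₄ₑ → t₃ₑ · t₋₄ₑ · t₃₄ · g ≡ Sign.- →
           i₃ · t₃ₑ ≡ (i₃ · i₄ · g · t₃₄ · Sign.-) · (i₄ · t₋₄ₑ)
    at-Q = toWitness {a? = ∀Sign? λ _ → ∀Sign? λ _ → ∀Sign? λ _ → ∀Sign? λ _ → ∀Sign? λ _ → ∀Sign? λ _ →
                           _ ≡? _ →-dec _ ≡? _} _

    at-R : ∀ g t₂₄ t₂ₑ t₄ₑ → t₂₄ · t₂ₑ · t₄ₑ · g ≡ Sign.- → t₂ₑ · Sign.+ · Sign.+ ≡ Sign.- · t₂₄ · (g · t₄ₑ)
    at-R = toWitness {a? = ∀Sign? λ _ → ∀Sign? λ _ → ∀Sign? λ _ → ∀Sign? λ _ → _ ≡? _ →-dec _ ≡? _} _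

    F₃-in-G₂ : ∀ i₁ i₂ i₃ i₄ g t₃₄ t₂₄ → i₁ · i₃ · i₄ · i₂ ≡ Sign.+ →
               (i₁ · g · t₂₄ · t₃₄ · Sign.-) · (i₃ · i₄ · g · t₃₄ · Sign.-) ≡ i₂ · t₂₄
    F₃-in-G₂ = toWitness {a? = ∀Sign? λ _ → ∀Sign? λ _ → ∀Sign? λ _ → ∀Sign? λ _ → ∀Sign? λ _ → ∀Sign? λ _ → ∀Sign? λ _ →
                               _ ≡? _ →-dec _ ≡? _} _

    F₄-in-G₂ : ∀ i₂ i₄ g t₂₄ → (Sign.- · i₂ · i₄ · g · t₂₄) · (i₄ · g) · Sign.+ ≡ Sign.- · i₂ · t₂₄
    F₄-in-G₂ = toWitness {a? = ∀Sign? λ _ → ∀Sign? λ _ → ∀Sign? λ _ → ∀Sign? λ _ → _ ≡? _} _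

    at-S : ∀ i₁ i₂ i₃ i₄ g t₁₃ t₃₄ t₂₄ te₁ te₂ → i₁ · i₃ · i₄ · i₂ ≡ Sign.+ →
           te₁ · t₁₃ ≡ opposite (te₂ · (g · t₂₄ · t₃₄)) →
           te₁ · (i₁ · t₁₃) · (i₃ · i₄ · g · t₃₄ · Sign.-) ≡ te₂ · i₂ · t₂₄
    at-S = toWitness {a? =
      ∀Sign? λ _ → ∀Sign? λ _ → ∀Sign? λ _ → ∀Sign? λ _ → ∀Sign? λ _ →
      ∀Sign? λ _ → ∀Sign? λ _ → ∀Sign? λ _ → ∀Sign? λ _ → ∀Sign? λ _ →
      _ ≡? _ →-dec _ ≡? _ →-dec _ ≡? _} _

    at-P : ∀ i₁ i₂ i₃ i₄ g t₁₂ t₃₄ t₂₄ te₁ te₃ → i₁ · i₃ · i₄ · i₂ ≡ Sign.+ →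
           te₁ · t₁₂ ≡ opposite (te₃ · (g · t₂₄ · t₃₄)) →
           te₁ · (i₁ · t₁₂) · (i₂ · t₂₄) ≡ te₃ · (i₃ · i₄ · g · t₃₄ · Sign.-) · Sign.+
    at-P = toWitness {a? =
      ∀Sign? λ _ → ∀Sign? λ _ → ∀Sign? λ _ → ∀Sign? λ _ → ∀Sign? λ _ →
      ∀Sign? λ _ → ∀Sign? λ _ → ∀Sign? λ _ → ∀Sign? λ _ → ∀Sign? λ _ →
      _ ≡? _ →-dec _ ≡? _ →-dec _ ≡? _} _

  open Signs

  module _ (α₁ α₂ α₃ α₄ : Carrier) where

    α̃₁ α̃₂ α̃₃ α̃₄ : Carrier
    α̃₂ = α₂ + α₁ * α₃ * α₄
    α̃₁ = (α₃ * α₄) ÷ α̃₂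
    α̃₃ = (α₂ * α₃) ÷ α̃₂
    α̃₄ = (α₁ * α₃) ÷ α̃₂

    -- i₁, …, i₄ are the parities of the intersection numbers, g that of γ₂(h₄),
    -- and the t's those of the windings between the square edges.
    module Moved (i₁ i₂ i₃ i₄ g t₃₄ t₂₄ t₋₁₂ : Sign) (F₃ F₄ : Carrier) where

      K H : Sign
      K = i₃ · i₄ · g · t₃₄ · Sign.-
      H = i₄ · g

      -- The right-hand sides of the claim in one coordinate, with signs in place of powers of -1.
      G₁ G₂ G₃ G₄ : Carrier
      G₄ = α̃₄ * α₃ ⁻¹ * ⟦ K ⟧ * F₃ + α̃₄ * ⟦ H ⟧ * F₄
      G₂ = α₁ * ⟦ i₁ · g · t₂₄ · t₃₄ · Sign.- ⟧ * F₃ + α₂ * α₄ ⁻¹ * ⟦ Sign.- · i₂ · i₄ · g · t₂₄ ⟧ * F₄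
      G₁ = α̃₁ * ⟦ i₁ · t₋₁₂ ⟧ * G₂
      G₃ = ⟦ K ⟧ * (α₂ * α₁ ⁻¹) * G₄

      G₄-cong : ∀ {x y} → ⟦ K ⟧ ≈ x → ⟦ H ⟧ ≈ y → G₄ ≈ α̃₄ * α₃ ⁻¹ * x * F₃ + α̃₄ * y * F₄
      G₄-cong p q = +-cong (*-congʳ (*-congˡ p)) (*-congʳ (*-congˡ q))

      G₂-cong : ∀ {x y} → ⟦ i₁ · g · t₂₄ · t₃₄ · Sign.- ⟧ ≈ x → ⟦ Sign.- · i₂ · i₄ · g · t₂₄ ⟧ ≈ y →
                G₂ ≈ α₁ * x * F₃ + α₂ * α₄ ⁻¹ * y * F₄
      G₂-cong p q = +-cong (*-congʳ (*-congˡ p)) (*-congʳ (*-congˡ q))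

      G₁-cong : ∀ {x y} → ⟦ i₁ · t₋₁₂ ⟧ ≈ x → G₂ ≈ y → G₁ ≈ α̃₁ * x * y
      G₁-cong p q = *-cong (*-congˡ p) q

      G₃-cong : ∀ {x y} → ⟦ K ⟧ ≈ x → G₄ ≈ y → G₃ ≈ x * (α₂ * α₁ ⁻¹) * y
      G₃-cong p q = *-cong (*-congʳ p) q

      module Solved (α₁≉0 : ¬ (α₁ ≈ 0#)) (α₃≉0 : ¬ (α₃ ≈ 0#)) (α₄≉0 : ¬ (α₄ ≈ 0#))
                    (α̃₂≉0 : ¬ (α̃₂ ≈ 0#))
                    (even : i₁ · i₃ · i₄ · i₂ ≡ Sign.+)
                    (t₃ₑ t₋₄ₑ t₂ₑ t₄ₑ : Sign) (X₃ X₄ : Carrier)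
                    (Q : t₃ₑ · t₋₄ₑ · t₃₄ · g ≡ Sign.-) (R : t₂₄ · t₂ₑ · t₄ₑ · g ≡ Sign.-)
                    (F₃-eq : F₃ ≈ ⟦ i₃ ⟧ * α₃ * (⟦ t₃₄ ⟧ * F₄ + ⟦ t₃ₑ ⟧ * X₄))
                    (F₄-eq : F₄ ≈ ⟦ i₄ ⟧ * α₄ * (⟦ t₄ₑ ⟧ * X₃)) where

        -- Up to the signs K and H, F₃ and F₄ are B and α₄ D; in B, C and D the system is free of signs.
        private
          β B C D : Carrier
          β = α̃₂ ⁻¹
          C = ⟦ i₄ · t₋₄ₑ ⟧ * X₄
          D = ⟦ g · t₄ₑ ⟧ * X₃
          B = α₃ * (C - α₄ * D)

        t₂ₑ≈ : ⟦ t₂ₑ ⟧ ≈ - 1# * ⟦ t₂₄ ⟧ * ⟦ g · t₄ₑ ⟧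
        t₂ₑ≈ = trans (sym (trans (*-identityʳ _) (*-identityʳ _)))
                     (units₃ t₂ₑ Sign.+ Sign.+ Sign.- t₂₄ (g · t₄ₑ) (at-R g t₂₄ t₂ₑ t₄ₑ R))

        F₄≈ : F₄ ≈ ⟦ H ⟧ * (α₄ * D)
        F₄≈ = begin
          F₄                                       ≈⟨ F₄-eq ⟩
          ⟦ i₄ ⟧ * α₄ * (⟦ t₄ₑ ⟧ * X₃)             ≈⟨ solve 4 (λ i a t x → i :* a :* (t :* x) := i :* t :* (a :* x)) refl _ α₄ _ X₃ ⟩
          ⟦ i₄ ⟧ * ⟦ t₄ₑ ⟧ * (α₄ * X₃)             ≈⟨ *-congʳ (units₂ H (g · t₄ₑ) i₄ t₄ₑ (split-F₄ i₄ g t₄ₑ)) ⟨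
          ⟦ H ⟧ * ⟦ g · t₄ₑ ⟧ * (α₄ * X₃)          ≈⟨ solve 4 (λ h t a x → h :* t :* (a :* x) := h :* (a :* (t :* x))) refl _ _ α₄ X₃ ⟩
          ⟦ H ⟧ * (α₄ * D)                         ∎

        F₃≈ : F₃ ≈ ⟦ K ⟧ * B
        F₃≈ = begin
          F₃
            ≈⟨ F₃-eq ⟩
          ⟦ i₃ ⟧ * α₃ * (⟦ t₃₄ ⟧ * F₄ + ⟦ t₃ₑ ⟧ * X₄)
            ≈⟨ *-congˡ (+-congʳ (*-congˡ F₄≈)) ⟩
          ⟦ i₃ ⟧ * α₃ * (⟦ t₃₄ ⟧ * (⟦ H ⟧ * (α₄ * D)) + ⟦ t₃ₑ ⟧ * X₄)
            ≈⟨ solve 8 (λ i a t h b d u x → i :* a :* (t :* (h :* (b :* d)) :+ u :* x)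
                          := a :* (i :* t :* h :* (b :* d) :+ i :* u :* x)) refl _ α₃ _ _ α₄ D _ X₄ ⟩
          α₃ * (⟦ i₃ ⟧ * ⟦ t₃₄ ⟧ * ⟦ H ⟧ * (α₄ * D) + ⟦ i₃ ⟧ * ⟦ t₃ₑ ⟧ * X₄)
            ≈⟨ *-congˡ (+-cong (*-congʳ (units₃ i₃ t₃₄ H Sign.- K Sign.+ (split-F₃ i₃ i₄ g t₃₄)))
                               (*-congʳ (units₂ i₃ t₃ₑ K (i₄ · t₋₄ₑ) (at-Q i₃ i₄ g t₃₄ t₃ₑ t₋₄ₑ Q)))) ⟩
          α₃ * (- 1# * ⟦ K ⟧ * 1# * (α₄ * D) + ⟦ K ⟧ * ⟦ i₄ · t₋₄ₑ ⟧ * X₄)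
            ≈⟨ solve 5 (λ a k d u x → a :* (:- con 1ℤ :* k :* con 1ℤ :* d :+ k :* u :* x)
                          := k :* (a :* (u :* x :- d))) refl α₃ _ (α₄ * D) _ X₄ ⟩
          ⟦ K ⟧ * B ∎

        G₄≈ : G₄ ≈ α̃₄ * C
        G₄≈ = begin
          α̃₄ * α₃ ⁻¹ * ⟦ K ⟧ * F₃ + α̃₄ * ⟦ H ⟧ * F₄
            ≈⟨ +-cong (*-congˡ F₃≈) (*-congˡ F₄≈) ⟩
          α̃₄ * α₃ ⁻¹ * ⟦ K ⟧ * (⟦ K ⟧ * B) + α̃₄ * ⟦ H ⟧ * (⟦ H ⟧ * (α₄ * D))
            ≈⟨ solve 7 (λ a r s k h c d → a :* r :* k :* (k :* (s :* (c :- d))) :+ a :* h :* (h :* d)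
                          := a :* (r :* s :* (k :* k) :* (c :- d) :+ h :* h :* d))
                 refl α̃₄ (α₃ ⁻¹) α₃ _ _ C (α₄ * D) ⟩
          α̃₄ * (α₃ ⁻¹ * α₃ * (⟦ K ⟧ * ⟦ K ⟧) * (C - α₄ * D) + ⟦ H ⟧ * ⟦ H ⟧ * (α₄ * D))
            ≈⟨ *-congˡ (+-cong (*-congʳ (*-cong (*-inverse α₃≉0) (⟦⟧-square K))) (*-congʳ (⟦⟧-square H))) ⟩
          α̃₄ * (1# * 1# * (C - α₄ * D) + 1# * (α₄ * D))
            ≈⟨ solve 3 (λ a c d → a :* (con 1ℤ :* con 1ℤ :* (c :- d) :+ con 1ℤ :* d) := a :* c) refl α̃₄ C (α₄ * D) ⟩
          α̃₄ * C ∎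

        G₂≈ : G₂ ≈ ⟦ i₂ ⟧ * ⟦ t₂₄ ⟧ * (α₁ * B - α₂ * D)
        G₂≈ = begin
          α₁ * ⟦ i₁ · g · t₂₄ · t₃₄ · Sign.- ⟧ * F₃ + α₂ * α₄ ⁻¹ * ⟦ Sign.- · i₂ · i₄ · g · t₂₄ ⟧ * F₄
            ≈⟨ +-cong (*-congˡ F₃≈) (*-congˡ F₄≈) ⟩
          α₁ * ⟦ i₁ · g · t₂₄ · t₃₄ · Sign.- ⟧ * (⟦ K ⟧ * B) + α₂ * α₄ ⁻¹ * ⟦ Sign.- · i₂ · i₄ · g · t₂₄ ⟧ * (⟦ H ⟧ * (α₄ * D))
            ≈⟨ solve 10 (λ a u k b c r v h s d → a :* u :* (k :* b) :+ c :* r :* v :* (h :* (s :* d))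
                          := a :* (u :* k :* b) :+ c :* (r :* s :* (v :* h :* con 1ℤ) :* d))
                 refl α₁ _ _ B α₂ (α₄ ⁻¹) _ _ α₄ D ⟩
          α₁ * (⟦ i₁ · g · t₂₄ · t₃₄ · Sign.- ⟧ * ⟦ K ⟧ * B)
            + α₂ * (α₄ ⁻¹ * α₄ * (⟦ Sign.- · i₂ · i₄ · g · t₂₄ ⟧ * ⟦ H ⟧ * 1#) * D)
            ≈⟨ +-cong (*-congˡ (*-congʳ (units₂ (i₁ · g · t₂₄ · t₃₄ · Sign.-) K i₂ t₂₄ (F₃-in-G₂ i₁ i₂ i₃ i₄ g t₃₄ t₂₄ even))))
                      (*-congˡ (*-congʳ (*-cong (*-inverse α₄≉0) (units₃ (Sign.- · i₂ · i₄ · g · t₂₄) H Sign.+ Sign.- i₂ t₂₄ (F₄-in-G₂ i₂ i₄ g t₂₄))))) ⟩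
          α₁ * (⟦ i₂ ⟧ * ⟦ t₂₄ ⟧ * B) + α₂ * (1# * (- 1# * ⟦ i₂ ⟧ * ⟦ t₂₄ ⟧) * D)
            ≈⟨ solve 6 (λ a i t b c d → a :* (i :* t :* b) :+ c :* (con 1ℤ :* (:- con 1ℤ :* i :* t) :* d)
                          := i :* t :* (a :* b :- c :* d)) refl α₁ _ _ B α₂ D ⟩
          ⟦ i₂ ⟧ * ⟦ t₂₄ ⟧ * (α₁ * B - α₂ * D) ∎

        G₃≈ : G₃ ≈ ⟦ K ⟧ * (α̃₃ * C)
        G₃≈ = begin
          ⟦ K ⟧ * (α₂ * α₁ ⁻¹) * G₄
            ≈⟨ *-congˡ G₄≈ ⟩
          ⟦ K ⟧ * (α₂ * α₁ ⁻¹) * (α₁ * α₃ * β * C)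
            ≈⟨ solve 7 (λ k a r s b c d → k :* (a :* r) :* (s :* b :* c :* d) := r :* s :* (k :* (a :* b :* c :* d)))
                 refl _ α₂ (α₁ ⁻¹) α₁ α₃ β C ⟩
          α₁ ⁻¹ * α₁ * (⟦ K ⟧ * (α̃₃ * C))
            ≈⟨ trans (*-congʳ (*-inverse α₁≉0)) (*-identityˡ _) ⟩
          ⟦ K ⟧ * (α̃₃ * C) ∎

        at-h₁ : G₁ ≈ ⟦ i₁ ⟧ * α̃₁ * (⟦ t₋₁₂ ⟧ * G₂)
        at-h₁ = begin
          α̃₁ * ⟦ i₁ · t₋₁₂ ⟧ * G₂         ≈⟨ *-congʳ (*-congˡ (⟦·⟧ i₁ t₋₁₂)) ⟩
          α̃₁ * (⟦ i₁ ⟧ * ⟦ t₋₁₂ ⟧) * G₂   ≈⟨ solve 4 (λ a i t g → a :* (i :* t) :* g := i :* a :* (t :* g)) refl α̃₁ _ _ G₂ ⟩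
          ⟦ i₁ ⟧ * α̃₁ * (⟦ t₋₁₂ ⟧ * G₂)   ∎

        at-h₂ : G₂ ≈ ⟦ i₂ ⟧ * α̃₂ * (⟦ t₂₄ ⟧ * G₄ + ⟦ t₂ₑ ⟧ * X₃)
        at-h₂ = begin
          G₂
            ≈⟨ G₂≈ ⟩
          ⟦ i₂ ⟧ * ⟦ t₂₄ ⟧ * (α₁ * (α₃ * (C - α₄ * D)) - α₂ * D)
            -- Collecting the multiples of `D` produces `α̃₂`: α₁B - α₂D = α₁α₃C - (α₂ + α₁α₃α₄)D.
            ≈⟨ solve 8 (λ i t a b c d e f → i :* t :* (a :* (b :* (c :- d :* e)) :- f :* e)
                          := i :* t :* (con 1ℤ :* (a :* b :* c) :- (f :+ a :* b :* d) :* e)) refl _ _ α₁ α₃ C α₄ D α₂ ⟩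
          ⟦ i₂ ⟧ * ⟦ t₂₄ ⟧ * (1# * (α₁ * α₃ * C) - α̃₂ * D)
            ≈⟨ *-congˡ (+-congʳ (*-congʳ (*-inverseʳ α̃₂≉0))) ⟨
          ⟦ i₂ ⟧ * ⟦ t₂₄ ⟧ * (α̃₂ * β * (α₁ * α₃ * C) - α̃₂ * D)
            ≈⟨ solve 8 (λ i t z b p c g x → i :* t :* (z :* b :* (p :* c) :- z :* (g :* x))
                          := i :* z :* (t :* (p :* b :* c) :+ :- con 1ℤ :* t :* g :* x)) refl _ _ α̃₂ β (α₁ * α₃) C _ X₃ ⟩
          ⟦ i₂ ⟧ * α̃₂ * (⟦ t₂₄ ⟧ * (α̃₄ * C) + - 1# * ⟦ t₂₄ ⟧ * ⟦ g · t₄ₑ ⟧ * X₃)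
            ≈⟨ *-congˡ (+-cong (*-congˡ G₄≈) (*-congʳ t₂ₑ≈)) ⟨
          ⟦ i₂ ⟧ * α̃₂ * (⟦ t₂₄ ⟧ * G₄ + ⟦ t₂ₑ ⟧ * X₃) ∎

        at-h₃ : G₃ ≈ ⟦ i₃ ⟧ * α̃₃ * (⟦ t₃ₑ ⟧ * X₄)
        at-h₃ = begin
          G₃                                         ≈⟨ G₃≈ ⟩
          ⟦ K ⟧ * (α̃₃ * (⟦ i₄ · t₋₄ₑ ⟧ * X₄))        ≈⟨ solve 4 (λ k a t x → k :* (a :* (t :* x)) := k :* t :* (a :* x)) refl _ α̃₃ _ X₄ ⟩
          ⟦ K ⟧ * ⟦ i₄ · t₋₄ₑ ⟧ * (α̃₃ * X₄)          ≈⟨ *-congʳ (units₂ i₃ t₃ₑ K (i₄ · t₋₄ₑ) (at-Q i₃ i₄ g t₃₄ t₃ₑ t₋₄ₑ Q)) ⟨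
          ⟦ i₃ ⟧ * ⟦ t₃ₑ ⟧ * (α̃₃ * X₄)               ≈⟨ solve 4 (λ i t a x → i :* t :* (a :* x) := i :* a :* (t :* x)) refl _ _ α̃₃ X₄ ⟩
          ⟦ i₃ ⟧ * α̃₃ * (⟦ t₃ₑ ⟧ * X₄)               ∎

        at-h₄ : G₄ ≈ ⟦ i₄ ⟧ * α̃₄ * (⟦ t₋₄ₑ ⟧ * X₄)
        at-h₄ = begin
          G₄                                         ≈⟨ G₄≈ ⟩
          α̃₄ * (⟦ i₄ · t₋₄ₑ ⟧ * X₄)                  ≈⟨ *-congˡ (*-congʳ (⟦·⟧ i₄ t₋₄ₑ)) ⟩
          α̃₄ * (⟦ i₄ ⟧ * ⟦ t₋₄ₑ ⟧ * X₄)              ≈⟨ solve 4 (λ a i t x → a :* (i :* t :* x) := i :* a :* (t :* x)) refl α̃₄ _ _ X₄ ⟩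
          ⟦ i₄ ⟧ * α̃₄ * (⟦ t₋₄ₑ ⟧ * X₄)              ∎

        -- An outer edge into S keeps its weight, direction and intersection number, so only the
        -- sums over the edges leaving S are compared: `h₁` and `h₂` before the move, `h₂` alone
        -- after it.
        into-S : ∀ te₁ te₂ t₁₃ {F₁ F₂} → te₁ · t₁₃ ≡ opposite (te₂ · (g · t₂₄ · t₃₄)) →
                 F₁ ≈ ⟦ i₁ ⟧ * α₁ * (⟦ t₁₃ ⟧ * F₃) → F₂ ≈ ⟦ i₂ ⟧ * α₂ * (⟦ t₂ₑ ⟧ * X₃) →
                 ⟦ te₁ ⟧ * F₁ + ⟦ te₂ ⟧ * F₂ ≈ ⟦ te₂ ⟧ * G₂
        into-S te₁ te₂ t₁₃ {F₁} {F₂} signs F₁-eq F₂-eq = begin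
          ⟦ te₁ ⟧ * F₁ + ⟦ te₂ ⟧ * F₂
            ≈⟨ +-cong (*-congˡ (trans F₁-eq (*-congˡ (*-congˡ F₃≈))))
                      (*-congˡ (trans F₂-eq (*-congˡ (*-congʳ t₂ₑ≈)))) ⟩
          ⟦ te₁ ⟧ * (⟦ i₁ ⟧ * α₁ * (⟦ t₁₃ ⟧ * (⟦ K ⟧ * B)))
            + ⟦ te₂ ⟧ * (⟦ i₂ ⟧ * α₂ * (- 1# * ⟦ t₂₄ ⟧ * ⟦ g · t₄ₑ ⟧ * X₃))
            ≈⟨ solve 12 (λ e i a t k b f j c u v x →
                 e :* (i :* a :* (t :* (k :* b))) :+ f :* (j :* c :* (:- con 1ℤ :* u :* v :* x))
                 := e :* (i :* t) :* k :* (a :* b) :- f :* (j :* u :* (c :* (v :* x))))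
                 refl _ _ α₁ _ _ B _ _ α₂ _ _ X₃ ⟩
          ⟦ te₁ ⟧ * (⟦ i₁ ⟧ * ⟦ t₁₃ ⟧) * ⟦ K ⟧ * (α₁ * B) - ⟦ te₂ ⟧ * (⟦ i₂ ⟧ * ⟦ t₂₄ ⟧ * (α₂ * D))
            ≈⟨ +-congʳ (*-congʳ (trans (*-congʳ (*-congˡ (sym (⟦·⟧ i₁ t₁₃))))
                                       (units₃ te₁ (i₁ · t₁₃) K te₂ i₂ t₂₄ (at-S i₁ i₂ i₃ i₄ g t₁₃ t₃₄ t₂₄ te₁ te₂ even signs)))) ⟩
          ⟦ te₂ ⟧ * ⟦ i₂ ⟧ * ⟦ t₂₄ ⟧ * (α₁ * B) - ⟦ te₂ ⟧ * (⟦ i₂ ⟧ * ⟦ t₂₄ ⟧ * (α₂ * D))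
            ≈⟨ solve 5 (λ e i t a b → e :* i :* t :* a :- e :* (i :* t :* b) := e :* (i :* t :* (a :- b)))
                 refl _ _ _ (α₁ * B) (α₂ * D) ⟩
          ⟦ te₂ ⟧ * (⟦ i₂ ⟧ * ⟦ t₂₄ ⟧ * (α₁ * B - α₂ * D))
            ≈⟨ *-congˡ G₂≈ ⟨
          ⟦ te₂ ⟧ * G₂ ∎

        -- The same comparison at P, where `h₃` alone leaves before the move, `-h₁` and `h₃` after
        -- it.
        into-P : ∀ te₁ te₃ → te₁ · t₋₁₂ ≡ opposite (te₃ · (g · t₂₄ · t₃₄)) →
                 ⟦ te₃ ⟧ * F₃ ≈ ⟦ te₁ ⟧ * G₁ + ⟦ te₃ ⟧ * G₃
        into-P te₁ te₃ signs = sym (begin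
          ⟦ te₁ ⟧ * (α̃₁ * ⟦ i₁ · t₋₁₂ ⟧ * G₂) + ⟦ te₃ ⟧ * G₃
            ≈⟨ +-cong (*-congˡ (*-congˡ G₂≈)) (*-congˡ G₃≈) ⟩
          ⟦ te₁ ⟧ * (α̃₁ * ⟦ i₁ · t₋₁₂ ⟧ * (⟦ i₂ ⟧ * ⟦ t₂₄ ⟧ * (α₁ * B - α₂ * D))) + ⟦ te₃ ⟧ * (⟦ K ⟧ * (α̃₃ * C))
            ≈⟨ +-congʳ (solve 5 (λ e a i u z → e :* (a :* i :* (u :* z)) := e :* i :* u :* (a :* z)) refl _ α̃₁ _ _ _) ⟩
          ⟦ te₁ ⟧ * ⟦ i₁ · t₋₁₂ ⟧ * (⟦ i₂ ⟧ * ⟦ t₂₄ ⟧) * (α̃₁ * (α₁ * B - α₂ * D)) + ⟦ te₃ ⟧ * (⟦ K ⟧ * (α̃₃ * C))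
            ≈⟨ +-congʳ (*-congʳ (trans (*-congˡ (sym (⟦·⟧ i₂ t₂₄)))
                                       (units₃ te₁ (i₁ · t₋₁₂) (i₂ · t₂₄) te₃ K Sign.+ (at-P i₁ i₂ i₃ i₄ g t₋₁₂ t₃₄ t₂₄ te₁ te₃ even signs)))) ⟩
          ⟦ te₃ ⟧ * ⟦ K ⟧ * 1# * (α̃₁ * (α₁ * B - α₂ * D)) + ⟦ te₃ ⟧ * (⟦ K ⟧ * (α̃₃ * C))
            -- As B = α₃(C - α₄D), one has α₃α₄(α₁B - α₂D) + α₂α₃C = (α₂ + α₁α₃α₄)B, so the
            -- denominator `α̃₂` cancels.
            ≈⟨ solve 9 (λ e k a b c d β C D →
                 let B = c :* (C :- d :* D) in
                 e :* k :* con 1ℤ :* (c :* d :* β :* (a :* B :- b :* D)) :+ e :* (k :* (b :* c :* β :* C))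
                 := e :* (k :* ((b :+ a :* c :* d) :* β :* B)))
                 refl _ _ α₁ α₂ α₃ α₄ β C D ⟩
          ⟦ te₃ ⟧ * (⟦ K ⟧ * (α̃₂ * β * B))
            ≈⟨ *-congˡ (*-congˡ (trans (*-congʳ (*-inverseʳ α̃₂≉0)) (*-identityˡ B))) ⟩
          ⟦ te₃ ⟧ * (⟦ K ⟧ * B)
            ≈⟨ *-congˡ F₃≈ ⟨
          ⟦ te₃ ⟧ * F₃ ∎)

-- Parity of the intersection numbers around a quadrilateral

module IntersectionParity (ℝ : RealNumbers) {n m k} (N : Plabic.Network ℝ n m k) {𝔩 : Plabic.Point ℝ}
                          (g : Plabic.IsGaugeDirection ℝ N 𝔩) where

  open Plabic ℝ
  open Parity

  opaque
    ι : Fin k → Sign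
    ι e = parityℤ (int N g e)

    ι-int : ∀ e → parityℤ (int N g e) ≡ ι e
    ι-int e = ≡.refl

module Intersections (ℝ : RealNumbers) where

  open Plabic ℝ
  open OrderedField ℝ
  open Rays ℝ
  open Parity
  open IntegerCoefficientSolver commutativeRing using (solve; _:=_; _:+_; _:*_; _:-_; :-_; con)
  open SetoidReasoning setoid

  -- A boundary vertex that is not a source emits no gauge ray and contributes the neutral sign.
  guard : Bool → Sign → Sign
  guard true  a = a
  guard false a = Sign.+

  indicator-× : ∀ {I M : Set} (I? : Dec I) (M? : Dec M) {a b} →
                (M → a ≡ opposite b) → (a ≡ opposite b → M) →
                indicator (does (I? ×-dec M?)) ≡ guard (does I?) (a · b)
  indicator-× (no _)  _       _ _ = ≡.refl
  indicator-× (yes _) (yes m) {a} {b} f _ rewrite f m = opposite-self b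
    where
    opposite-self : ∀ b → Sign.- ≡ opposite b · b
    opposite-self Sign.+ = ≡.refl
    opposite-self Sign.- = ≡.refl
  indicator-× (yes _) (no ¬m) {Sign.+} {Sign.+} _ _ = ≡.refl
  indicator-× (yes _) (no ¬m) {Sign.+} {Sign.-} _ g = contradiction (g ≡.refl) ¬m
  indicator-× (yes _) (no ¬m) {Sign.-} {Sign.+} _ g = contradiction (g ≡.refl) ¬m
  indicator-× (yes _) (no ¬m) {Sign.-} {Sign.-} _ _ = ≡.refl

  module _ {n m k} (N : Network n m k) (pn : IsPlabicNetwork N) {𝔩 : Point} (g : IsGaugeDirection N 𝔩) where
    open Network N
    open IsPlabicNetwork pn
    open IsGaugeDirection g
    open IntersectionParity ℝ N g

    boundary-line : ∀ j → cross (B -ᵥ A) (boundary j -ᵥ A) ≈ 0#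
    boundary-line j = let e₁ , e₂ = on-segment j in
      trans (PlaneLemmas.cross-cong {B -ᵥ A} {B -ᵥ A} (refl , refl) (+-congʳ e₁ , +-congʳ e₂))
        (solve 5 (λ t a₁ a₂ b₁ b₂ → let d = b₁ :- a₁ , b₂ :- a₂ in
             d ⊠ (a₁ :+ t :* (b₁ :- a₁) :- a₁ , a₂ :+ t :* (b₂ :- a₂) :- a₂) := con 0ℤ)
           refl (param j) (proj₁ A) (proj₂ A) (proj₁ B) (proj₂ B))

    right-of-boundary : ∀ j {x} → Interior D x → cross (B -ᵥ A) (x -ᵥ boundary j) < 0#
    right-of-boundary j {x₁ , x₂} int = <.<-respˡ-≈ (begin
        cross (B -ᵥ A) ((x₁ , x₂) -ᵥ A)
          ≈⟨ solve 8 (λ d₁ d₂ x₁ x₂ a₁ a₂ b₁ b₂ →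
               (d₁ , d₂) ⊠ (x₁ :- a₁ , x₂ :- a₂)
               := (d₁ , d₂) ⊠ (x₁ :- b₁ , x₂ :- b₂) :+ (d₁ , d₂) ⊠ (b₁ :- a₁ , b₂ :- a₂))
             refl (proj₁ B - proj₁ A) (proj₂ B - proj₂ A) x₁ x₂ (proj₁ A) (proj₂ A)
             (proj₁ (boundary j)) (proj₂ (boundary j)) ⟩
        cross (B -ᵥ A) ((x₁ , x₂) -ᵥ boundary j) + cross (B -ᵥ A) (boundary j -ᵥ A)
          ≈⟨ +-congˡ (boundary-line j) ⟩
        cross (B -ᵥ A) ((x₁ , x₂) -ᵥ boundary j) + 0#
          ≈⟨ +-identityʳ _ ⟩
        cross (B -ᵥ A) ((x₁ , x₂) -ᵥ boundary j) ∎) (interior-clockwise disk int)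

    -- The ray from `boundary j` reaches an interior point, which is strictly to the right of AB,
    -- while its base point is on that line.
    gauge-enters : Fin n → cross (B -ᵥ A) 𝔩 < 0#
    gauge-enters j = let x , (t , 0<t , e₁ , e₂) , int = points-in j in
      factor 0<t (<.<-respˡ-≈
        (trans (PlaneLemmas.cross-cong {B -ᵥ A} {B -ᵥ A} (refl , refl) (+-congʳ e₁ , +-congʳ e₂))
          (solve 7 (λ t d₁ d₂ b₁ b₂ l₁ l₂ →
             (d₁ , d₂) ⊠ (b₁ :+ t :* l₁ :- b₁ , b₂ :+ t :* l₂ :- b₂) := t :* (d₁ , d₂) ⊠ (l₁ , l₂))
             refl t (proj₁ B - proj₁ A) (proj₂ B - proj₂ A) (proj₁ (boundary j)) (proj₂ (boundary j))
             (proj₁ 𝔩) (proj₂ 𝔩)))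
        (right-of-boundary j int))
      where
      factor : ∀ {t y} → 0# < t → t * y < 0# → y < 0#
      factor {t} {y} 0<t ty<0 with <.compare 0# y
      ... | tri< 0<y _ _ = contradiction (*-pos 0<t 0<y) (<.asym ty<0)
      ... | tri≈ _ 0≈y _ = contradiction ty<0 (<.irrefl (trans (*-congˡ (sym 0≈y)) (zeroʳ t)))
      ... | tri> _ _ y<0 = y<0

    flankᵥ : Fin n → Fin m → Sign
    flankᵥ j v = flank (boundary j) 𝔩 (B -ᵥ A) (gauge-enters j) (internal v)

    -- Genericity speaks only of the ray itself, but the other half of its line contains no interior
    -- point of the disk.
    off-line : ∀ j v → ¬ (cross 𝔩 (internal v -ᵥ boundary j) ≈ 0#)
    off-line j v eq =
      generic j v (on-ray (boundary j) 𝔩 (B -ᵥ A) (gauge-enters j) (right-of-boundary j (inside v)) eq)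

    meets-indicator : ∀ e {u v} → src e ≡ inj₂ u → tgt e ≡ inj₂ v → ∀ j →
      indicator (does (gaugeRayMeets? N g e j)) ≡ guard (does (isSource? j)) (flankᵥ j u · flankᵥ j v)
    meets-indicator e {u} {v} eu ev j = indicator-× (isSource? j) (rayMeetsSegment? b 𝔩 (pos (src e)) (pos (tgt e)) (not-parallel e))
      (λ meets → meets⇒separates b 𝔩 (B -ᵥ A) n𝔩 _ _ (off-line j u) (off-line j v)
                   (≡.subst₂ (λ x y → RayMeetsSegment b 𝔩 (pos x) (pos y)) eu ev meets))
      (λ opp → ≡.subst₂ (λ x y → RayMeetsSegment b 𝔩 (pos x) (pos y)) (≡.sym eu) (≡.sym ev)
                 (separates⇒meets b 𝔩 (B -ᵥ A) n𝔩 _ _ (off-line j u) (off-line j v)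
                   (right-of-boundary j (inside u)) (right-of-boundary j (inside v)) opp))
      where
      b = boundary j
      n𝔩 = gauge-enters j

    opaque
      unfolding ι

      -- For each gauge ray, an edge contributes the product of the flanks of its two ends, and
      -- every corner is an end of two of the four edges.
      even-quadrilateral : ∀ e f h e′ {p q r t} →
        src e ≡ inj₂ p → tgt e ≡ inj₂ q → src f ≡ inj₂ q → tgt f ≡ inj₂ r →
        src h ≡ inj₂ r → tgt h ≡ inj₂ t → src e′ ≡ inj₂ p → tgt e′ ≡ inj₂ t →
        ι e · ι f · ι h · ι e′ ≡ Sign.+
      even-quadrilateral e f h e′ {p} {q} {r} {t} e₁ e₂ f₁ f₂ h₁ h₂ e′₁ e′₂ =
        count₄ (gaugeRayMeets? N g e) (gaugeRayMeets? N g f) (gaugeRayMeets? N g h) (gaugeRayMeets? N g e′)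
          (λ j → ≡.trans
            (≡.cong₂ _·_ (≡.cong₂ _·_ (≡.cong₂ _·_
              (meets-indicator e e₁ e₂ j) (meets-indicator f f₁ f₂ j)) (meets-indicator h h₁ h₂ j))
              (meets-indicator e′ e′₁ e′₂ j))
            (around (does (isSource? j)) (flankᵥ j p) (flankᵥ j q) (flankᵥ j r) (flankᵥ j t)))
          (allFin n)
        where
        around : ∀ s a b c d → guard s (a · b) · guard s (b · c) · guard s (c · d) · guard s (a · d) ≡ Sign.+
        around false _ _ _ _ = ≡.refl
        around true = toWitness {a? = ∀Sign? λ a → ∀Sign? λ b → ∀Sign? λ c → ∀Sign? λ d → _ Sign.≟ _} _
          where open SignCalculus

-- Lists without repetition and sums over outgoing edges

module UniqueLists {a} {A : Set a} where

  only-member : ∀ {xs : List A} {x} → Unique xs → x ∈ xs → (∀ {y} → y ∈ xs → y ≡ x) → xs ≡ x ∷ []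
  only-member {_ ∷ []}    _                 _ only = ≡.cong (_∷ []) (only (here ≡.refl))
  only-member {_ ∷ _ ∷ _} ((y≢z ∷ _) ∷ _) _ only =
    contradiction (≡.trans (only (here ≡.refl)) (≡.sym (only (there (here ≡.refl))))) y≢z

  -- The edge indices do not determine which edge is listed first; commutativity of the sum absorbs
  -- the two orders in `Σ-out-two`.
  two-members : ∀ {xs : List A} {x y} → Unique xs → x ≢ y → x ∈ xs → y ∈ xs →
                (∀ {z} → z ∈ xs → z ≡ x ⊎ z ≡ y) → xs ≡ x ∷ y ∷ [] ⊎ xs ≡ y ∷ x ∷ []
  two-members {z ∷ zs} {x} {y} (z∉zs ∷ u) x≢y x∈ y∈ only with only (here ≡.refl)
  ... | inj₁ ≡.refl = inj₁ (≡.cong (x ∷_) (only-member u (tail y∈ λ eq → x≢y (≡.sym eq)) λ w∈ →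
                        fromInj₂ (λ eq → contradiction (≡.sym eq) (All.lookup z∉zs w∈)) (only (there w∈))))
    where
    tail : ∀ {w} → w ∈ x ∷ zs → w ≢ x → w ∈ zs
    tail (here eq)  w≢x = contradiction eq w≢x
    tail (there w∈) _   = w∈
  ... | inj₂ ≡.refl = inj₂ (≡.cong (y ∷_) (only-member u (tail x∈ x≢y) λ w∈ →
                        fromInj₁ (λ eq → contradiction (≡.sym eq) (All.lookup z∉zs w∈)) (only (there w∈))))
    where
    tail : ∀ {w} → w ∈ y ∷ zs → w ≢ y → w ∈ zs
    tail (here eq)  w≢y = contradiction eq w≢y
    tail (there w∈) _   = w∈

  member-of-singleton : ∀ {xs : List A} {x y} → length xs ≡ 1 → x ∈ xs → y ∈ xs → y ≡ x
  member-of-singleton {_ ∷ []} _ (here ≡.refl) (here ≡.refl) = ≡.refl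

  member-of-pair : ∀ {xs : List A} {x y z} → length xs ≡ 2 → x ≢ y → x ∈ xs → y ∈ xs → z ∈ xs →
                   z ≡ x ⊎ z ≡ y
  member-of-pair {_ ∷ _ ∷ []} _ x≢y (here p)         (here q)         _                = contradiction (≡.trans p (≡.sym q)) x≢y
  member-of-pair {_ ∷ _ ∷ []} _ x≢y (there (here p)) (there (here q)) _                = contradiction (≡.trans p (≡.sym q)) x≢y
  member-of-pair {_ ∷ _ ∷ []} _ x≢y (here p)         (there (here q)) (here r)         = inj₁ (≡.trans r (≡.sym p))
  member-of-pair {_ ∷ _ ∷ []} _ x≢y (here p)         (there (here q)) (there (here r)) = inj₂ (≡.trans r (≡.sym q))
  member-of-pair {_ ∷ _ ∷ []} _ x≢y (there (here p)) (here q)         (here r)         = inj₂ (≡.trans r (≡.sym q))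
  member-of-pair {_ ∷ _ ∷ []} _ x≢y (there (here p)) (here q)         (there (here r)) = inj₁ (≡.trans r (≡.sym p))

module Incidence (ℝ : RealNumbers) {n m k} (N : Plabic.Network ℝ n m k) where

  open Plabic ℝ
  open Network N
  open UniqueLists

  Σ-out : (Fin k → Carrier) → Vertex → Carrier
  Σ-out term v = foldr (λ f Σ → term f + Σ) 0# (outEdges v)

  Σ-cong : ∀ {t u : Fin k → Carrier} xs → (∀ {f} → f ∈ xs → t f ≈ u f) →
           foldr (λ f Σ → t f + Σ) 0# xs ≈ foldr (λ f Σ → u f + Σ) 0# xs
  Σ-cong []       eq = refl
  Σ-cong (f ∷ xs) eq = +-cong (eq (here ≡.refl)) (Σ-cong xs λ f∈ → eq (there f∈))

  out∈ : ∀ {e v} → src e ≡ v → e ∈ outEdges v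
  out∈ {e} {v} eq = ∈-filter⁺ (λ e → src e ≟ᵛ v) (∈-allFin e) eq

  ∈out : ∀ {e v} → e ∈ outEdges v → src e ≡ v
  ∈out {e} {v} e∈ = proj₂ (∈-filter⁻ (λ e → src e ≟ᵛ v) {xs = allFin k} e∈)

  in∈ : ∀ {e v} → tgt e ≡ v → e ∈ inEdges v
  in∈ {e} {v} eq = ∈-filter⁺ (λ e → tgt e ≟ᵛ v) (∈-allFin e) eq

  out-unique : ∀ v → Unique (outEdges v)
  out-unique v = filter⁺ (λ e → src e ≟ᵛ v) (allFin⁺ k)

  Σ-out-one : ∀ {v f} term → src f ≡ v → (∀ e → src e ≡ v → e ≡ f) → Σ-out term v ≈ term f
  Σ-out-one {v} term f∈ only
    rewrite only-member (out-unique v) (out∈ f∈) (λ {e} e∈ → only e (∈out e∈)) = +-identityʳ _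

  Σ-out-two : ∀ {v f g} term → f ≢ g → src f ≡ v → src g ≡ v →
              (∀ e → src e ≡ v → e ≡ f ⊎ e ≡ g) → Σ-out term v ≈ term f + term g
  Σ-out-two {v} {f} {g} term f≢g f∈ g∈ only =
    sum (two-members (out-unique v) f≢g (out∈ f∈) (out∈ g∈) (λ {e} e∈ → only e (∈out e∈)))
    where
    sum : ∀ {xs} → xs ≡ f ∷ g ∷ [] ⊎ xs ≡ g ∷ f ∷ [] → foldr (λ f Σ → term f + Σ) 0# xs ≈ term f + term g
    sum (inj₁ ≡.refl) = +-congˡ (+-identityʳ _)
    sum (inj₂ ≡.refl) = trans (+-congˡ (+-identityʳ _)) (+-comm _ _)

-- Edges at a corner of the face

module CornerEdges (ℝ : RealNumbers) {n m k} (N : Plabic.Network ℝ n m k)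
                   (pn : Plabic.IsPlabicNetwork ℝ N) where

  open Plabic ℝ
  open Network N
  open IsPlabicNetwork pn
  open OrderedField ℝ
  open Corners ℝ
  open IntegerCoefficientSolver commutativeRing using (solve; _:=_; _:+_; _:*_; _:-_; :-_; con)
  open SetoidReasoning setoid

  -- Forgets the orientation, so that edges entering and leaving a corner are treated alike.
  Joins : Fin k → Vertex → Vertex → Set
  Joins e u v = (src e ≡ u × tgt e ≡ v) ⊎ (src e ≡ v × tgt e ≡ u)

  point : Vertex → Vertex → Carrier → Point
  point u v s = pos u +ᵥ s • (pos v -ᵥ pos u)

  reverse-parameter : ∀ p q s → p + s * (q - p) ≈ q + (1# - s) * (p - q)
  reverse-parameter = solve 3 (λ p q s → p :+ s :* (q :- p) := q :+ (con 1ℤ :- s) :* (p :- q)) refl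

  0<1-s : ∀ {s} → s < 1# → 0# < 1# - s
  0<1-s = <⇒0<-

  1-s<1 : ∀ {s} → 0# < s → 1# - s < 1#
  1-s<1 {s} 0<s = complement-<1 0<s (solve 1 (λ s → con 1ℤ :- s :+ s := con 1ℤ) refl s)

  on-edge : ∀ {e u v s} → Joins e u v → 0# < s → s < 1# → OnEdge e (point u v s)
  on-edge {s = s} (inj₁ (≡.refl , ≡.refl)) 0<s s<1 = s , inj₁ 0<s , inj₁ s<1 , refl , refl
  on-edge {s = s} (inj₂ (≡.refl , ≡.refl)) 0<s s<1 =
    1# - s , inj₁ (0<1-s s<1) , inj₁ (1-s<1 0<s) , reverse-parameter _ _ s , reverse-parameter _ _ s

  not-start : ∀ {u v s} → u ≢ v → 0# < s → ¬ (point u v s ≈ᵥ pos u)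
  not-start {u} {v} {s} u≢v 0<s (e₁ , e₂) = u≢v (pos-injective (coordinate e₁ , coordinate e₂))
    where
    coordinate : ∀ {p q} → p + s * (q - p) ≈ p → p ≈ q
    coordinate {p} {q} eq = begin
      p                              ≈⟨ solve 2 (λ p q → p := q :- con 1ℤ :* (q :- p)) refl p q ⟩
      q - 1# * (q - p)               ≈⟨ +-congˡ (-‿cong (*-congʳ (*-inverse (0<⇒≉0 0<s)))) ⟨
      q - s ⁻¹ * s * (q - p)         ≈⟨ solve 4 (λ p q s r → q :- r :* s :* (q :- p) := q :- r :* (p :+ s :* (q :- p) :- p)) refl p q s (s ⁻¹) ⟩
      q - s ⁻¹ * (p + s * (q - p) - p) ≈⟨ +-congˡ (-‿cong (*-congˡ (trans (+-congʳ eq) (-‿inverseʳ p)))) ⟩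
      q - s ⁻¹ * 0#                  ≈⟨ solve 2 (λ q r → q :- r :* con 0ℤ := q) refl q (s ⁻¹) ⟩
      q                              ∎

  not-end : ∀ {u v s} → u ≢ v → s < 1# → ¬ (point u v s ≈ᵥ pos v)
  not-end {u} {v} {s} u≢v s<1 (e₁ , e₂) = not-start (λ eq → u≢v (≡.sym eq)) (0<1-s s<1)
    (trans (sym (reverse-parameter _ _ s)) e₁ , trans (sym (reverse-parameter _ _ s)) e₂)

  joined-distinct : ∀ {e u v} → Joins e u v → u ≢ v
  joined-distinct {e} (inj₁ (p , q)) ≡.refl = no-loops e (≡.trans p (≡.sym q))
  joined-distinct {e} (inj₂ (p , q)) ≡.refl = no-loops e (≡.trans p (≡.sym q))

  endpoint : ∀ {e u v w} → Joins e u v → EndpointOf e w → w ≡ u ⊎ w ≡ v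
  endpoint (inj₁ (p , q)) (inj₁ r) = inj₁ (≡.trans (≡.sym r) p)
  endpoint (inj₁ (p , q)) (inj₂ r) = inj₂ (≡.trans (≡.sym r) q)
  endpoint (inj₂ (p , q)) (inj₁ r) = inj₂ (≡.trans (≡.sym r) p)
  endpoint (inj₂ (p , q)) (inj₂ r) = inj₁ (≡.trans (≡.sym r) q)

  -- By planarity a common point of two edges is a common endpoint, but the overlap point is
  -- strictly between the ends of `e`.
  no-overlap : ∀ {e h v w x} → e ≢ h → Joins e v w → Joins h v x →
               ¬ Overlap (pos v) (pos x -ᵥ pos v) (pos w -ᵥ pos v)
  no-overlap {e} {h} {v} {w} {x} e≢h je jh (s , t , (0<s , s<1) , (0<t , t<1) , e₁ , e₂) =
    let z , ze , _ , at-z = no-crossings e≢h (on-edge je 0<t t<1)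
          (transport (on-edge jh 0<s s<1))
    in end z (endpoint je ze) at-z
    where
    transport : OnEdge h (point v x s) → OnEdge h (point v w t)
    transport (r , 0≤r , r≤1 , f₁ , f₂) = r , 0≤r , r≤1 , trans e₁ f₁ , trans e₂ f₂

    end : ∀ z → z ≡ v ⊎ z ≡ w → ¬ (point v w t ≈ᵥ pos z)
    end _ (inj₁ ≡.refl) = not-start (joined-distinct je) 0<t
    end _ (inj₂ ≡.refl) = not-end (joined-distinct je) t<1

  corner-edge : ∀ {v x o y : Fin m} {w hx hy e} →
    Joins hx (inj₂ v) (inj₂ x) → Joins hy (inj₂ v) (inj₂ y) → Joins e (inj₂ v) w → e ≢ hx → e ≢ hy →
    ClockwiseQuadrilateral (internal v) (internal x) (internal o) (internal y) →
    (∀ e {p} → OnEdge e p → ¬ InQuadrilateral (internal v) (internal x) (internal o) (internal y) p) →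
    CyclicCCW (internal y -ᵥ internal v) (internal x -ᵥ internal v) (pos w -ᵥ internal v)
  corner-edge {v} {x} {o} {y} {w} {hx} {hy} {e} jx jy je e≢hx e≢hy quad face =
    corner (internal v) (internal x) (internal o) (internal y) (pos w) quad
      (λ t 0<t t<1 → face e (on-edge je 0<t t<1))
      (no-overlap e≢hx je jx) (no-overlap e≢hy je jy)
      (λ eq → joined-distinct je (≡.sym (pos-injective eq)))


  rotate-cut : ∀ {a b c d} → Cut a b c d → Cut c d a b
  rotate-cut {a} {b} {c} {d} (abc , acd) = CW-rotate a c d acd , CW-rotate b c a (CW-rotate a b c abc)

  rotate-InCut : ∀ {a b c d x} → InCut a b c d x → InCut c d a b x
  rotate-InCut (cut , inj₁ (ab , bc , ca)) = rotate-cut cut , inj₂ (inj₁ (ca , ab , bc))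
  rotate-InCut (cut , inj₂ (inj₁ (ac , cd , da))) = rotate-cut cut , inj₁ (cd , da , ac)
  rotate-InCut (cut , inj₂ (inj₂ (s , 0<s , s<1 , e₁ , e₂))) =
    rotate-cut cut , inj₂ (inj₂ (1# - s , 0<1-s s<1 , 1-s<1 0<s ,
      trans e₁ (reverse-parameter _ _ s) , trans e₂ (reverse-parameter _ _ s)))

  rotate-quadrilateral : ∀ {a b c d} → ClockwiseQuadrilateral a b c d → ClockwiseQuadrilateral b c d a
  rotate-quadrilateral (inj₁ cut) = inj₂ (rotate-cut cut)
  rotate-quadrilateral (inj₂ cut) = inj₁ cut

  -- A cut may be read from either end of its diagonal, so the region does not depend on the
  -- starting corner. The face condition, stated from S, thus becomes available at P.
  rotate-region : ∀ {a b c d x} → InQuadrilateral b c d a x → InQuadrilateral a b c d x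
  rotate-region (inj₁ i) = inj₂ i
  rotate-region (inj₂ i) = inj₁ (rotate-InCut i)

-- Combinatorics of the graph before and after the move

module SquareGraph (ℝ : RealNumbers) {n m k} (N : Plabic.Network ℝ n m k)
                   (pn : Plabic.IsPlabicNetwork ℝ N) (sq : Plabic.Square ℝ N) where

  open Plabic ℝ
  open Network N
  open IsPlabicNetwork pn
  open Square sq
  open OrderedField ℝ
  open UniqueLists
  open Incidence ℝ N

  Ñ : Network n m k
  Ñ = squareMove N sq

  open Network Ñ public using () renaming (src to s̃rc; tgt to t̃gt; dir to d̃ir; weight to w̃eight)

  CW-thin : ∀ {a b} → ¬ CW a b a
  CW-thin {a} {b} cw = <.irrefl (trans
    (PlaneLemmas.cross-cong {b -ᵥ a} {b -ᵥ a} (refl , refl) (-‿inverseʳ _ , -‿inverseʳ _))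
    (trans (+-cong (zeroʳ _) (-‿cong (zeroʳ _))) (-‿inverseʳ 0#))) cw

  CW-asym : ∀ {a b c} → CW a b c → ¬ CW a c b
  CW-asym {a} {b} {c} cw cw′ =
    <.asym cw (<.<-respʳ-≈ (PlaneLemmas.cross-anti (c -ᵥ a) (b -ᵥ a)) (<0⇒0<- cw′))

  -- Opposite corners share a colour, so the geometry must separate them: identified, they would
  -- give a cut a triangle with a repeated vertex or two triangles of opposite orientation.
  S≢Q : S ≢ Q
  S≢Q eq = clash (≡.subst (λ q → ClockwiseQuadrilateral (internal S) (internal P) (internal q) (internal R))
                   (≡.sym eq) quadrilateral)
    where
    clash : ¬ ClockwiseQuadrilateral (internal S) (internal P) (internal S) (internal R)
    clash (inj₁ (spq , _))   = CW-thin spq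
    clash (inj₂ (pqr , prs)) = CW-asym pqr prs

  P≢R : P ≢ R
  P≢R eq = clash (≡.subst (λ r → ClockwiseQuadrilateral (internal S) (internal P) (internal Q) (internal r))
                   (≡.sym eq) quadrilateral)
    where
    clash : ¬ ClockwiseQuadrilateral (internal S) (internal P) (internal Q) (internal P)
    clash (inj₁ (spq , sqr)) = CW-asym spq sqr
    clash (inj₂ (pqr , _))   = CW-thin pqr

  bichromatic : ∀ {u v} → colour u ≡ white → colour v ≡ black → u ≢ v
  bichromatic w b ≡.refl = contradiction (≡.trans (≡.sym w) b) λ ()

  S≢P : S ≢ P
  S≢P = bichromatic S-white P-black
  S≢R : S ≢ R
  S≢R = bichromatic S-white R-black
  Q≢P : Q ≢ P
  Q≢P = bichromatic Q-white P-black
  Q≢R : Q ≢ R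
  Q≢R = bichromatic Q-white R-black

  private
    differ : ∀ {f : Fin k → Vertex} {e e′ u v} → f e ≡ inj₂ u → f e′ ≡ inj₂ v → u ≢ v → e ≢ e′
    differ p q u≢v ≡.refl = u≢v (inj₂-injective (≡.trans (≡.sym p) q))

  h₁≢h₂ : h₁ ≢ h₂
  h₁≢h₂ = differ {tgt} h₁-tgt h₂-tgt P≢R
  h₁≢h₃ : h₁ ≢ h₃
  h₁≢h₃ = differ {src} h₁-src h₃-src S≢P
  h₁≢h₄ : h₁ ≢ h₄
  h₁≢h₄ = differ {src} h₁-src h₄-src S≢Q
  h₂≢h₃ : h₂ ≢ h₃
  h₂≢h₃ = differ {src} h₂-src h₃-src S≢P
  h₂≢h₄ : h₂ ≢ h₄
  h₂≢h₄ = differ {src} h₂-src h₄-src S≢Q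
  h₃≢h₄ : h₃ ≢ h₄
  h₃≢h₄ = differ {tgt} h₃-tgt h₄-tgt Q≢R

  outdegree-white : ∀ {v} → degree (inj₂ v) ≡ 3 → colour v ≡ white → outdegree (inj₂ v) ≡ 2
  outdegree-white {v} deg w = ℕ.+-cancelˡ-≡ 1 _ _
    (≡.trans (≡.cong (ℕ._+ outdegree (inj₂ v)) (≡.sym (white-perfect v w))) deg)

  indegree-black : ∀ {v} → degree (inj₂ v) ≡ 3 → colour v ≡ black → indegree (inj₂ v) ≡ 2
  indegree-black {v} deg b = ℕ.+-cancelʳ-≡ 1 _ _
    (≡.trans (≡.cong (indegree (inj₂ v) ℕ.+_) (≡.sym (black-perfect v b))) deg)

  -- Perfectness and trivalence leave exactly two outgoing edges at a white corner and one at a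
  -- black corner, so the named edges are all of them.
  out-S : ∀ e → src e ≡ inj₂ S → e ≡ h₁ ⊎ e ≡ h₂
  out-S e eq = member-of-pair (outdegree-white S-trivalent S-white) h₁≢h₂ (out∈ h₁-src) (out∈ h₂-src) (out∈ eq)

  out-P : ∀ e → src e ≡ inj₂ P → e ≡ h₃
  out-P e eq = member-of-singleton (black-perfect P P-black) (out∈ h₃-src) (out∈ eq)

  out-Q : ∀ e → src e ≡ inj₂ Q → e ≡ h₄ ⊎ e ≡ e₄
  out-Q e eq = member-of-pair (outdegree-white Q-trivalent Q-white) (λ p → e₄≢h₄ (≡.sym p))
                 (out∈ h₄-src) (out∈ e₄-src) (out∈ eq)

  out-R : ∀ e → src e ≡ inj₂ R → e ≡ e₃
  out-R e eq = member-of-singleton (black-perfect R R-black) (out∈ e₃-src) (out∈ eq)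

  in-Q : ∀ e → tgt e ≡ inj₂ Q → e ≡ h₃
  in-Q e eq = member-of-singleton (white-perfect Q Q-white) (in∈ h₃-tgt) (in∈ eq)

  in-R : ∀ e → tgt e ≡ inj₂ R → e ≡ h₂ ⊎ e ≡ h₄
  in-R e eq = member-of-pair (indegree-black R-trivalent R-black) h₂≢h₄ (in∈ h₂-tgt) (in∈ h₄-tgt) (in∈ eq)

  record Outer (e : Fin k) : Set where
    constructor outer
    field
      ≢h₁ : e ≢ h₁
      ≢h₂ : e ≢ h₂
      ≢h₃ : e ≢ h₃
      ≢h₄ : e ≢ h₄

  data Position (e : Fin k) : Set where
    is-h₁    : e ≡ h₁ → Position e
    is-h₂    : e ≡ h₂ → Position e
    is-h₃    : e ≡ h₃ → Position e
    is-h₄    : e ≡ h₄ → Position e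
    is-outer : Outer e → Position e

  position : ∀ e → Position e
  position e with e Fin.≟ h₁ | e Fin.≟ h₂ | e Fin.≟ h₃ | e Fin.≟ h₄
  ... | yes p | _     | _     | _     = is-h₁ p
  ... | no _  | yes p | _     | _     = is-h₂ p
  ... | no _  | no _  | yes p | _     = is-h₃ p
  ... | no _  | no _  | no _  | yes p = is-h₄ p
  ... | no p  | no q  | no r  | no s  = is-outer (outer p q r s)

  e₃-outer : Outer e₃
  e₃-outer = outer (differ {src} e₃-src h₁-src (λ eq → S≢R (≡.sym eq)))
                   (differ {src} e₃-src h₂-src (λ eq → S≢R (≡.sym eq)))
                   (differ {src} e₃-src h₃-src (λ eq → P≢R (≡.sym eq)))
                   (differ {src} e₃-src h₄-src (λ eq → Q≢R (≡.sym eq)))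

  e₄-outer : Outer e₄
  e₄-outer = outer (differ {src} e₄-src h₁-src (λ eq → S≢Q (≡.sym eq)))
                   (differ {src} e₄-src h₂-src (λ eq → S≢Q (≡.sym eq)))
                   (differ {src} e₄-src h₃-src Q≢P) e₄≢h₄

  data OnSquare (v : Fin m) : Set where
    is-S : v ≡ S → OnSquare v
    is-P : v ≡ P → OnSquare v
    is-Q : v ≡ Q → OnSquare v
    is-R : v ≡ R → OnSquare v

  onSquare? : ∀ v → Dec (OnSquare v)
  onSquare? v with v Fin.≟ S | v Fin.≟ P | v Fin.≟ Q | v Fin.≟ R
  ... | yes p | _     | _     | _     = yes (is-S p)
  ... | no _  | yes p | _     | _     = yes (is-P p)
  ... | no _  | no _  | yes p | _     = yes (is-Q p)
  ... | no _  | no _  | no _  | yes p = yes (is-R p)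
  ... | no p  | no q  | no r  | no s  =
    no λ { (is-S eq) → p eq ; (is-P eq) → q eq ; (is-Q eq) → r eq ; (is-R eq) → s eq }

  outer-from : ∀ {e v} → ¬ OnSquare v → src e ≡ inj₂ v → Outer e
  outer-from off eq = outer
    (λ p → off (is-S (leaves p h₁-src))) (λ p → off (is-S (leaves p h₂-src)))
    (λ p → off (is-P (leaves p h₃-src))) (λ p → off (is-Q (leaves p h₄-src)))
    where
    leaves : ∀ {h u} → _ ≡ h → src h ≡ inj₂ u → _ ≡ u
    leaves ≡.refl p = inj₂-injective (≡.trans (≡.sym eq) p)

  ⌊⌋-true : ∀ {A : Set} (a? : Dec A) → A → ⌊ a? ⌋ ≡ true
  ⌊⌋-true a? a = ≡.trans (isYes≗does a?) (dec-true a? a)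

  ⌊⌋-false : ∀ {A : Set} (a? : Dec A) → ¬ A → ⌊ a? ⌋ ≡ false
  ⌊⌋-false a? ¬a = ≡.trans (isYes≗does a?) (dec-false a? ¬a)

  module _ {A : Set} (x₁ x₂ x₃ x₄ : A) (x : Fin k → A) where

    -- Has the nested form of the weights in `squareMove`, so that its lemmas compute both the new
    -- weights and the candidate edge vectors.
    onSquare : Fin k → A
    onSquare e = if ⌊ e Fin.≟ h₁ ⌋ then x₁ else
                 if ⌊ e Fin.≟ h₂ ⌋ then x₂ else
                 if ⌊ e Fin.≟ h₃ ⌋ then x₃ else
                 if ⌊ e Fin.≟ h₄ ⌋ then x₄ else x e

    onSquare-h₁ : onSquare h₁ ≡ x₁
    onSquare-h₁ rewrite ⌊⌋-true (h₁ Fin.≟ h₁) ≡.refl = ≡.refl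

    onSquare-h₂ : onSquare h₂ ≡ x₂
    onSquare-h₂ rewrite ⌊⌋-false (h₂ Fin.≟ h₁) (λ p → h₁≢h₂ (≡.sym p))
                      | ⌊⌋-true (h₂ Fin.≟ h₂) ≡.refl = ≡.refl

    onSquare-h₃ : onSquare h₃ ≡ x₃
    onSquare-h₃ rewrite ⌊⌋-false (h₃ Fin.≟ h₁) (λ p → h₁≢h₃ (≡.sym p))
                      | ⌊⌋-false (h₃ Fin.≟ h₂) (λ p → h₂≢h₃ (≡.sym p))
                      | ⌊⌋-true (h₃ Fin.≟ h₃) ≡.refl = ≡.refl

    onSquare-h₄ : onSquare h₄ ≡ x₄
    onSquare-h₄ rewrite ⌊⌋-false (h₄ Fin.≟ h₁) (λ p → h₁≢h₄ (≡.sym p))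
                      | ⌊⌋-false (h₄ Fin.≟ h₂) (λ p → h₂≢h₄ (≡.sym p))
                      | ⌊⌋-false (h₄ Fin.≟ h₃) (λ p → h₃≢h₄ (≡.sym p))
                      | ⌊⌋-true (h₄ Fin.≟ h₄) ≡.refl = ≡.refl

    onSquare-outer : ∀ {e} → Outer e → onSquare e ≡ x e
    onSquare-outer {e} (outer p q r s) rewrite ⌊⌋-false (e Fin.≟ h₁) p | ⌊⌋-false (e Fin.≟ h₂) q
                                              | ⌊⌋-false (e Fin.≟ h₃) r | ⌊⌋-false (e Fin.≟ h₄) s = ≡.refl

  reversed-h₁ : reversed h₁ ≡ true
  reversed-h₁ rewrite ⌊⌋-true (h₁ Fin.≟ h₁) ≡.refl = ≡.refl

  reversed-h₄ : reversed h₄ ≡ true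
  reversed-h₄ rewrite ⌊⌋-false (h₄ Fin.≟ h₁) (λ p → h₁≢h₄ (≡.sym p)) | ⌊⌋-true (h₄ Fin.≟ h₄) ≡.refl = ≡.refl

  unreversed : ∀ {e} → e ≢ h₁ → e ≢ h₄ → reversed e ≡ false
  unreversed {e} p q rewrite ⌊⌋-false (e Fin.≟ h₁) p | ⌊⌋-false (e Fin.≟ h₄) q = ≡.refl

  module _ {e} (r : reversed e ≡ true) where
    s̃rc-reversed : s̃rc e ≡ tgt e
    s̃rc-reversed rewrite r = ≡.refl
    t̃gt-reversed : t̃gt e ≡ src e
    t̃gt-reversed rewrite r = ≡.refl
    d̃ir-reversed : d̃ir e ≈ᵥ -ᵥ dir e
    d̃ir-reversed rewrite r = sym (PlaneLemmas.neg-- _ _) , sym (PlaneLemmas.neg-- _ _)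

  module _ {e} (r : reversed e ≡ false) where
    s̃rc-unreversed : s̃rc e ≡ src e
    s̃rc-unreversed rewrite r = ≡.refl
    t̃gt-unreversed : t̃gt e ≡ tgt e
    t̃gt-unreversed rewrite r = ≡.refl
    d̃ir-unreversed : d̃ir e ≡ dir e
    d̃ir-unreversed rewrite r = ≡.refl

  h₁-s̃rc : s̃rc h₁ ≡ inj₂ P
  h₁-s̃rc = ≡.trans (s̃rc-reversed reversed-h₁) h₁-tgt
  h₁-t̃gt : t̃gt h₁ ≡ inj₂ S
  h₁-t̃gt = ≡.trans (t̃gt-reversed reversed-h₁) h₁-src
  h₄-s̃rc : s̃rc h₄ ≡ inj₂ R
  h₄-s̃rc = ≡.trans (s̃rc-reversed reversed-h₄) h₄-tgt
  h₄-t̃gt : t̃gt h₄ ≡ inj₂ Q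
  h₄-t̃gt = ≡.trans (t̃gt-reversed reversed-h₄) h₄-src

  unreversed-h₂ : reversed h₂ ≡ false
  unreversed-h₂ = unreversed (λ p → h₁≢h₂ (≡.sym p)) h₂≢h₄
  unreversed-h₃ : reversed h₃ ≡ false
  unreversed-h₃ = unreversed (λ p → h₁≢h₃ (≡.sym p)) h₃≢h₄
  unreversed-outer : ∀ {e} → Outer e → reversed e ≡ false
  unreversed-outer o = unreversed (Outer.≢h₁ o) (Outer.≢h₄ o)

  s̃rc-cases : ∀ e {v} → s̃rc e ≡ v → (e ≡ h₁ × v ≡ inj₂ P) ⊎ (e ≡ h₄ × v ≡ inj₂ R)
                                    ⊎ (reversed e ≡ false × src e ≡ v)
  s̃rc-cases e eq with position e
  ... | is-h₁ ≡.refl = inj₁ (≡.refl , ≡.trans (≡.sym eq) h₁-s̃rc)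
  ... | is-h₄ ≡.refl = inj₂ (inj₁ (≡.refl , ≡.trans (≡.sym eq) h₄-s̃rc))
  ... | is-h₂ ≡.refl = inj₂ (inj₂ (unreversed-h₂ , ≡.trans (≡.sym (s̃rc-unreversed unreversed-h₂)) eq))
  ... | is-h₃ ≡.refl = inj₂ (inj₂ (unreversed-h₃ , ≡.trans (≡.sym (s̃rc-unreversed unreversed-h₃)) eq))
  ... | is-outer o   = inj₂ (inj₂ (unreversed-outer o , ≡.trans (≡.sym (s̃rc-unreversed (unreversed-outer o))) eq))

  õut-S : ∀ e → s̃rc e ≡ inj₂ S → e ≡ h₂
  õut-S e eq with s̃rc-cases e eq
  ... | inj₁ (_ , p)        = contradiction (inj₂-injective p) S≢P
  ... | inj₂ (inj₁ (_ , p)) = contradiction (inj₂-injective p) S≢R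
  ... | inj₂ (inj₂ (r , p)) with out-S e p
  ...   | inj₁ ≡.refl = contradiction (≡.trans (≡.sym r) reversed-h₁) λ ()
  ...   | inj₂ q      = q

  õut-P : ∀ e → s̃rc e ≡ inj₂ P → e ≡ h₁ ⊎ e ≡ h₃
  õut-P e eq with s̃rc-cases e eq
  ... | inj₁ (p , _)        = inj₁ p
  ... | inj₂ (inj₁ (_ , p)) = contradiction (inj₂-injective p) P≢R
  ... | inj₂ (inj₂ (_ , p)) = inj₂ (out-P e p)

  õut-Q : ∀ e → s̃rc e ≡ inj₂ Q → e ≡ e₄
  õut-Q e eq with s̃rc-cases e eq
  ... | inj₁ (_ , p)        = contradiction (inj₂-injective p) Q≢P
  ... | inj₂ (inj₁ (_ , p)) = contradiction (inj₂-injective p) Q≢R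
  ... | inj₂ (inj₂ (r , p)) with out-Q e p
  ...   | inj₁ ≡.refl = contradiction (≡.trans (≡.sym r) reversed-h₄) λ ()
  ...   | inj₂ q      = q

  õut-R : ∀ e → s̃rc e ≡ inj₂ R → e ≡ h₄ ⊎ e ≡ e₃
  õut-R e eq with s̃rc-cases e eq
  ... | inj₁ (_ , p)        = contradiction (≡.sym (inj₂-injective p)) P≢R
  ... | inj₂ (inj₁ (p , _)) = inj₁ p
  ... | inj₂ (inj₂ (_ , p)) = inj₂ (out-R e p)

  õut-off : ∀ {v} → ¬ OnSquare v → ∀ e → s̃rc e ≡ inj₂ v → src e ≡ inj₂ v
  õut-off off e eq with s̃rc-cases e eq
  ... | inj₁ (_ , p)        = contradiction (is-P (inj₂-injective p)) off
  ... | inj₂ (inj₁ (_ , p)) = contradiction (is-R (inj₂-injective p)) off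
  ... | inj₂ (inj₂ (_ , p)) = p

  IsSource⇒ : ∀ {j} → IsSource j → Network.IsSource Ñ j
  IsSource⇒ {j} (e , eq) with position e
  ... | is-h₁ ≡.refl = contradiction (≡.trans (≡.sym eq) h₁-src) λ ()
  ... | is-h₄ ≡.refl = contradiction (≡.trans (≡.sym eq) h₄-src) λ ()
  ... | is-h₂ ≡.refl = contradiction (≡.trans (≡.sym eq) h₂-src) λ ()
  ... | is-h₃ ≡.refl = contradiction (≡.trans (≡.sym eq) h₃-src) λ ()
  ... | is-outer o   = e , ≡.trans (s̃rc-unreversed (unreversed-outer o)) eq

  IsSource⇐ : ∀ {j} → Network.IsSource Ñ j → IsSource j
  IsSource⇐ {j} (e , eq) with s̃rc-cases e eq
  ... | inj₁ (_ , ())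
  ... | inj₂ (inj₁ (_ , ()))
  ... | inj₂ (inj₂ (_ , p)) = e , p

  flip-meets : ∀ {b 𝔩 p q} → RayMeetsSegment b 𝔩 p q → RayMeetsSegment b 𝔩 q p
  flip-meets (x , ray , s , 0≤s , s≤1 , e₁ , e₂) =
    x , ray , 1# - s , 0≤1-s s≤1 , 1-s≤1 0≤s ,
    trans e₁ (reverse-parameter _ _ s) , trans e₂ (reverse-parameter _ _ s)
    where
    open CornerEdges ℝ N pn
    0≤1-s : s ≤ 1# → 0# ≤ 1# - s
    0≤1-s (inj₁ s<1) = inj₁ (0<1-s s<1)
    0≤1-s (inj₂ s≈1) = inj₂ (trans (sym (-‿inverseʳ 1#)) (+-congˡ (-‿cong (sym s≈1))))
    1-s≤1 : 0# ≤ s → 1# - s ≤ 1#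
    1-s≤1 (inj₁ 0<s) = inj₁ (1-s<1 0<s)
    1-s≤1 (inj₂ 0≈s) = inj₂ (trans (+-congˡ (-‿cong (sym 0≈s))) (trans (+-congʳ (sym (+-identityʳ 1#)))
      (trans (+-assoc 1# 0# (- 0#)) (trans (+-congˡ (-‿inverseʳ 0#)) (+-identityʳ 1#)))))

  module _ {𝔩 : Point} (g : IsGaugeDirection N 𝔩) where

    -- Reversal leaves an edge the same segment, and the reversed edges join internal vertices, so
    -- the boundary sources stay the same.
    int-preserved : ∀ e → int Ñ (squareMove-gauge N sq g) e ≡ int N g e
    int-preserved e = ≡.cong (λ xs → + length xs)
      (filter-≐ (gaugeRayMeets? Ñ (squareMove-gauge N sq g) e) (gaugeRayMeets? N g e)
        ((λ { (i , meets) → IsSource⇐ i , from meets }) , (λ { (i , meets) → IsSource⇒ i , to meets }))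
        (allFin n))
      where
      Meets Meets̃ : Fin n → Set
      Meets j = RayMeetsSegment (boundary j) 𝔩 (pos (src e)) (pos (tgt e))
      Meets̃ j = RayMeetsSegment (boundary j) 𝔩 (pos (s̃rc e)) (pos (t̃gt e))

      from : ∀ {j} → Meets̃ j → Meets j
      from meets with reversed e
      ... | true  = flip-meets meets
      ... | false = meets

      to : ∀ {j} → Meets j → Meets̃ j
      to meets with reversed e
      ... | true  = flip-meets meets
      ... | false = meets

-- The edge system written with signs

module EdgeSystem (ℝ : RealNumbers) {n m k} (N : Plabic.Network ℝ n m k) {𝔩 : Plabic.Point ℝ}
                  (g : Plabic.IsGaugeDirection ℝ N 𝔩) where

  open Plabic ℝ
  open Network N
  open IsGaugeDirection g
  open OrderedField ℝ
  open Turning ℝ 𝔩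
  open Parity
  open SignedUnits ℝ
  open Exponents ℝ 𝔩
  open Incidence ℝ N
  open IntersectionParity ℝ N g

  transverse : ∀ e → Transverse (dir e)
  transverse e eq = not-parallel e (trans (sym (PlaneLemmas.cross-anti (dir e) 𝔩))
    (trans (-‿cong (⊙-sg eq)) (IntegerCoefficientSolver.-0≈0 commutativeRing)))

  term : EdgeFamily {n} {m} {k} → Fin k → Fin n → Fin k → Carrier
  term E e i f = [-1]^ (wind 𝔩 (dir e) (dir f)) * E f i

  term≈ : ∀ E e f i {a b x} → dir e ≈ᵥ a → dir f ≈ᵥ b → E f i ≡ x → term E e i f ≈ ⟦ τ a b ⟧ * x
  term≈ E e f i p q r = *-cong
    (trans ([-1]^-parity (wind 𝔩 (dir e) (dir f)))
           (reflexive (≡.cong ⟦_⟧ (≡.trans (parity-wind (dir e) (dir f) (transverse e) (transverse f)) (τ-cong p q)))))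
    (reflexive r)

  [-1]^-ι : ∀ e → [-1]^ (int N g e) ≈ ⟦ ι e ⟧
  [-1]^-ι e = trans ([-1]^-parity (int N g e)) (reflexive (≡.cong ⟦_⟧ (ι-int e)))

  opaque
    RHS : EdgeFamily {n} {m} {k} → Fin k → Fin m → Fin n → Carrier
    RHS E e v i = [-1]^ (int N g e) * weight e * Σ-out (term E e i) (inj₂ v)

    at-internal-RHS : ∀ {E} → SolvesEdgeSystem N g E → ∀ e v → tgt e ≡ inj₂ v → ∀ i → E e i ≈ RHS E e v i
    at-internal-RHS solves = SolvesEdgeSystem.at-internal solves

    at-sink-ι : ∀ {E} → SolvesEdgeSystem N g E → ∀ e j → tgt e ≡ inj₁ j → ∀ i →
                E e i ≈ ⟦ ι e ⟧ * weight e * canonical N g j i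
    at-sink-ι solves e j eq i = trans (SolvesEdgeSystem.at-sink solves e j eq i) (*-congʳ (*-congʳ ([-1]^-ι e)))

    solves-RHS : ∀ {E} → (∀ e v → tgt e ≡ inj₂ v → ∀ i → E e i ≈ RHS E e v i) →
                 (∀ e j → tgt e ≡ inj₁ j → ∀ i → E e i ≈ ⟦ ι e ⟧ * weight e * canonical N g j i) →
                 SolvesEdgeSystem N g E
    solves-RHS internal sink = record
      { at-internal = internal
      ; at-sink     = λ e j eq i → trans (sink e j eq i) (*-congʳ (*-congʳ (sym ([-1]^-ι e))))
      }

    -- Serves vertices off the square, whose outgoing edges are not listed explicitly but are common
    -- to both networks.
    RHS-out : ∀ E {e v es} {x : Fin k → Carrier} {s w d} i → outEdges (inj₂ v) ≡ es →
              ι e ≡ s → weight e ≡ w → dir e ≈ᵥ d →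
              (∀ {f} → f ∈ es → ⟦ τ d (dir f) ⟧ * E f i ≈ x f) →
              RHS E e v i ≈ ⟦ s ⟧ * w * foldr (λ f Σ → x f + Σ) 0# es
    RHS-out E {e} {es = es} i ≡.refl ≡.refl ≡.refl p terms = *-cong
      (*-congʳ ([-1]^-ι e))
      (Σ-cong es λ {f} f∈ → trans (term≈ E e f i p (refl , refl) ≡.refl) (terms f∈))

    RHS-one : ∀ E {e v f} i {s w a b x} → src f ≡ inj₂ v → (∀ e → src e ≡ inj₂ v → e ≡ f) →
              ι e ≡ s → weight e ≡ w → dir e ≈ᵥ a → dir f ≈ᵥ b → E f i ≡ x →
              RHS E e v i ≈ ⟦ s ⟧ * w * (⟦ τ a b ⟧ * x)
    RHS-one E {e} i f∈ only ≡.refl ≡.refl p q r = *-cong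
      (*-congʳ ([-1]^-ι e))
      (trans (Σ-out-one (term E e i) f∈ only) (term≈ E e _ i p q r))

    RHS-two : ∀ E {e v f h} i {s w a b c x y} → f ≢ h → src f ≡ inj₂ v → src h ≡ inj₂ v →
              (∀ e → src e ≡ inj₂ v → e ≡ f ⊎ e ≡ h) →
              ι e ≡ s → weight e ≡ w → dir e ≈ᵥ a → dir f ≈ᵥ b → dir h ≈ᵥ c →
              E f i ≡ x → E h i ≡ y →
              RHS E e v i ≈ ⟦ s ⟧ * w * (⟦ τ a b ⟧ * x + ⟦ τ a c ⟧ * y)
    RHS-two E {e} i f≢h f∈ h∈ only ≡.refl ≡.refl p q q′ r r′ = *-cong
      (*-congʳ ([-1]^-ι e))
      (trans (Σ-out-two (term E e i) f≢h f∈ h∈ only) (+-cong (term≈ E e _ i p q r) (term≈ E e _ i p q′ r′)))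


-- The claimed vectors solve the moved system

module MovedSystem (ℝ : RealNumbers) {n m k} (N : Plabic.Network ℝ n m k)
                   (pn : Plabic.IsPlabicNetwork ℝ N) {𝔩 : Plabic.Point ℝ}
                   (g : Plabic.IsGaugeDirection ℝ N 𝔩) (sq : Plabic.Square ℝ N)
                   (F : Plabic.EdgeFamily ℝ {n} {m} {k}) (F-solves : Plabic.SolvesEdgeSystem ℝ N g F) where

  open Plabic ℝ
  open Network N
  open IsPlabicNetwork pn
  open Square sq
  open SignCalculus
  open OrderedField ℝ
  open Turning ℝ 𝔩
  open Parity
  open SignedUnits ℝ
  open CornerEdges ℝ N pn
  open SquareGraph ℝ N pn sq
  open IntersectionParity ℝ N g
  open Incidence ℝ N using (∈out)

  g̃ : IsGaugeDirection Ñ 𝔩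
  g̃ = squareMove-gauge N sq g

  private
    module Old = EdgeSystem ℝ N g
    module New = EdgeSystem ℝ Ñ g̃
  open Old using (transverse)

  ≈ᵥ-refl : ∀ {u} → u ≈ᵥ u
  ≈ᵥ-refl = refl , refl

  ≈ᵥ-reflexive : ∀ {u v} → u ≡ v → u ≈ᵥ v
  ≈ᵥ-reflexive ≡.refl = ≈ᵥ-refl

  neg-- : ∀ {u v} → -ᵥ (u -ᵥ v) ≈ᵥ v -ᵥ u
  neg-- = PlaneLemmas.neg-- _ _ , PlaneLemmas.neg-- _ _

  ≈ᵥ-sym : ∀ {u v} → u ≈ᵥ v → v ≈ᵥ u
  ≈ᵥ-sym (p , q) = sym p , sym q

  neg-neg : ∀ {u} → -ᵥ (-ᵥ u) ≈ᵥ u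
  neg-neg = -‿involutive _ , -‿involutive _
    where open RingProperties ring using (-‿involutive)

  transverse-neg : ∀ {u} → Transverse u → Transverse (-ᵥ u)
  transverse-neg {u} tu eq = tu (neg-zero _ (≡.trans (≡.sym (sg-cross-negˡ u 𝔩)) eq))
    where
    neg-zero : ∀ t → neg t ≡ ⊙ → t ≡ ⊙
    neg-zero ⊙ _ = ≡.refl

  cyclic-cong : ∀ {u v w u′ v′ w′} → u ≈ᵥ u′ → v ≈ᵥ v′ → w ≈ᵥ w′ → CyclicCCW u v w → CyclicCCW u′ v′ w′
  cyclic-cong {u} {v} {w} {u′} {v′} {w′} p q r cyc = ccw
    (≡.subst₂ (λ x y → Cyclic x y [ w′ , u′ ]) (sg-cross-cong {u} {u′} {v} {v′} p q) (sg-cross-cong {v} {v′} {w} {w′} q r)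
      (≡.subst (Cyclic [ u , v ] [ v , w ]) (sg-cross-cong {w} {w′} {u} {u′} r p) (cyclic {u} {v} {w} cyc)))

  dir-≡ : ∀ {e u v} → src e ≡ u → tgt e ≡ v → dir e ≡ pos v -ᵥ pos u
  dir-≡ p q = ≡.cong₂ (λ u v → pos v -ᵥ pos u) p q

  H₁ H₂ H₃ H₄ : Point
  H₁ = dir h₁
  H₂ = dir h₂
  H₃ = dir h₃
  H₄ = dir h₄

  γ t₁₃ t₃₄ t₄₂ t₂₁ t₂₄ t₁₂ : Sign
  γ   = side H₄
  t₁₃ = τ H₁ H₃
  t₃₄ = τ H₃ H₄
  t₄₂ = τ H₄ (-ᵥ H₂)
  t₂₁ = τ (-ᵥ H₂) H₁
  t₂₄ = τ H₂ (-ᵥ H₄)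
  t₁₂ = τ (-ᵥ H₁) H₂

  -- The clockwise tour S, P, Q, R follows `h₁`, `h₃`, `h₄` and returns against `h₂`.
  around : t₁₃ · t₃₄ · t₄₂ · t₂₁ ≡ Sign.- × Reversible H₄ (-ᵥ H₂) × Reversible (-ᵥ H₂) H₁
  around = convert (≡.sym (dir-≡ h₁-src h₁-tgt)) (≡.sym (dir-≡ h₃-src h₃-tgt)) (≡.sym (dir-≡ h₄-src h₄-tgt)) H₂≈
    (λ a b c d → quadrilateral-turns (internal S) (internal P) (internal Q) (internal R) a b c d quadrilateral)
    where
    H₂≈ : internal S -ᵥ internal R ≈ᵥ -ᵥ H₂
    H₂≈ = ≡.subst (λ u → internal S -ᵥ internal R ≈ᵥ -ᵥ u) (≡.sym (dir-≡ h₂-src h₂-tgt)) (≈ᵥ-sym neg--)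

    convert : ∀ {a b c d} → a ≡ H₁ → b ≡ H₃ → c ≡ H₄ → d ≈ᵥ -ᵥ H₂ →
      (Transverse a → Transverse b → Transverse c → Transverse d →
       τ a b · τ b c · τ c d · τ d a ≡ Sign.- × Reversible c d × Reversible d a) →
      t₁₃ · t₃₄ · t₄₂ · t₂₁ ≡ Sign.- × Reversible H₄ (-ᵥ H₂) × Reversible (-ᵥ H₂) H₁
    convert {d = d} ≡.refl ≡.refl ≡.refl eq turns =
      let j , r , r′ = turns (transverse h₁) (transverse h₃) (transverse h₄)
                         (λ p → transverse-neg (transverse h₂) (≡.trans (≡.sym (sg-cross-cong eq ≈ᵥ-refl)) p))
      in ≡.trans (≡.cong₂ (λ x y → t₁₃ · t₃₄ · x · y) (τ-cong (≈ᵥ-refl {H₄}) (≈ᵥ-sym eq)) (τ-cong (≈ᵥ-sym eq) (≈ᵥ-refl {H₁}))) j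
       , (λ p → ≡.trans (r (≡.trans (sg-cross-cong (≈ᵥ-refl {H₄}) eq) p)) (side-cong eq))
       , (λ p → ≡.trans (side-cong (≈ᵥ-sym eq)) (r′ (≡.trans (sg-cross-cong eq (≈ᵥ-refl {H₁})) p)))

  -- Replaces the passage of the tour at R by the winding of `h₂` and `-h₄` in the claimed formulas;
  -- `reversal₂₁` does the same at S for `-h₁` and `h₂`.
  reversal₄₂ : t₄₂ · t₂₄ ≡ γ · opposite (side H₂)
  reversal₄₂ = ≡.trans (≡.cong (t₄₂ ·_) (τ-cong (≈ᵥ-sym neg-neg) ≈ᵥ-refl))
    (≡.trans (τ-reverse H₄ (-ᵥ H₂) (transverse h₄) (transverse-neg (transverse h₂)) (proj₁ (proj₂ around)))
             (≡.cong (γ ·_) (side-neg H₂ (transverse h₂))))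

  reversal₂₁ : t₂₁ · t₁₂ ≡ opposite (side H₂) · side H₁
  reversal₂₁ = ≡.trans (≡.cong (t₂₁ ·_) (τ-cong ≈ᵥ-refl (≈ᵥ-sym neg-neg)))
    (≡.trans (τ-reverse (-ᵥ H₂) H₁ (transverse-neg (transverse h₂)) (transverse h₁) (proj₂ (proj₂ around)))
             (≡.cong (_· side H₁) (side-neg H₂ (transverse h₂))))

  -- `τ-vertex` with `h₂` and `h₁` leaving S, in the cyclic order supplied by `corner-edge`; the
  -- tour then links S to the windings at Q and R.
  turns-at-S : ∀ e → tgt e ≡ inj₂ S → Outer e →
               τ (dir e) H₁ · t₁₃ ≡ opposite (τ (dir e) H₂ · (γ · t₂₄ · t₃₄))
  turns-at-S e eq o =
    signs-at-S (τ (dir e) H₁) (τ (dir e) H₂) t₁₃ t₃₄ t₄₂ t₂₁ t₂₄ (side H₂) γ (proj₁ around) reversal₄₂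
      (τ-vertex (dir e) H₂ H₁ (transverse e) (transverse h₂) (transverse h₁)
        (cyclic-cong (≈ᵥ-reflexive (≡.sym (dir-≡ h₂-src h₂-tgt))) (≈ᵥ-reflexive (≡.sym (dir-≡ h₁-src h₁-tgt)))
          (≡.subst (λ u → pos (src e) -ᵥ internal S ≈ᵥ -ᵥ u) (≡.sym (dir-≡ ≡.refl eq)) (≈ᵥ-sym neg--))
          (corner-edge (inj₁ (h₁-src , h₁-tgt)) (inj₁ (h₂-src , h₂-tgt)) (inj₂ (≡.refl , eq))
            (Outer.≢h₁ o) (Outer.≢h₂ o) quadrilateral face)))

  -- `τ-vertex` with `-h₁` and `h₃`, the edges leaving P after the move. The corner S enters as
  -- well, because `-h₁` continues along `h₂`.
  turns-at-P : ∀ e → tgt e ≡ inj₂ P → Outer e →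
               τ (dir e) (-ᵥ H₁) · t₁₂ ≡ opposite (τ (dir e) H₃ · (γ · t₂₄ · t₃₄))
  turns-at-P e eq o =
    signs-at-P (τ (dir e) (-ᵥ H₁)) (τ (dir e) H₃) t₁₃ t₃₄ t₄₂ t₂₁ t₂₄ t₁₂ (side H₁) (side H₂) γ
      (proj₁ around) reversal₄₂ reversal₂₁
      (≡.trans (≡.cong₂ (λ x y → τ (dir e) H₃ · x · τ (dir e) (-ᵥ H₁) · y)
                 (τ-cong (≈ᵥ-sym neg-neg) ≈ᵥ-refl) (≡.sym (side-neg H₁ (transverse h₁))))
        (τ-vertex (dir e) (-ᵥ H₁) H₃ (transverse e) (transverse-neg (transverse h₁)) (transverse h₃)
          (cyclic-cong
            (≡.subst (λ u → internal S -ᵥ internal P ≈ᵥ -ᵥ u) (≡.sym (dir-≡ h₁-src h₁-tgt)) (≈ᵥ-sym neg--))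
            (≈ᵥ-reflexive (≡.sym (dir-≡ h₃-src h₃-tgt)))
            (≡.subst (λ u → pos (src e) -ᵥ internal P ≈ᵥ -ᵥ u) (≡.sym (dir-≡ ≡.refl eq)) (≈ᵥ-sym neg--))
            (corner-edge (inj₁ (h₃-src , h₃-tgt)) (inj₂ (h₁-src , h₁-tgt)) (inj₂ (≡.refl , eq))
              (Outer.≢h₃ o) (Outer.≢h₁ o) (rotate-quadrilateral quadrilateral)
              (λ e on i → face e on (rotate-region i))))))

  α≉0 : ∀ e → ¬ (weight e ≈ 0#)
  α≉0 e = 0<⇒≉0 (weight-positive e)

  α̃₂≉0 : ¬ (α̃₂ ≈ 0#)
  α̃₂≉0 = 0<⇒≉0 (+-pos (weight-positive h₂)
    (*-pos (*-pos (weight-positive h₁) (weight-positive h₃)) (weight-positive h₄)))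

  module G (i : Fin n) =
    SquareAlgebra.Moved ℝ α₁ α₂ α₃ α₄ (ι h₁) (ι h₂) (ι h₃) (ι h₄) γ t₃₄ t₂₄ t₁₂ (F h₃ i) (F h₄ i)

  E : EdgeFamily {n} {m} {k}
  E e i = onSquare (G.G₁ i) (G.G₂ i) (G.G₃ i) (G.G₄ i) (λ e → F e i) e

  module _ (i : Fin n) where

    F₁-eq : F h₁ i ≈ ⟦ ι h₁ ⟧ * α₁ * (⟦ t₁₃ ⟧ * F h₃ i)
    F₁-eq = trans (Old.at-internal-RHS F-solves h₁ P h₁-tgt i)
      (Old.RHS-one F i h₃-src out-P ≡.refl ≡.refl ≈ᵥ-refl ≈ᵥ-refl ≡.refl)

    F₂-eq : F h₂ i ≈ ⟦ ι h₂ ⟧ * α₂ * (⟦ τ H₂ (dir e₃) ⟧ * F e₃ i)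
    F₂-eq = trans (Old.at-internal-RHS F-solves h₂ R h₂-tgt i)
      (Old.RHS-one F i e₃-src out-R ≡.refl ≡.refl ≈ᵥ-refl ≈ᵥ-refl ≡.refl)

    F₃-eq : F h₃ i ≈ ⟦ ι h₃ ⟧ * α₃ * (⟦ t₃₄ ⟧ * F h₄ i + ⟦ τ H₃ (dir e₄) ⟧ * F e₄ i)
    F₃-eq = trans (Old.at-internal-RHS F-solves h₃ Q h₃-tgt i)
      (Old.RHS-two F i (λ p → e₄≢h₄ (≡.sym p)) h₄-src e₄-src out-Q ≡.refl ≡.refl ≈ᵥ-refl ≈ᵥ-refl ≈ᵥ-refl ≡.refl ≡.refl)

    F₄-eq : F h₄ i ≈ ⟦ ι h₄ ⟧ * α₄ * (⟦ τ H₄ (dir e₃) ⟧ * F e₃ i)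
    F₄-eq = trans (Old.at-internal-RHS F-solves h₄ R h₄-tgt i)
      (Old.RHS-one F i e₃-src out-R ≡.refl ≡.refl ≈ᵥ-refl ≈ᵥ-refl ≡.refl)

    module Eq = G.Solved i (α≉0 h₁) (α≉0 h₃) (α≉0 h₄) α̃₂≉0
      (Intersections.even-quadrilateral ℝ N pn g h₁ h₃ h₄ h₂
        h₁-src h₁-tgt h₃-src h₃-tgt h₄-src h₄-tgt h₂-src h₂-tgt)
      (τ H₃ (dir e₄)) (τ (-ᵥ H₄) (dir e₄)) (τ H₂ (dir e₃)) (τ H₄ (dir e₃)) (F e₃ i) (F e₄ i)
      (τ-vertex H₃ H₄ (dir e₄) (transverse h₃) (transverse h₄) (transverse e₄) cyclic-at-Q)
      (τ-merge H₂ H₄ (dir e₃) (transverse h₂) (transverse h₄) (transverse e₃) cyclic-at-R)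
      F₃-eq F₄-eq

  ι̃ : ∀ e → IntersectionParity.ι ℝ Ñ g̃ e ≡ ι e
  ι̃ e = ≡.trans (≡.sym (IntersectionParity.ι-int ℝ Ñ g̃ e))
    (≡.trans (≡.cong parityℤ (int-preserved g e)) (ι-int e))

  H̃₁ : d̃ir h₁ ≈ᵥ -ᵥ H₁
  H̃₁ = d̃ir-reversed reversed-h₁
  H̃₂ : d̃ir h₂ ≈ᵥ H₂
  H̃₂ = ≈ᵥ-reflexive (d̃ir-unreversed unreversed-h₂)
  H̃₃ : d̃ir h₃ ≈ᵥ H₃
  H̃₃ = ≈ᵥ-reflexive (d̃ir-unreversed unreversed-h₃)
  H̃₄ : d̃ir h₄ ≈ᵥ -ᵥ H₄
  H̃₄ = d̃ir-reversed reversed-h₄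
  d̃ir-outer : ∀ {e} → Outer e → d̃ir e ≈ᵥ dir e
  d̃ir-outer o = ≈ᵥ-reflexive (d̃ir-unreversed (unreversed-outer o))

  w̃eight-outer : ∀ {e} → Outer e → w̃eight e ≡ weight e
  w̃eight-outer = onSquare-outer α̃₁ α̃₂ α̃₃ α̃₄ weight

  module _ (i : Fin n) where
    open G i using (G₁; G₂; G₃; G₄)

    E-h₁ : E h₁ i ≡ G₁
    E-h₁ = onSquare-h₁ G₁ G₂ G₃ G₄ (λ e → F e i)
    E-h₂ : E h₂ i ≡ G₂
    E-h₂ = onSquare-h₂ G₁ G₂ G₃ G₄ (λ e → F e i)
    E-h₃ : E h₃ i ≡ G₃
    E-h₃ = onSquare-h₃ G₁ G₂ G₃ G₄ (λ e → F e i)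
    E-h₄ : E h₄ i ≡ G₄
    E-h₄ = onSquare-h₄ G₁ G₂ G₃ G₄ (λ e → F e i)
    E-outer : ∀ {e} → Outer e → E e i ≡ F e i
    E-outer = onSquare-outer G₁ G₂ G₃ G₄ (λ e → F e i)

    equation-h₁ : E h₁ i ≈ New.RHS E h₁ S i
    equation-h₁ = trans (reflexive E-h₁) (trans (Eq.at-h₁ i) (sym
      (New.RHS-one E i (≡.trans (s̃rc-unreversed unreversed-h₂) h₂-src) õut-S (ι̃ h₁)
        (onSquare-h₁ α̃₁ α̃₂ α̃₃ α̃₄ weight) H̃₁ H̃₂ E-h₂)))

    equation-h₂ : E h₂ i ≈ New.RHS E h₂ R i
    equation-h₂ = trans (reflexive E-h₂) (trans (Eq.at-h₂ i) (sym
      (New.RHS-two E i (λ p → Outer.≢h₄ e₃-outer (≡.sym p)) h₄-s̃rc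
        (≡.trans (s̃rc-unreversed (unreversed-outer e₃-outer)) e₃-src) õut-R (ι̃ h₂)
        (onSquare-h₂ α̃₁ α̃₂ α̃₃ α̃₄ weight) H̃₂ H̃₄ (d̃ir-outer e₃-outer) E-h₄ (E-outer e₃-outer))))

    equation-h₃ : E h₃ i ≈ New.RHS E h₃ Q i
    equation-h₃ = trans (reflexive E-h₃) (trans (Eq.at-h₃ i) (sym
      (New.RHS-one E i (≡.trans (s̃rc-unreversed (unreversed-outer e₄-outer)) e₄-src) õut-Q (ι̃ h₃)
        (onSquare-h₃ α̃₁ α̃₂ α̃₃ α̃₄ weight) H̃₃ (d̃ir-outer e₄-outer) (E-outer e₄-outer))))

    equation-h₄ : E h₄ i ≈ New.RHS E h₄ Q i
    equation-h₄ = trans (reflexive E-h₄) (trans (Eq.at-h₄ i) (sym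
      (New.RHS-one E i (≡.trans (s̃rc-unreversed (unreversed-outer e₄-outer)) e₄-src) õut-Q (ι̃ h₄)
        (onSquare-h₄ α̃₁ α̃₂ α̃₃ α̃₄ weight) H̃₄ (d̃ir-outer e₄-outer) (E-outer e₄-outer))))

    equation-into-S : ∀ e → Outer e → tgt e ≡ inj₂ S → E e i ≈ New.RHS E e S i
    equation-into-S e o eq = trans (reflexive (E-outer o)) (trans (Old.at-internal-RHS F-solves e S eq i)
      (trans (Old.RHS-two F i h₁≢h₂ h₁-src h₂-src out-S ≡.refl ≡.refl ≈ᵥ-refl ≈ᵥ-refl ≈ᵥ-refl ≡.refl ≡.refl)
      (trans (*-congˡ (Eq.into-S i (τ (dir e) H₁) (τ (dir e) H₂) t₁₃ (turns-at-S e eq o) (F₁-eq i) (F₂-eq i)))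
      (sym (New.RHS-one E i (≡.trans (s̃rc-unreversed unreversed-h₂) h₂-src) õut-S (ι̃ e)
        (w̃eight-outer o) (d̃ir-outer o) H̃₂ E-h₂)))))

    equation-into-P : ∀ e → Outer e → tgt e ≡ inj₂ P → E e i ≈ New.RHS E e P i
    equation-into-P e o eq = trans (reflexive (E-outer o)) (trans (Old.at-internal-RHS F-solves e P eq i)
      (trans (Old.RHS-one F i h₃-src out-P ≡.refl ≡.refl ≈ᵥ-refl ≈ᵥ-refl ≡.refl)
      (trans (*-congˡ (Eq.into-P i (τ (dir e) (-ᵥ H₁)) (τ (dir e) H₃) (turns-at-P e eq o)))
      (sym (New.RHS-two E i h₁≢h₃ h₁-s̃rc (≡.trans (s̃rc-unreversed unreversed-h₃) h₃-src) õut-P (ι̃ e)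
        (w̃eight-outer o) (d̃ir-outer o) H̃₁ H̃₃ E-h₁ E-h₃)))))

    -- Away from the square both networks have the same outgoing edges, all of them outer, so the
    -- old equation carries over term by term.
    equation-off : ∀ e v → Outer e → ¬ OnSquare v → tgt e ≡ inj₂ v → E e i ≈ New.RHS E e v i
    equation-off e v o off eq = trans (reflexive (E-outer o)) (trans (Old.at-internal-RHS F-solves e v eq i)
      (trans (Old.RHS-out F i ≡.refl ≡.refl ≡.refl ≈ᵥ-refl (λ _ → refl))
      (sym (New.RHS-out E i out≡ (ι̃ e) (w̃eight-outer o) (d̃ir-outer o) (λ f∈ →
        let o′ = outer-from off (∈out f∈)
        in *-cong (reflexive (≡.cong ⟦_⟧ (τ-cong (≈ᵥ-refl {dir e}) (d̃ir-outer o′)))) (reflexive (E-outer o′)))))))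
      where
      out≡ : Network.outEdges Ñ (inj₂ v) ≡ outEdges (inj₂ v)
      out≡ = filter-≐ (λ f → s̃rc f ≟ᵛ inj₂ v) (λ f → src f ≟ᵛ inj₂ v)
        ((λ {f} → õut-off off f) ,
         (λ {f} p → ≡.trans (s̃rc-unreversed (unreversed-outer (outer-from off p))) p)) (allFin k)

    equation : ∀ e v → t̃gt e ≡ inj₂ v → E e i ≈ New.RHS E e v i
    equation e v eq = case (position e)
      where
      at : ∀ {u} → E e i ≈ New.RHS E e u i → u ≡ v → E e i ≈ New.RHS E e v i
      at q ≡.refl = q

      case : Position e → E e i ≈ New.RHS E e v i
      case (is-h₁ ≡.refl) = at equation-h₁ (inj₂-injective (≡.trans (≡.sym h₁-t̃gt) eq))
      case (is-h₂ ≡.refl) = at equation-h₂ (inj₂-injective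
        (≡.trans (≡.sym (≡.trans (t̃gt-unreversed unreversed-h₂) h₂-tgt)) eq))
      case (is-h₃ ≡.refl) = at equation-h₃ (inj₂-injective
        (≡.trans (≡.sym (≡.trans (t̃gt-unreversed unreversed-h₃) h₃-tgt)) eq))
      case (is-h₄ ≡.refl) = at equation-h₄ (inj₂-injective (≡.trans (≡.sym h₄-t̃gt) eq))
      case (is-outer o) = ends (onSquare? v)
        where
        tgt-e : tgt e ≡ inj₂ v
        tgt-e = ≡.trans (≡.sym (t̃gt-unreversed (unreversed-outer o))) eq

        ends : Dec (OnSquare v) → E e i ≈ New.RHS E e v i
        ends (no off)            = equation-off e v o off tgt-e
        ends (yes (is-S ≡.refl)) = equation-into-S e o tgt-e
        ends (yes (is-P ≡.refl)) = equation-into-P e o tgt-e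
        -- No outer edge ends at Q or R: before the move only `h₃` enters Q, and only `h₂` and `h₄`
        -- enter R.
        ends (yes (is-Q ≡.refl)) = contradiction (in-Q e tgt-e) (Outer.≢h₃ o)
        ends (yes (is-R ≡.refl)) with in-R e tgt-e
        ... | inj₁ p = contradiction p (Outer.≢h₂ o)
        ... | inj₂ p = contradiction p (Outer.≢h₄ o)

    sink : ∀ e j → t̃gt e ≡ inj₁ j → E e i ≈ ⟦ IntersectionParity.ι ℝ Ñ g̃ e ⟧ * w̃eight e * canonical N g j i
    sink e j eq = case (position e)
      where
      absurd : ∀ {u} → t̃gt e ≡ inj₂ u → E e i ≈ ⟦ IntersectionParity.ι ℝ Ñ g̃ e ⟧ * w̃eight e * canonical N g j i
      absurd p = contradiction (≡.trans (≡.sym eq) p) λ ()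

      case : Position e → E e i ≈ ⟦ IntersectionParity.ι ℝ Ñ g̃ e ⟧ * w̃eight e * canonical N g j i
      case (is-h₁ ≡.refl) = absurd h₁-t̃gt
      case (is-h₂ ≡.refl) = absurd (≡.trans (t̃gt-unreversed unreversed-h₂) h₂-tgt)
      case (is-h₃ ≡.refl) = absurd (≡.trans (t̃gt-unreversed unreversed-h₃) h₃-tgt)
      case (is-h₄ ≡.refl) = absurd h₄-t̃gt
      case (is-outer o) = trans (reflexive (E-outer o))
        (trans (Old.at-sink-ι F-solves e j (≡.trans (≡.sym (t̃gt-unreversed (unreversed-outer o))) eq) i)
        (*-congʳ (*-cong (reflexive (≡.cong ⟦_⟧ (≡.sym (ι̃ e)))) (reflexive (≡.sym (w̃eight-outer o))))))

  E-solves : SolvesEdgeSystem Ñ g̃ E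
  E-solves = New.solves-RHS (λ e v eq i → equation i e v eq) (λ e j eq i → sink i e j eq)

-- From signs back to the exponents of the claim

module MovedVectors (ℝ : RealNumbers) {n m k} (N : Plabic.Network ℝ n m k)
                    (pn : Plabic.IsPlabicNetwork ℝ N) {𝔩 : Plabic.Point ℝ}
                    (g : Plabic.IsGaugeDirection ℝ N 𝔩) (sq : Plabic.Square ℝ N)
                    (F : Plabic.EdgeFamily ℝ {n} {m} {k}) (F-solves : Plabic.SolvesEdgeSystem ℝ N g F) where

  open Plabic ℝ
  open Network N
  open Square sq using (α₁; α₂; α₃; α₄; α̃₁; α̃₄)
  open Turning ℝ 𝔩
  open Parity
  open SignedUnits ℝ
  open IntersectionParity ℝ N g
  open EdgeSystem ℝ N g using (transverse)
  open MovedSystem ℝ N pn g sq F F-solves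
  open Exponents ℝ 𝔩

  -- The edges are projections of sq: under names opened from sq, the equality of
  -- two values of int is only found by unfolding them.
  private
    h₄-γ : parityℤ (γ₂ 𝔩 H₄) ≡ γ
    h₄-γ = parity-γ₂ H₄

    wd₃₄ : parityℤ (wind 𝔩 H₃ H₄) ≡ t₃₄
    wd₃₄ = parity-wind H₃ H₄ (transverse (Square.h₃ sq)) (transverse (Square.h₄ sq))

    wd₂₄ : parityℤ (wind 𝔩 H₂ (-ᵥ H₄)) ≡ t₂₄
    wd₂₄ = parity-wind H₂ (-ᵥ H₄) (transverse (Square.h₂ sq)) (transverse-neg (transverse (Square.h₄ sq)))

    wd₁₂ : parityℤ (wind 𝔩 (-ᵥ H₁) H₂) ≡ t₁₂
    wd₁₂ = parity-wind (-ᵥ H₁) H₂ (transverse-neg (transverse (Square.h₁ sq))) (transverse (Square.h₂ sq))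

    exponent-K : ⟦ ι (Square.h₃ sq) · ι (Square.h₄ sq) · γ · t₃₄ · Sign.- ⟧
                 ≈ [-1]^ (int N g (Square.h₃ sq) ℤ.+ int N g (Square.h₄ sq) ℤ.+ γ₂ 𝔩 H₄ ℤ.+ wind 𝔩 H₃ H₄ ℤ.+ 1ℤ)
    exponent-K = sign-power₅ (int N g (Square.h₃ sq)) (int N g (Square.h₄ sq)) (γ₂ 𝔩 H₄) (wind 𝔩 H₃ H₄) 1ℤ
      (ι-int (Square.h₃ sq)) (ι-int (Square.h₄ sq)) h₄-γ wd₃₄ ≡.refl

  module _ (F̃ : EdgeFamily {n} {m} {k}) (unique : ∀ e i → E e i ≈ F̃ e i) (i : Fin n) where

    private
      moved-h₂ : G.G₂ i ≈ F̃ (Square.h₂ sq) i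
      moved-h₂ = trans (sym (reflexive (E-h₂ i))) (unique (Square.h₂ sq) i)

      moved-h₄ : G.G₄ i ≈ F̃ (Square.h₄ sq) i
      moved-h₄ = trans (sym (reflexive (E-h₄ i))) (unique (Square.h₄ sq) i)

    move-h₄ : F̃ (Square.h₄ sq) i ≈
        α̃₄ * α₃ ⁻¹ * [-1]^ (int N g (Square.h₃ sq) ℤ.+ int N g (Square.h₄ sq) ℤ.+ γ₂ 𝔩 H₄ ℤ.+ wind 𝔩 H₃ H₄ ℤ.+ 1ℤ)
        * F (Square.h₃ sq) i
      + α̃₄ * [-1]^ (int N g (Square.h₄ sq) ℤ.+ γ₂ 𝔩 H₄) * F (Square.h₄ sq) i
    move-h₄ = trans (sym moved-h₄) (G.G₄-cong i exponent-K
      (sign-power₂ (int N g (Square.h₄ sq)) (γ₂ 𝔩 H₄) (ι-int (Square.h₄ sq)) h₄-γ))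

    move-h₂ : F̃ (Square.h₂ sq) i ≈
        α₁ * [-1]^ (int N g (Square.h₁ sq) ℤ.+ γ₂ 𝔩 H₄ ℤ.+ wind 𝔩 H₂ (-ᵥ H₄) ℤ.+ wind 𝔩 H₃ H₄ ℤ.+ 1ℤ)
        * F (Square.h₃ sq) i
      + α₂ * α₄ ⁻¹ * [-1]^ (1ℤ ℤ.+ int N g (Square.h₂ sq) ℤ.+ int N g (Square.h₄ sq) ℤ.+ γ₂ 𝔩 H₄ ℤ.+ wind 𝔩 H₂ (-ᵥ H₄))
        * F (Square.h₄ sq) i
    move-h₂ = trans (sym moved-h₂) (G.G₂-cong i
      (sign-power₅ (int N g (Square.h₁ sq)) (γ₂ 𝔩 H₄) (wind 𝔩 H₂ (-ᵥ H₄)) (wind 𝔩 H₃ H₄) 1ℤ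
        (ι-int (Square.h₁ sq)) h₄-γ wd₂₄ wd₃₄ ≡.refl)
      (sign-power₅ 1ℤ (int N g (Square.h₂ sq)) (int N g (Square.h₄ sq)) (γ₂ 𝔩 H₄) (wind 𝔩 H₂ (-ᵥ H₄))
        ≡.refl (ι-int (Square.h₂ sq)) (ι-int (Square.h₄ sq)) h₄-γ wd₂₄))

    move-h₁ : F̃ (Square.h₁ sq) i ≈ α̃₁ * [-1]^ (int N g (Square.h₁ sq) ℤ.+ wind 𝔩 (-ᵥ H₁) H₂) * F̃ (Square.h₂ sq) i
    move-h₁ = trans (sym (unique (Square.h₁ sq) i)) (trans (reflexive (E-h₁ i))
      (G.G₁-cong i (sign-power₂ (int N g (Square.h₁ sq)) (wind 𝔩 (-ᵥ H₁) H₂) (ι-int (Square.h₁ sq)) wd₁₂) moved-h₂))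

    move-h₃ : F̃ (Square.h₃ sq) i ≈
      [-1]^ (int N g (Square.h₃ sq) ℤ.+ int N g (Square.h₄ sq) ℤ.+ γ₂ 𝔩 H₄ ℤ.+ wind 𝔩 H₃ H₄ ℤ.+ 1ℤ)
      * (α₂ * α₁ ⁻¹) * F̃ (Square.h₄ sq) i
    move-h₃ = trans (sym (unique (Square.h₃ sq) i)) (trans (reflexive (E-h₃ i)) (G.G₃-cong i exponent-K moved-h₄))

lemma5p1 : (ℝ : RealNumbers) → let open Plabic ℝ in
  (n m k : ℕ) (N : Network n m k) → IsPlabicNetwork N →
  (𝔩 : Point) (g : IsGaugeDirection N 𝔩) (sq : Square N) →
  let open Network N using (dir)
      open Square sq
      Ñ = squareMove N sq
      g̃ = squareMove-gauge N sq g
      ι = int N g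
      γ = γ₂ 𝔩
      wd = wind 𝔩
  in
  (F F̃ : EdgeFamily {n} {m} {k}) → AreEdgeVectors N g F → AreEdgeVectors Ñ g̃ F̃ →
  ∀ i →
    (F̃ h₄ i ≈
        α̃₄ * α₃ ⁻¹ * [-1]^ (ι h₃ +ℤ ι h₄ +ℤ γ (dir h₄) +ℤ wd (dir h₃) (dir h₄) +ℤ 1ℤ) * F h₃ i
      + α̃₄ * [-1]^ (ι h₄ +ℤ γ (dir h₄)) * F h₄ i)
  × (F̃ h₂ i ≈
        α₁ * [-1]^ (ι h₁ +ℤ γ (dir h₄) +ℤ wd (dir h₂) (-ᵥ dir h₄) +ℤ wd (dir h₃) (dir h₄) +ℤ 1ℤ) * F h₃ i
      + α₂ * α₄ ⁻¹ * [-1]^ (1ℤ +ℤ ι h₂ +ℤ ι h₄ +ℤ γ (dir h₄) +ℤ wd (dir h₂) (-ᵥ dir h₄)) * F h₄ i)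
  × (F̃ h₁ i ≈ α̃₁ * [-1]^ (ι h₁ +ℤ wd (-ᵥ dir h₁) (dir h₂)) * F̃ h₂ i)
  × (F̃ h₃ i ≈
        [-1]^ (ι h₃ +ℤ ι h₄ +ℤ γ (dir h₄) +ℤ wd (dir h₃) (dir h₄) +ℤ 1ℤ) * (α₂ * α₁ ⁻¹) * F̃ h₄ i)
lemma5p1 ℝ n m k N pn 𝔩 g sq F F̃ F-edge F̃-edge i =
  M.move-h₄ F̃ unique i , M.move-h₂ F̃ unique i , M.move-h₁ F̃ unique i , M.move-h₃ F̃ unique i
  where
  F-solves = Plabic.AreEdgeVectors.solves F-edge
  module S = MovedSystem ℝ N pn g sq F F-solves
  module M = MovedVectors ℝ N pn g sq F F-solves
  unique = Plabic.AreEdgeVectors.unique F̃-edge S.E S.E-solves
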